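{- For any Eulerian graph $G$: (1) $c_{2,\mathrm{top}}(G) = \frac{\Delta(G)}{2}$, provided $G$ is not a union of two or more vertex-disjoint cycles; (2) $c_{2,\mathrm{iso}}(G) \leq \mathrm{la}(G)$; (3) $c_2(G) \leq \Delta(G)$.
   Context: All graphs are finite and simple. A graph is Eulerian if every vertex has even degree (not necessarily connected). For an Eulerian graph $G=(V,E)$, a cycle odd-cover of $G$ is a collection of cycles in the complete graph on $V$ whose edge sets have symmetric difference equal to $E$; $c_2(G)$ is the minimum cardinality of a cycle odd-cover. $c_{2,\mathrm{top}}(G)$ is the minimum of $c_2(H)$ over all subdivisions $H$ of $G$ (including $G$). $c_{2,\mathrm{iso}}(G)$ is the minimum of $c_2(H)$ over all graphs $H$ obtained from $G$ by adding (any number of) isolated vertices. $\Delta(G)$ is the maximum degree. A linear forest is a graph each of whose components is a path; $\mathrm{la}(G)$ is the minimum number of edge-disjoint linear forests whose union is $E(G)$. -}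

module Defs where

open import Data.Nat using (ℕ; zero; suc; _+_; _≤_; _⊔_)
open import Data.Nat.Divisibility using (_∣_)
open import Data.Fin using (Fin; zero; suc; _≟_)
open import Data.Bool using (Bool; true; false; _∧_; _∨_; _xor_; if_then_else_; not)
open import Data.List using (List; []; _∷_; length; foldr; map; allFin)
open import Data.Nat.ListAction using (sum)
open import Data.List.Relation.Unary.Unique.Propositional using (Unique)
open import Data.List.Relation.Unary.AllPairs using (AllPairs)
open import Data.List.Membership.Propositional using (_∈_; _∉_)
open import Data.Product using (_×_; _,_; proj₁; proj₂; Σ; ∃; ∃-syntax)
open import Relation.Binary.PropositionalEquality using (_≡_; _≢_)
open import Relation.Nullary using (does; ¬_)

Adj : ℕ → Set
Adj n = Fin n → Fin n → Bool

record Graph (n : ℕ) : Set where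
  field
    adj    : Adj n
    sym    : ∀ u v → adj u v ≡ adj v u
    irrefl : ∀ v → adj v v ≡ false
open Graph public

deg : ∀ {n} → Graph n → Fin n → ℕ
deg {n} G v = sum (map (λ u → if adj G v u then 1 else 0) (allFin n))

Δ : ∀ {n} → Graph n → ℕ
Δ {n} G = foldr _⊔_ 0 (map (deg G) (allFin n))

Eulerian : ∀ {n} → Graph n → Set
Eulerian {n} G = ∀ (v : Fin n) → 2 ∣ deg G v

module _ {n : ℕ} where

  lastOr : Fin n → List (Fin n) → Fin n
  lastOr x []       = x
  lastOr x (y ∷ ys) = lastOr y ys

  pathPairs : List (Fin n) → List (Fin n × Fin n)
  pathPairs []           = []
  pathPairs (x ∷ [])     = []
  pathPairs (x ∷ y ∷ xs) = (x , y) ∷ pathPairs (y ∷ xs)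

  cyclePairs : List (Fin n) → List (Fin n × Fin n)
  cyclePairs []       = []
  cyclePairs (x ∷ xs) = (lastOr x xs , x) ∷ pathPairs (x ∷ xs)

  anyB : {A : Set} → (A → Bool) → List A → Bool
  anyB p []       = false
  anyB p (x ∷ xs) = p x ∨ anyB p xs

  hasEdge : List (Fin n × Fin n) → Adj n
  hasEdge ps u v = anyB (λ p → (does (u ≟ proj₁ p) ∧ does (v ≟ proj₂ p))
                             ∨ (does (v ≟ proj₁ p) ∧ does (u ≟ proj₂ p))) ps

  record Cycle : Set where
    field
      verts    : List (Fin n)
      distinct : Unique verts
      long     : 3 ≤ length verts

  cycleAdj : Cycle → Adj n
  cycleAdj c = hasEdge (cyclePairs (Cycle.verts c))

  record Path : Set where
    field
      verts    : List (Fin n)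
      distinct : Unique verts
      nonempty : 1 ≤ length verts

  pathAdj : Path → Adj n
  pathAdj p = hasEdge (pathPairs (Path.verts p))

  VertexDisjoint : List (Fin n) → List (Fin n) → Set
  VertexDisjoint xs ys = ∀ x → x ∈ xs → x ∉ ys

  symDiff : List Cycle → Adj n
  symDiff cs u v = foldr (λ c acc → cycleAdj c u v xor acc) false cs

  OddCover : Adj n → List Cycle → Set
  OddCover A cs = ∀ u v → symDiff cs u v ≡ A u v

  -- "c₂(A) ≤ k": some cycle odd-cover has at most k cycles
  -- (c₂ is the minimum cardinality of a cycle odd-cover)
  C2≤ : Adj n → ℕ → Set
  C2≤ A k = Σ (List Cycle) λ cs → OddCover A cs × length cs ≤ k

  C2≥ : Adj n → ℕ → Set
  C2≥ A k = ∀ (cs : List Cycle) → OddCover A cs → k ≤ length cs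

  DisjointCycleUnion : Graph n → Set
  DisjointCycleUnion G =
    Σ (List Cycle) λ cs →
        2 ≤ length cs
      × AllPairs (λ c d → VertexDisjoint (Cycle.verts c) (Cycle.verts d)) cs
      × (∀ u v → adj G u v ≡ anyB (λ c → cycleAdj c u v) cs)

  -- F is a linear forest: its edge set is the union of pairwise
  -- vertex-disjoint paths (these are its non-trivial components;
  -- vertices not on any listed path are isolated, i.e. trivial paths).
  LinearForest : Adj n → Set
  LinearForest F =
    Σ (List Path) λ ps →
        AllPairs (λ p q → VertexDisjoint (Path.verts p) (Path.verts q)) ps
      × (∀ u v → F u v ≡ anyB (λ p → pathAdj p u v) ps)

  -- E(G) is the union of k pairwise edge-disjoint linear forests
  -- ("la(G) ≤ k"; la is the minimum such k)
  LinearDecomp : Graph n → ℕ → Set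
  LinearDecomp G k =
    Σ (Fin k → Adj n) λ F →
        (∀ i → LinearForest (F i))
      × (∀ i j → i ≢ j → ∀ u v → F i u v ≡ true → F j u v ≡ false)
      × (∀ u v → adj G u v ≡ true → ∃[ i ] F i u v ≡ true)
      × (∀ i u v → F i u v ≡ true → adj G u v ≡ true)

-- Elementary subdivision: replace edge uv by a path u w v with a new
-- vertex w.  The new vertex is 'zero'; old vertex x becomes 'suc x'.

subdivide : ∀ {n} → Adj n → Fin n → Fin n → Adj (suc n)
subdivide A u v zero    zero    = false
subdivide A u v zero    (suc y) = does (y ≟ u) ∨ does (y ≟ v)
subdivide A u v (suc x) zero    = does (x ≟ u) ∨ does (x ≟ v)
subdivide A u v (suc x) (suc y) =
  A x y ∧ not ((does (x ≟ u) ∧ does (y ≟ v)) ∨ (does (x ≟ v) ∧ does (y ≟ u)))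

data Subdivision {n : ℕ} (A : Adj n) : (m : ℕ) → Adj m → Set where
  here : Subdivision A n A
  step : ∀ {m} {B : Adj m} → Subdivision A m B →
         (u v : Fin m) → B u v ≡ true →
         Subdivision A (suc m) (subdivide B u v)

C2top≡ : ∀ {n} → Graph n → ℕ → Set
C2top≡ G k =
    (Σ ℕ λ m → Σ (Adj m) λ H → Subdivision (adj G) m H × C2≤ H k)
  × (∀ m (H : Adj m) → Subdivision (adj G) m H → C2≥ H k)

addIso : ∀ {n} (j : ℕ) → Adj n → Adj (j + n)
addIso zero    A = A
addIso (suc j) A zero    y       = false
addIso (suc j) A (suc x) zero    = false
addIso (suc j) A (suc x) (suc y) = addIso j A x y

C2iso≤ : ∀ {n} → Graph n → ℕ → Set
C2iso≤ G k = Σ ℕ λ j → C2≤ (addIso j (adj G)) k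

{-# OPTIONS --safe #-}
module Submission where

-- An Eulerian graph of maximum degree 2k splits into k edge-disjoint unions of vertex-disjoint cycles (Petersen): orient it so that
-- in- and outdegrees agree, and colour the arcs by König's theorem, so that each colour class is a permutation with fixed points.
-- Two cycles suffice for a union of disjoint cycles D₁, …, Dᵣ: one traverses all of them with each closing edge left out, the other
-- consists of the closing edges, and the same linking edges complete both. This gives (3).
-- For (1), subdivide the closing edge of every Dᵢ into three. Two colour classes can then be covered by two cycles, each traversing
-- the members of one class and shortcutting those of the other along the middle edges; all classes are absorbed in turn into one cycle.
-- For (2), two paths of one linear forest are joined through a fresh vertex r. Their joined ends x and y are also path ends in other
-- forests, by parity, and those forests absorb the edges xr and ry. When each forest is a single path, one new hub vertex closes all.

open import Defs renaming (sym to adj-sym; irrefl to adj-irrefl)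
open import Algebra.Bundles using (CommutativeSemigroup)
import Algebra.Properties.CommutativeSemigroup as CommutativeSemigroupProperties
open import Algebra.Structures using (IsCommutativeMonoid)
open import Data.Bool using (Bool; true; false; _∧_; _∨_; _xor_; if_then_else_; not)
open import Data.Bool.Properties using (∨-comm; ∨-assoc; ∨-identityʳ; ∧-comm; ∧-zeroʳ; ∧-identityʳ; not-involutive; xor-assoc; xor-comm; xor-same; xor-identityʳ)
open import Data.Bool.Solver using (module xor-∧-Solver)
open import Data.Fin using (Fin; zero; suc; _≟_)
import Data.Fin.Properties as Fin
open import Data.List using (List; []; _∷_; _++_; length; map; foldr; concat; concatMap; drop; reverse; filter; tabulate; allFin)
open import Data.List.Properties using (++-assoc; ++-identityʳ; concat-++; concatMap-++; filter-notAll; length-++; length-map; length-reverse; length-tabulate; map-++; map-id; map-tabulate; map-∘; unfold-reverse)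
import Data.List.Membership.DecPropositional as DecMembership
open import Data.List.Membership.Propositional using (_∈_; _∉_)
open import Data.List.Membership.Propositional.Properties using (∈-allFin; ∈-++⁺ˡ; ∈-++⁺ʳ; ∈-++⁻; ∈-concatMap⁺; ∈-filter⁺; ∈-filter⁻; ∈-map⁺; ∈-map⁻)
open import Data.List.Relation.Binary.Permutation.Propositional using (_↭_; ↭-refl; ↭-prep; ↭-swap; ↭-trans; ↭-sym; ↭-reflexive; ↭⇒↭ₛ)
open import Data.List.Relation.Binary.Permutation.Propositional.Properties as Perm using (++⁺ʳ; ++⁺ˡ; shifts; ↭-length; ∈-resp-↭; All-resp-↭)
import Data.List.Relation.Binary.Permutation.Setoid.Properties as PermSetoid
open import Data.List.Relation.Binary.Pointwise as Pointwise using (Pointwise; []; _∷_)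
open import Data.List.Relation.Unary.All as All using (All; []; _∷_)
import Data.List.Relation.Unary.All.Properties as All
open import Data.List.Relation.Unary.AllPairs as AllPairs using (AllPairs; []; _∷_)
import Data.List.Relation.Unary.AllPairs.Properties as AllPairs
open import Data.List.Relation.Unary.Any as Any using (here; there)
open import Data.List.Relation.Unary.Unique.Propositional using (Unique)
import Data.List.Relation.Unary.Unique.Propositional.Properties as Unique
open import Data.Nat using (ℕ; zero; suc; _+_; _*_; _∸_; _⊔_; ⌊_/2⌋; _≤_; _<_; z≤n; s≤s; s≤s⁻¹)
open import Data.Nat.Divisibility using (_∣_; divides)
open import Data.Nat.ListAction using (sum)
open import Data.Nat.Properties
  using ( suc-injective; +-assoc; +-comm; +-identityʳ; +-cancelˡ-≡; +-cancelʳ-≡; +-0-isCommutativeMonoid; *-identityʳ; *-zeroʳ; *-suc; *-distribˡ-+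
        ; m+n≡0⇒m≡0; m+n≡0⇒n≡0; m+[n∸m]≡n; n≡⌊n+n/2⌋; ⌊n/2⌋+⌈n/2⌉≡n; ⊔-sel
        ; ≤-refl; ≤-trans; ≤-reflexive; <-≤-trans; +-mono-≤; +-monoʳ-≤; +-mono-<-≤; +-mono-≤-<; m≤m+n; m≤n+m; n≤1+n; 1+n≰n
        ; m≤m⊔n; m≤n⊔m; ⌊n/2⌋-mono; ⌊n/2⌋≤⌈n/2⌉; module ≤-Reasoning )
open import Data.Nat.Solver using (module +-*-Solver)
open import Data.Product using (Σ; _×_; _,_; proj₁; proj₂; ∃-syntax)
open import Data.Sum using (_⊎_; inj₁; inj₂)
open import Function using (_∘_; id)
open import Function.Definitions using (Injective)
open import Relation.Binary.PropositionalEquality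
open import Relation.Nullary using (does; yes; no; ¬_; ¬?; Dec; contradiction; _×-dec_)
open import Relation.Nullary.Decidable using (dec-true; dec-false)

-- Edges are counted with multiplicity in ℕ (`count`) as long as simplicity of the graph has to be
-- exploited, and modulo 2 (`parity`) once cycles are combined; an equation between counts yields
-- the one between parities. Linking edges may be arbitrary pairs of vertices: they occur in both
-- cycles of a pair and cancel. The obstacle in (1) is that different colour classes share vertices,
-- so a cycle through one class cannot in general use the closing edges of another. Two fresh
-- vertices per cycle, adjacent to each other, give every member a closing edge that meets no other
-- member. A woven cycle again has fresh end vertices, so it serves as a class with one member, and
-- each further class costs only one more cycle. In (2) the invariant is that every vertex is an end
-- of an even number of paths. It supplies the paths that absorb the two edges at the fresh vertex,
-- it survives the join, and at last it makes the edges at the hub cancel. Every join lowers the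
-- number of paths, which bounds the isolated vertices used.

-- Finite sums, over ℕ and modulo 2

module BigOp {M : Set} {_∙_ : M → M → M} {ε : M} (isCM : IsCommutativeMonoid _≡_ _∙_ ε) where
  open IsCommutativeMonoid isCM using (assoc; comm; identityˡ; isCommutativeSemigroup)

  private
    commutativeSemigroup : CommutativeSemigroup _ _
    commutativeSemigroup = record { isCommutativeSemigroup = isCommutativeSemigroup }

  open CommutativeSemigroupProperties commutativeSemigroup using (interchange)

  private variable
    A B : Set

  fold : (A → M) → List A → M
  fold f []       = ε
  fold f (x ∷ xs) = f x ∙ fold f xs

  fold-++ : (f : A → M) → ∀ xs ys → fold f (xs ++ ys) ≡ fold f xs ∙ fold f ys
  fold-++ f []       ys = sym (identityˡ _)
  fold-++ f (x ∷ xs) ys = trans (cong (f x ∙_) (fold-++ f xs ys)) (sym (assoc _ _ _))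

  fold-cong : {f g : A → M} → (∀ x → f x ≡ g x) → ∀ xs → fold f xs ≡ fold g xs
  fold-cong f≗g []       = refl
  fold-cong f≗g (x ∷ xs) = cong₂ _∙_ (f≗g x) (fold-cong f≗g xs)

  fold-congᴬ : {f g : A → M} → ∀ {xs} → All (λ x → f x ≡ g x) xs → fold f xs ≡ fold g xs
  fold-congᴬ []         = refl
  fold-congᴬ (eq ∷ eqs) = cong₂ _∙_ eq (fold-congᴬ eqs)

  fold-ε : {f : A → M} → (∀ x → f x ≡ ε) → ∀ xs → fold f xs ≡ ε
  fold-ε f≗ε []       = refl
  fold-ε f≗ε (x ∷ xs) = trans (cong₂ _∙_ (f≗ε x) (fold-ε f≗ε xs)) (identityˡ ε)

  fold-∙ : (f g : A → M) → ∀ xs → fold (λ x → f x ∙ g x) xs ≡ fold f xs ∙ fold g xs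
  fold-∙ f g []       = sym (identityˡ ε)
  fold-∙ f g (x ∷ xs) = trans (cong ((f x ∙ g x) ∙_) (fold-∙ f g xs)) (interchange _ _ _ _)

  fold-comm : (f : A → B → M) → ∀ xs ys →
              fold (λ x → fold (f x) ys) xs ≡ fold (λ y → fold (λ x → f x y) xs) ys
  fold-comm f []       ys = sym (fold-ε (λ _ → refl) ys)
  fold-comm f (x ∷ xs) ys =
    trans (cong (fold (f x) ys ∙_) (fold-comm f xs ys)) (sym (fold-∙ (f x) _ ys))

  fold-map : (f : B → M) (g : A → B) → ∀ xs → fold f (map g xs) ≡ fold (f ∘ g) xs
  fold-map f g []       = refl
  fold-map f g (x ∷ xs) = cong (f (g x) ∙_) (fold-map f g xs)

  fold-concat : (f : A → M) → ∀ xss → fold f (concat xss) ≡ fold (fold f) xss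
  fold-concat f []         = refl
  fold-concat f (xs ∷ xss) = trans (fold-++ f xs (concat xss)) (cong (fold f xs ∙_) (fold-concat f xss))

  fold-concatMap : (f : B → M) (g : A → List B) → ∀ xs →
                   fold f (concatMap g xs) ≡ fold (fold f ∘ g) xs
  fold-concatMap f g xs = trans (fold-concat f (map g xs)) (fold-map (fold f) g xs)

  fold-↭ : (f : A → M) → ∀ {xs ys} → xs ↭ ys → fold f xs ≡ fold f ys
  fold-↭ f _↭_.refl           = refl
  fold-↭ f (_↭_.prep x p)     = cong (f x ∙_) (fold-↭ f p)
  fold-↭ f {ys = _ ∷ _ ∷ ys} (_↭_.swap x y p) = trans (cong (λ z → f x ∙ (f y ∙ z)) (fold-↭ f p))
    (trans (sym (assoc _ _ _)) (trans (cong (_∙ fold f ys) (comm _ _)) (assoc _ _ _)))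
  fold-↭ f (_↭_.trans p q)    = trans (fold-↭ f p) (fold-↭ f q)

xor-isCommutativeMonoid : IsCommutativeMonoid _≡_ _xor_ false
xor-isCommutativeMonoid = record
  { isMonoid = record
    { isSemigroup = record
      { isMagma = record { isEquivalence = isEquivalence ; ∙-cong = cong₂ _xor_ }
      ; assoc = xor-assoc }
    ; identity = (λ _ → refl) , xor-identityʳ }
  ; comm = xor-comm }

open BigOp +-0-isCommutativeMonoid public using () renaming
  ( fold to ∑; fold-++ to ∑-++; fold-cong to ∑-cong; fold-congᴬ to ∑-congᴬ; fold-ε to ∑-0; fold-∙ to ∑-+
  ; fold-comm to ∑-comm; fold-map to ∑-map; fold-concat to ∑-concat; fold-concatMap to ∑-concatMap; fold-↭ to ∑-↭ )
open BigOp xor-isCommutativeMonoid public using () renaming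
  ( fold to ⨁; fold-++ to ⨁-++; fold-cong to ⨁-cong; fold-congᴬ to ⨁-congᴬ; fold-ε to ⨁-false; fold-∙ to ⨁-xor
  ; fold-comm to ⨁-comm; fold-map to ⨁-map; fold-concat to ⨁-concat; fold-concatMap to ⨁-concatMap; fold-↭ to ⨁-↭ )

-- Parities and edge multiplicities

private variable
  A B : Set
  k m n : ℕ

⟦_⟧ : Bool → ℕ
⟦ b ⟧ = if b then 1 else 0

⟦⟧≤1 : ∀ b → ⟦ b ⟧ ≤ 1
⟦⟧≤1 true  = ≤-refl
⟦⟧≤1 false = z≤n

odd : ℕ → Bool
odd zero    = false
odd (suc n) = not (odd n)

not-xor : ∀ a b → not (a xor b) ≡ not a xor b
not-xor true  true  = refl
not-xor true  false = refl
not-xor false b     = refl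

odd-+ : ∀ m n → odd (m + n) ≡ odd m xor odd n
odd-+ zero    n = refl
odd-+ (suc m) n = trans (cong not (odd-+ m n)) (not-xor (odd m) (odd n))

odd-⟦⟧ : ∀ b → odd ⟦ b ⟧ ≡ b
odd-⟦⟧ true  = refl
odd-⟦⟧ false = refl

odd-∑ : (f : A → ℕ) → ∀ xs → odd (∑ f xs) ≡ ⨁ (odd ∘ f) xs
odd-∑ f []       = refl
odd-∑ f (x ∷ xs) = trans (odd-+ (f x) _) (cong (odd (f x) xor_) (odd-∑ f xs))

odd-double : ∀ m → odd (m + m) ≡ false
odd-double m = trans (odd-+ m m) (xor-same (odd m))

even⇒¬odd : ∀ {m} → 2 ∣ m → odd m ≡ false
even⇒¬odd (divides q refl) =
  trans (cong odd (+-*-Solver.solve 1 (λ q → q :* con 2 := q :+ q) refl q)) (odd-double q)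
  where open +-*-Solver using (solve; _:*_; _:+_; _:=_; con)

∑-mono : {f g : A → ℕ} → (∀ x → f x ≤ g x) → ∀ xs → ∑ f xs ≤ ∑ g xs
∑-mono f≤g []       = z≤n
∑-mono f≤g (x ∷ xs) = +-mono-≤ (f≤g x) (∑-mono f≤g xs)

does-refl : (x : Fin n) → does (x ≟ x) ≡ true
does-refl x = dec-true (x ≟ x) refl

∑-allFin-suc : (f : Fin (suc n) → ℕ) → ∑ f (allFin (suc n)) ≡ f zero + ∑ (f ∘ suc) (allFin n)
∑-allFin-suc {n} f = cong (f zero +_)
  (trans (cong (∑ f) (sym (map-tabulate (λ i → i) suc))) (∑-map f suc (allFin n)))

∑-δ : (x : Fin n) → ∑ (λ u → ⟦ does (u ≟ x) ⟧) (allFin n) ≡ 1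
∑-δ {suc n} zero    = trans (∑-allFin-suc {n} (λ u → ⟦ does (u ≟ zero) ⟧)) (cong suc (∑-0 (λ _ → refl) (allFin n)))
∑-δ {suc n} (suc x) = trans (∑-allFin-suc {n} (λ u → ⟦ does (u ≟ suc x) ⟧)) (∑-δ x)

-- The summand of hasEdge: hasEdge ps u v is anyB (λ p → edge p u v) ps by computation.
edge : Fin n × Fin n → Adj n
edge p u v = (does (u ≟ proj₁ p) ∧ does (v ≟ proj₂ p)) ∨ (does (v ≟ proj₁ p) ∧ does (u ≟ proj₂ p))

parity : List (Fin n × Fin n) → Adj n
parity ps u v = ⨁ (λ p → edge p u v) ps

count : List (Fin n × Fin n) → Fin n → Fin n → ℕ
count ps u v = ∑ (λ p → ⟦ edge p u v ⟧) ps

odd-count : (ps : List (Fin n × Fin n)) → ∀ u v → odd (count ps u v) ≡ parity ps u v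
odd-count ps u v = trans (odd-∑ _ ps) (⨁-cong (λ p → odd-⟦⟧ (edge p u v)) ps)

edge-swap : ∀ (a b u v : Fin n) → edge (a , b) u v ≡ edge (b , a) u v
edge-swap a b u v = trans (∨-comm (does (u ≟ a) ∧ does (v ≟ b)) _)
  (cong₂ _∨_ (∧-comm (does (v ≟ a)) _) (∧-comm (does (u ≟ a)) _))

edge-sym : ∀ (p : Fin n × Fin n) u v → edge p u v ≡ edge p v u
edge-sym p u v = ∨-comm (does (u ≟ proj₁ p) ∧ does (v ≟ proj₂ p)) _

edge-self : (a b : Fin n) → edge (a , b) a b ≡ true
edge-self a b rewrite does-refl a | does-refl b = refl

edge-ends : ∀ {p : Fin n × Fin n} {u v} → edge p u v ≡ true → p ≡ (u , v) ⊎ p ≡ (v , u)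
edge-ends {p = a , b} {u} {v} eq with u ≟ a | v ≟ b | v ≟ a | u ≟ b
... | yes refl | yes refl | _        | _        = inj₁ refl
... | yes _    | no _     | yes refl | yes refl = inj₂ refl
... | no _     | _        | yes refl | yes refl = inj₂ refl

∑-edge : ∀ {a b : Fin n} → a ≢ b → ∀ v →
         ∑ (λ u → ⟦ edge (a , b) v u ⟧) (allFin n) ≡ ⟦ does (v ≟ a) ⟧ + ⟦ does (v ≟ b) ⟧
∑-edge {n} {a} {b} a≢b v with v ≟ a | v ≟ b
... | yes refl | yes refl = contradiction refl a≢b
... | yes refl | no  _    = trans (∑-cong (λ u → lemma (does (u ≟ b)) (does (u ≟ v))) (allFin n)) (∑-δ b)
  where lemma : ∀ x y → ⟦ x ∨ (y ∧ false) ⟧ ≡ ⟦ x ⟧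
        lemma true  _     = refl
        lemma false true  = refl
        lemma false false = refl
... | no  _    | yes refl = trans (∑-cong (λ u → lemma (does (u ≟ a))) (allFin n)) (∑-δ a)
  where lemma : ∀ y → ⟦ y ∧ true ⟧ ≡ ⟦ y ⟧
        lemma true  = refl
        lemma false = refl
... | no  _    | no  _    = ∑-0 (λ u → lemma (does (u ≟ a))) (allFin n)
  where lemma : ∀ y → ⟦ y ∧ false ⟧ ≡ 0
        lemma true  = refl
        lemma false = refl

-- Balanced orientations

δ : Fin n → Fin n → ℕ
δ u v = ⟦ does (u ≟ v) ⟧

δ-refl : (v : Fin n) → δ v v ≡ 1
δ-refl v = cong ⟦_⟧ (does-refl v)

δ-≢ : {u v : Fin n} → u ≢ v → δ u v ≡ 0
δ-≢ {u = u} {v} u≢v = cong ⟦_⟧ (dec-false (u ≟ v) u≢v)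

outdeg indeg : List (Fin n × Fin n) → Fin n → ℕ
outdeg ps v = ∑ (λ p → δ v (proj₁ p)) ps
indeg  ps v = ∑ (λ p → δ v (proj₂ p)) ps

degree : List (Fin n × Fin n) → Fin n → ℕ
degree ps v = ∑ (λ p → δ v (proj₁ p) + δ v (proj₂ p)) ps

∑-count : ∀ {ps : List (Fin n × Fin n)} → All (λ p → proj₁ p ≢ proj₂ p) ps → ∀ v →
          ∑ (count ps v) (allFin n) ≡ degree ps v
∑-count {n} {ps} ps≢ v = trans (∑-comm (λ u p → ⟦ edge p v u ⟧) (allFin n) ps)
  (∑-congᴬ (All.map (λ p≢ → ∑-edge p≢ v) ps≢))

incident : ∀ (y : Fin n) ps → odd (degree ps y) ≡ true →
           ∃[ z ] ∃[ qs ] (ps ↭ (y , z) ∷ qs ⊎ ps ↭ (z , y) ∷ qs)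
incident y ((a , b) ∷ ps) eq with y ≟ a | y ≟ b
... | yes refl | _        = b , ps , inj₁ ↭-refl
... | no _     | yes refl = a , ps , inj₂ ↭-refl
... | no _     | no _     with incident y ps eq
...   | z , qs , inj₁ p = z , (a , b) ∷ qs , inj₁ (↭-trans (↭-prep _ p) (↭-swap _ _ ↭-refl))
...   | z , qs , inj₂ p = z , (a , b) ∷ qs , inj₂ (↭-trans (↭-prep _ p) (↭-swap _ _ ↭-refl))

odd-cancel : ∀ p k → odd (p + p + k) ≡ odd k
odd-cancel p k = trans (odd-+ (p + p) k) (cong (_xor odd k) (odd-double p))

count-swap : ∀ (a b : Fin n) ps u v → count ((a , b) ∷ ps) u v ≡ count ((b , a) ∷ ps) u v
count-swap a b ps u v = cong (λ e → ⟦ e ⟧ + count ps u v) (edge-swap a b u v)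

degree-swap : ∀ (a b : Fin n) ps v → degree ((a , b) ∷ ps) v ≡ degree ((b , a) ∷ ps) v
degree-swap a b ps v = cong (_+ degree ps v) (+-comm (δ v a) (δ v b))

-- Walks along unused edges from y until it reaches x, the only vertex where the parities let it stop; if x ≡ y, a new closed walk is
-- started at any remaining edge.
orientTrail : ∀ m (ps : List (Fin n × Fin n)) → length ps ≡ m → ∀ x y →
         (∀ v → odd (degree ps v + (δ v x + δ v y)) ≡ false) →
         ∃[ os ] (∀ u v → count os u v ≡ count ps u v) ×
                 (∀ v → outdeg os v + δ v x ≡ indeg os v + δ v y)
orientTrail zero [] _ x y even with x ≟ y
... | yes refl = [] , (λ _ _ → refl) , λ _ → refl
-- With no edge left, a walk still away from x would make the parity at y odd.
... | no  x≢y  = contradiction (even y) (lemma x≢y)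
  where
  lemma : x ≢ y → odd (δ y x + δ y y) ≢ false
  lemma x≢y eq with y ≟ x | y ≟ y
  ... | yes y≡x | _       = x≢y (sym y≡x)
  ... | no _    | yes _   = contradiction eq λ ()
  ... | no _    | no  y≢y = y≢y refl
orientTrail (suc m) ps len x y even with x ≟ y
orientTrail (suc m) ((a , b) ∷ ps) len x y even | yes refl =
  -- A closed walk that begins with `(a , b)` must still lead from b back to a; hence the target a
  -- and the current vertex b.
  let os , cnt , bal = orientTrail m ps (suc-injective len) a b λ v →
        trans (sym (odd-cancel (δ v x) _))
          (trans (cong odd (solve 4 (λ a b d x → x :+ x :+ (d :+ (a :+ b)) := a :+ b :+ d :+ (x :+ x)) refl
            (δ v a) (δ v b) (degree ps v) (δ v x))) (even v))
  in (a , b) ∷ os , (λ u v → cong (⟦ edge (a , b) u v ⟧ +_) (cnt u v)) , λ v →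
     cong (_+ δ v x) (trans (+-comm (δ v a) _) (trans (bal v) (+-comm _ (δ v b))))
  where open +-*-Solver using (solve; _:+_; _:=_)
orientTrail {n} (suc m) ps len x y even | no x≢y =
  let z , qs , p = incident y ps y-odd
      cnt-p , deg-p , len-p = split p
      os , cnt , bal = orientTrail m qs (suc-injective (trans (sym len-p) len)) x z λ v →
        trans (sym (odd-cancel (δ v y) _))
          (trans (cong odd (solve 4 (λ y z d x → y :+ y :+ (d :+ (x :+ z)) := y :+ z :+ d :+ (x :+ y)) refl
            (δ v y) (δ v z) (degree qs v) (δ v x)))
            (trans (cong (λ d → odd (d + (δ v x + δ v y))) (sym (deg-p v))) (even v)))
  in (y , z) ∷ os
     , (λ u v → trans (cong (⟦ edge (y , z) u v ⟧ +_) (cnt u v)) (sym (cnt-p u v)))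
     , λ v → trans (+-assoc (δ v y) _ _) (trans (cong (δ v y +_) (bal v))
         (solve 3 (λ y i z → y :+ (i :+ z) := z :+ i :+ y) refl (δ v y) (indeg os v) (δ v z)))
  where
  open +-*-Solver using (solve; _:+_; _:=_)
  split : ∀ {z qs} → ps ↭ (y , z) ∷ qs ⊎ ps ↭ (z , y) ∷ qs →
          (∀ u v → count ps u v ≡ count ((y , z) ∷ qs) u v) ×
          (∀ v → degree ps v ≡ degree ((y , z) ∷ qs) v) × length ps ≡ suc (length qs)
  split (inj₁ p) = (λ u v → ∑-↭ _ p) , (λ v → ∑-↭ _ p) , ↭-length p
  split {z} {qs} (inj₂ p) =
    (λ u v → trans (∑-↭ _ p) (count-swap z y qs u v)) ,
    (λ v → trans (∑-↭ _ p) (degree-swap z y qs v)) , ↭-length p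
  y-odd : odd (degree ps y) ≡ true
  y-odd with y ≟ x | y ≟ y | even y
  ... | yes y≡x | _       | _ = contradiction (sym y≡x) x≢y
  ... | no _    | no y≢y  | _ = contradiction refl y≢y
  ... | no _    | yes _   | e = trans (sym (not-involutive _)) (cong not (trans (cong odd (+-comm 1 (degree ps y))) e))

balancedOrientation : (ps : List (Fin n × Fin n)) → (∀ v → odd (degree ps v) ≡ false) →
  ∃[ os ] (∀ u v → count os u v ≡ count ps u v) × (∀ v → outdeg os v ≡ indeg os v)
balancedOrientation [] even = [] , (λ _ _ → refl) , λ _ → refl
balancedOrientation ps@((x , _) ∷ _) even =
  let os , cnt , bal = orientTrail _ ps refl x x λ v →
        trans (odd-+ (degree ps v) _) (cong₂ _xor_ (even v) (odd-double (δ v x)))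
  in os , cnt , λ v → +-cancelʳ-≡ (δ v x) _ _ (bal v)

-- König's theorem

_∈im_ : Fin n → (Fin n → Fin n) → Set
w ∈im f = ∃[ r ] f r ≡ w

_∈im?_ : (w : Fin n) (f : Fin n → Fin n) → Dec (w ∈im f)
w ∈im? f = Fin.any? (λ r → f r ≟ w)

missing : (Fin n → Fin n) → Fin n → ℕ
missing f w = ⟦ not (does (w ∈im? f)) ⟧

missing-0 : ∀ {f : Fin n → Fin n} {w} → w ∈im f → missing f w ≡ 0
missing-0 {f = f} {w} w∈ = cong (λ b → ⟦ not b ⟧) (dec-true (w ∈im? f) w∈)

missing-1 : ∀ {f : Fin n → Fin n} {w} → ¬ w ∈im f → missing f w ≡ 1
missing-1 {f = f} {w} w∉ = cong (λ b → ⟦ not b ⟧) (dec-false (w ∈im? f) w∉)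

missing≤1 : ∀ (f : Fin n → Fin n) w → missing f w ≤ 1
missing≤1 f w = ⟦⟧≤1 _

missing-mono : ∀ {f g : Fin n → Fin n} {w} → (w ∈im f → w ∈im g) → missing g w ≤ missing f w
missing-mono {f = f} {g} {w} imp with w ∈im? f
... | yes w∈ = ≤-reflexive (missing-0 (imp w∈))
... | no  _  = missing≤1 g w

update : (Fin n → Fin n) → Fin n → Fin n → Fin n → Fin n
update f r w s = if does (s ≟ r) then w else f s

update-same : ∀ (f : Fin n → Fin n) r w → update f r w r ≡ w
update-same f r w rewrite does-refl r = refl

update-other : ∀ (f : Fin n → Fin n) {r} w {s} → s ≢ r → update f r w s ≡ f s
update-other f {r} w {s} s≢r rewrite dec-false (s ≟ r) s≢r = refl

-- In each row f′ and g′ have the values of f and g, up to order; counting values makes the relation transitive by arithmetic.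
RowSwap : (f g f′ g′ : Fin n → Fin n) → Set
RowSwap f g f′ g′ = ∀ s v → δ v (f′ s) + δ v (g′ s) ≡ δ v (f s) + δ v (g s)

-- A Kempe chain: w is attained twice by f and missed by g, and U lists the rows not exchanged so far. Exchanging
-- row r repairs w, and can only break the value w₁ = g r, in which case the situation recurs with w₁ in place of w.
kempe : ∀ m (U : List (Fin n)) → length U ≤ m → (f g : Fin n → Fin n) (w r r′ : Fin n) →
        r ∈ U → f r ≡ w → r′ ≢ r → f r′ ≡ w → ¬ w ∈im g →
        (∀ {s t} → s ∉ U → t ∈ U → f s ≢ g t) →
        ∃[ f′ ] ∃[ g′ ] RowSwap f g f′ g′ ×
          (∀ v → missing f′ v + missing g′ v ≤ missing f v + missing g v) ×
          missing f′ w + missing g′ w ≤ 0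
kempe zero [] _ f g w r r′ () _ _ _ _ _
kempe {n} (suc m) U len f g w r r′ r∈U fr r′≢r fr′ w∉g inv = body
  where
  open DecMembership (_≟_ {n}) using (_∈?_)
  w₁ = g r
  f₁ = update f r w₁
  g₁ = update g r w

  w₁≢w : w₁ ≢ w
  w₁≢w eq = w∉g (r , eq)

  w∈f₁ : w ∈im f₁
  w∈f₁ = r′ , trans (update-other f w₁ r′≢r) fr′

  w∈g₁ : w ∈im g₁
  w∈g₁ = r , update-same g r w

  w₁∈f₁ : w₁ ∈im f₁
  w₁∈f₁ = r , update-same f r w₁

  swap₁ : RowSwap f g f₁ g₁
  swap₁ s v with s ≟ r
  ... | yes refl = trans (+-comm (δ v (g s)) _) (cong (λ z → δ v z + δ v (g s)) (sym fr))
  ... | no  _    = refl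

  f⊆f₁ : ∀ {v} → v ≢ w → v ∈im f → v ∈im f₁
  f⊆f₁ v≢w (s , fs) with s ≟ r
  ... | yes refl = contradiction (trans (sym fs) fr) v≢w
  ... | no  s≢r  = s , trans (update-other f w₁ s≢r) fs

  g⊆g₁ : ∀ {v} → v ≢ w₁ → v ∈im g → v ∈im g₁
  g⊆g₁ v≢w₁ (s , gs) with s ≟ r
  ... | yes refl = contradiction (sym gs) v≢w₁
  ... | no  s≢r  = s , trans (update-other g w s≢r) gs

  at-w : missing f₁ w + missing g₁ w ≤ 0
  at-w = ≤-reflexive (cong₂ _+_ (missing-0 w∈f₁) (missing-0 w∈g₁))

  elsewhere : ∀ v → v ≢ w₁ → missing f₁ v + missing g₁ v ≤ missing f v + missing g v
  elsewhere v v≢w₁ with v ≟ w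
  ... | yes refl = ≤-trans at-w z≤n
  ... | no  v≢w  = +-mono-≤ (missing-mono {f = f} {g = f₁} (f⊆f₁ v≢w)) (missing-mono {f = g} {g = g₁} (g⊆g₁ v≢w₁))

  Result = ∃[ f′ ] ∃[ g′ ] RowSwap f g f′ g′ ×
          (∀ v → missing f′ v + missing g′ v ≤ missing f v + missing g v) ×
          missing f′ w + missing g′ w ≤ 0

  stop : missing f₁ w₁ + missing g₁ w₁ ≤ missing f w₁ + missing g w₁ → Result
  stop at-w₁ = f₁ , g₁ , swap₁ , everywhere , at-w
    where
    everywhere : ∀ v → missing f₁ v + missing g₁ v ≤ missing f v + missing g v
    everywhere v with v ≟ w₁
    ... | yes refl = at-w₁
    ... | no  v≢w₁ = elsewhere v v≢w₁

  U₁ = filter (λ s → ¬? (s ≟ r)) U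

  body : Result
  body with w₁ ∈im? f | w₁ ∈im? g₁
  -- If f missed `w₁`, the exchange has added it to the image of the first column, which compensates
  -- for its possible loss in the second.
  ... | no w₁∉f | _ = stop (subst₂ (λ a b → a + missing g₁ w₁ ≤ b + missing g w₁)
          (sym (missing-0 w₁∈f₁)) (sym (missing-1 w₁∉f)) (≤-trans (missing≤1 g₁ w₁) (s≤s z≤n)))
  ... | yes _ | yes w₁∈g₁ = stop (≤-trans (≤-reflexive (cong₂ _+_ (missing-0 w₁∈f₁) (missing-0 w₁∈g₁))) z≤n)
  ... | yes (r₂ , fr₂) | no w₁∉g₁ =
    let f′ , g′ , swp , le , at-w₁ = kempe m U₁ (s≤s⁻¹ (≤-trans shorter len)) f₁ g₁ w₁ r₂ r r₂∈U₁
            (trans (update-other f w₁ r₂≢r) fr₂) (r₂≢r ∘ sym) (update-same f r w₁) w₁∉g₁ inv₁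
        everywhere : ∀ v → missing f′ v + missing g′ v ≤ missing f v + missing g v
        everywhere = λ v → merge f′ g′ le at-w₁ v
    in f′ , g′ , (λ s v → trans (swp s v) (swap₁ s v)) , everywhere , ≤-trans (le w) at-w
    where
    merge : ∀ f′ g′ → (∀ v → missing f′ v + missing g′ v ≤ missing f₁ v + missing g₁ v) →
            missing f′ w₁ + missing g′ w₁ ≤ 0 → ∀ v → missing f′ v + missing g′ v ≤ missing f v + missing g v
    merge f′ g′ le at-w₁ v with v ≟ w₁
    ... | yes refl = ≤-trans at-w₁ z≤n
    ... | no  v≢w₁ = ≤-trans (le v) (elsewhere v v≢w₁)
    r₂≢r : r₂ ≢ r
    r₂≢r refl = w₁≢w (trans (sym fr₂) fr)
    r₂∈U : r₂ ∈ U
    -- By `inv`, a row exchanged earlier cannot have the f-value `g r`, so the chain never returns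
    -- to one.
    r₂∈U with r₂ ∈? U
    ... | yes p = p
    ... | no  p = contradiction fr₂ (inv p r∈U)
    r₂∈U₁ : r₂ ∈ U₁
    r₂∈U₁ = ∈-filter⁺ (λ s → ¬? (s ≟ r)) r₂∈U r₂≢r
    shorter : length U₁ < length U
    shorter = filter-notAll (λ s → ¬? (s ≟ r)) U (Any.map (λ r≡s ¬p → ¬p (sym r≡s)) r∈U)
    inv₁ : ∀ {s t} → s ∉ U₁ → t ∈ U₁ → f₁ s ≢ g₁ t
    inv₁ {s} {t} s∉ t∈ eq with s ≟ r
    -- The row just exchanged has the f-value `w₁`, which `g₁` misses altogether; this keeps the
    -- invariant.
    ... | yes refl = w₁∉g₁ (t , sym eq)
    ... | no  s≢r  = let t∈U , t≢r = ∈-filter⁻ (λ s → ¬? (s ≟ r)) {xs = U} t∈ in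
      inv (λ s∈U → s∉ (∈-filter⁺ (λ s → ¬? (s ≟ r)) s∈U s≢r)) t∈U
          (trans eq (update-other g w t≢r))

Columns : ℕ → Set
Columns n = List (Fin n → Fin n)

entries : Columns n → Fin n → Fin n → ℕ
entries fs s v = ∑ (λ f → δ v (f s)) fs

-- The measure on which `könig` descends. It vanishes exactly when every column is a permutation.
defect : Columns n → ℕ
defect {n} fs = ∑ (λ f → ∑ (missing f) (allFin n)) fs

∑-bound : ∀ {A : Set} (f g : A → ℕ) → (∀ x → f x ≤ g x) → ∀ {x xs} → x ∈ xs → f x < g x → ∑ f xs < ∑ g xs
∑-bound f g f≤g {xs = _ ∷ xs} (here refl) lt = +-mono-<-≤ lt (∑-mono f≤g xs)
∑-bound f g f≤g {xs = y ∷ _} (there x∈) lt = +-mono-≤-< (f≤g y) (∑-bound f g f≤g x∈ lt)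

∑-∈ : ∀ {A : Set} (f : A → ℕ) {x xs} → x ∈ xs → f x ≤ ∑ f xs
∑-∈ f (here refl) = m≤m+n _ _
∑-∈ f {xs = y ∷ _} (there x∈) = ≤-trans (∑-∈ f x∈) (m≤n+m _ (f y))

Repeats : (Fin n → Fin n) → Set
Repeats f = ∃[ r ] ∃[ s ] (s ≢ r × f s ≡ f r)

repeats? : (f : Fin n → Fin n) → Dec (Repeats f)
repeats? f = Fin.any? λ r → Fin.any? λ s → ¬? (s ≟ r) ×-dec (f s ≟ f r)

¬repeats⇒injective : ∀ {f : Fin n → Fin n} → ¬ Repeats f → Injective _≡_ _≡_ f
¬repeats⇒injective ¬rep {x} {y} eq with x ≟ y
... | yes x≡y = x≡y
... | no  x≢y = contradiction (y , x , x≢y , eq) ¬rep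

injectiveOrRepeats : (fs : Columns n) → All (Injective _≡_ _≡_) fs ⊎ ∃[ f ] ∃[ gs ] (fs ↭ f ∷ gs × Repeats f)
injectiveOrRepeats [] = inj₁ []
injectiveOrRepeats (f ∷ fs) with repeats? f | injectiveOrRepeats fs
... | yes rep | _ = inj₂ (f , fs , ↭-refl , rep)
... | no ¬rep | inj₁ inj = inj₁ (¬repeats⇒injective ¬rep ∷ inj)
... | no ¬rep | inj₂ (h , gs , p , rep) = inj₂ (h , f ∷ gs , ↭-trans (↭-prep _ p) (↭-swap _ _ ↭-refl) , rep)

occurrences : (Fin n → Fin n) → Fin n → ℕ
occurrences {n} f w = ∑ (λ s → δ w (f s)) (allFin n)

-- The pigeonhole step of `könig`: if one column attains w twice, regularity leaves too few
-- occurrences for all the other columns to attain it, so one of them misses w and can be the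
-- partner of a Kempe exchange.
missedBy : ∀ w (fs : Columns n) → length fs ≤ ∑ (λ f → occurrences f w) fs ⊎ ∃[ g ] ∃[ gs ] (fs ↭ g ∷ gs × ¬ w ∈im g)
missedBy w [] = inj₁ z≤n
missedBy w (f ∷ fs) with w ∈im? f | missedBy w fs
... | no  w∉ | _ = inj₂ (f , fs , ↭-refl , w∉)
... | yes _ | inj₂ (g , gs , p , w∉) = inj₂ (g , f ∷ gs , ↭-trans (↭-prep _ p) (↭-swap _ _ ↭-refl) , w∉)
... | yes (r , fr) | inj₁ le = inj₁ (+-mono-≤ (≤-trans (≤-reflexive (sym (trans (cong (δ w) fr) (δ-refl w)))) (∑-∈ (λ s → δ w (f s)) (∈-allFin r))) le)

occurrences-repeat : ∀ (f : Fin n → Fin n) {r s} → s ≢ r → f s ≡ f r → 2 ≤ occurrences f (f r)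
occurrences-repeat {n} f {r} {s} s≢r fs = ≤-trans
  (≤-reflexive (sym (trans (∑-+ (λ t → δ t r) (λ t → δ t s) (allFin n)) (cong₂ _+_ (∑-δ r) (∑-δ s)))))
  (∑-mono two (allFin n))
  where
  two : ∀ t → δ t r + δ t s ≤ δ (f r) (f t)
  two t with t ≟ r | t ≟ s
  ... | yes refl | yes refl = contradiction refl s≢r
  ... | yes refl | no  _    = ≤-reflexive (sym (δ-refl (f t)))
  ... | no  _    | yes refl = ≤-reflexive (sym (trans (cong (δ (f r)) fs) (δ-refl (f r))))
  ... | no  _    | no  _    = z≤n

-- Column f stands for the edges from s to `f s` of a bipartite multigraph. Degrees on the side of
-- the rows are `length fs` by construction, so only the side of the values is constrained.
Regular : Columns n → Set
Regular fs = ∀ w → ∑ (λ f → occurrences f w) fs ≡ length fs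

regular-resp : ∀ {fs gs : Columns n} → (∀ s v → entries gs s v ≡ entries fs s v) → length gs ≡ length fs →
               Regular fs → Regular gs
regular-resp {n} {fs} {gs} eq len reg w = begin
  ∑ (λ f → occurrences f w) gs    ≡⟨ ∑-comm (λ f s → δ w (f s)) gs (allFin n) ⟩
  ∑ (λ s → entries gs s w) (allFin n) ≡⟨ ∑-cong (λ s → eq s w) (allFin n) ⟩
  ∑ (λ s → entries fs s w) (allFin n) ≡⟨ sym (∑-comm (λ f s → δ w (f s)) fs (allFin n)) ⟩
  ∑ (λ f → occurrences f w) fs    ≡⟨ reg w ⟩
  length fs ≡⟨ sym len ⟩
  length gs ∎
  where open ≡-Reasoning

-- König's edge colouring theorem for regular bipartite multigraphs: column j holds the edges of colour j.
könig : ∀ m (fs : Columns n) → defect fs ≤ m → Regular fs →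
        ∃[ gs ] All (Injective _≡_ _≡_) gs × length gs ≡ length fs × (∀ s v → entries gs s v ≡ entries fs s v)
könig {n} m fs bound reg with injectiveOrRepeats fs
... | inj₁ inj = fs , inj , refl , λ _ _ → refl
... | inj₂ (f , rest , p , r , s , s≢r , fs≡fr) with missedBy (f r) rest
...   | inj₁ le = contradiction
        (≤-trans (+-mono-≤ (occurrences-repeat f s≢r fs≡fr) le)
          (≤-reflexive (trans (sym (∑-↭ (λ h → occurrences h (f r)) p)) (trans (reg (f r)) (↭-length p))))) 1+n≰n
...   | inj₂ (g , rest′ , q , w∉g) with kempe _ (allFin n) ≤-refl f g (f r) r s (∈-allFin r) refl s≢r fs≡fr w∉g
                                          (λ s∉ _ → contradiction (∈-allFin _) s∉)
...     | f′ , g′ , swp , le , at-w = continue m bound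
  where
  pq : fs ↭ f ∷ g ∷ rest′
  pq = ↭-trans p (↭-prep f q)
  fs′ = f′ ∷ g′ ∷ rest′
  entries-eq : ∀ s v → entries fs′ s v ≡ entries fs s v
  entries-eq s v = trans (sym (+-assoc (δ v (f′ s)) _ _)) (trans (cong (_+ entries rest′ s v) (swp s v))
    (trans (+-assoc (δ v (f s)) _ _) (sym (∑-↭ (λ f → δ v (f s)) pq))))
  len-eq : length fs′ ≡ length fs
  len-eq = sym (↭-length pq)
  -- The exchange makes no value worse, and it repairs `f r`, which g missed.
  smaller : defect fs′ < defect fs
  smaller = subst₂ _<_
    (trans (cong (_+ defect rest′) (∑-+ (missing f′) (missing g′) (allFin n))) (+-assoc (∑ (missing f′) (allFin n)) _ _))
    (trans (cong (_+ defect rest′) (∑-+ (missing f) (missing g) (allFin n)))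
      (trans (+-assoc (∑ (missing f) (allFin n)) _ _) (sym (∑-↭ (λ f → ∑ (missing f) (allFin n)) pq))))
    (+-mono-<-≤ (∑-bound (λ v → missing f′ v + missing g′ v) (λ v → missing f v + missing g v) le (∈-allFin (f r))
      (<-≤-trans (s≤s at-w) (≤-trans (≤-reflexive (sym (missing-1 w∉g))) (m≤n+m _ (missing f (f r)))))) (≤-refl {defect rest′}))
  continue : ∀ m → defect fs ≤ m →
    ∃[ gs ] All (Injective _≡_ _≡_) gs × length gs ≡ length fs × (∀ s v → entries gs s v ≡ entries fs s v)
  continue zero bound = contradiction (<-≤-trans smaller bound) λ ()
  continue (suc m) bound =
    let gs , inj , len , eq = könig m fs′ (s≤s⁻¹ (<-≤-trans smaller bound)) (regular-resp {fs = fs} {gs = fs′} entries-eq len-eq reg)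
    in gs , inj , trans len len-eq , λ s v → trans (eq s v) (entries-eq s v)

-- Cycle decomposition of a permutation

Unique-resp-↭ : ∀ {xs ys : List A} → xs ↭ ys → Unique xs → Unique ys
Unique-resp-↭ {A = A} p = PermSetoid.Unique-resp-↭ (setoid A) (↭⇒↭ₛ p)

∈⇒↭ : ∀ {x : A} {xs} → x ∈ xs → ∃[ ys ] xs ↭ x ∷ ys
∈⇒↭ {xs = _ ∷ xs} (here refl) = xs , ↭-refl
∈⇒↭ {xs = y ∷ _}  (there x∈)  = let ys , p = ∈⇒↭ x∈ in y ∷ ys , ↭-trans (↭-prep y p) (↭-swap _ _ ↭-refl)

concatMap-↭ : (f : A → List B) → ∀ {xs ys} → xs ↭ ys → concatMap f xs ↭ concatMap f ys
concatMap-↭ f _↭_.refl         = ↭-refl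
concatMap-↭ f (_↭_.prep x p)   = ++⁺ˡ (f x) (concatMap-↭ f p)
concatMap-↭ f (_↭_.swap x y p) = ↭-trans (shifts (f x) (f y)) (++⁺ˡ (f y) (++⁺ˡ (f x) (concatMap-↭ f p)))
concatMap-↭ f (_↭_.trans p q)  = ↭-trans (concatMap-↭ f p) (concatMap-↭ f q)

Unique-++ˡ : ∀ (xs : List A) {ys} → Unique (xs ++ ys) → Unique xs
Unique-++ˡ []       _          = []
Unique-++ˡ (x ∷ xs) (x∉ ∷ uniq) = All.++⁻ˡ xs x∉ ∷ Unique-++ˡ xs uniq

Unique-++ʳ : ∀ (xs : List A) {ys} → Unique (xs ++ ys) → Unique ys
Unique-++ʳ []       uniq       = uniq
Unique-++ʳ (x ∷ xs) (_ ∷ uniq) = Unique-++ʳ xs uniq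

Unique-++-disjoint : ∀ (xs : List A) {ys} → Unique (xs ++ ys) → ∀ {z} → z ∈ xs → z ∉ ys
Unique-++-disjoint (x ∷ xs) (x∉ ∷ _) (here refl) z∈ys = All.lookup x∉ (∈-++⁺ʳ xs z∈ys) refl
Unique-++-disjoint (x ∷ xs) (_ ∷ uniq) (there z∈) z∈ys = Unique-++-disjoint xs uniq z∈ z∈ys

pathPairs-++ : ∀ (x : Fin n) xs zs → pathPairs (x ∷ xs ++ zs) ≡ pathPairs (x ∷ xs) ++ pathPairs (lastOr x xs ∷ zs)
pathPairs-++ x []       zs = refl
pathPairs-++ x (y ∷ xs) zs = cong ((x , y) ∷_) (pathPairs-++ y xs zs)

lastOr-++ : ∀ (x : Fin n) xs zs → lastOr x (xs ++ zs) ≡ lastOr (lastOr x xs) zs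
lastOr-++ x []       zs = refl
lastOr-++ x (y ∷ xs) zs = lastOr-++ y xs zs

lastOr-∈ : ∀ (x : Fin n) xs → lastOr x xs ∈ x ∷ xs
lastOr-∈ x []       = here refl
lastOr-∈ x (y ∷ xs) = there (lastOr-∈ y xs)

module _ {n : ℕ} where

  NEList : Set
  NEList = Fin n × List (Fin n)

  verts : NEList → List (Fin n)
  verts (x , xs) = x ∷ xs

  end : NEList → Fin n
  end (x , xs) = lastOr x xs

  end∈ : ∀ p → end p ∈ verts p
  end∈ (x , xs) = lastOr-∈ x xs

  support : List NEList → List (List (Fin n)) → List (Fin n)
  support ps cs = concatMap verts ps ++ concat cs

  arcs : List NEList → List (List (Fin n)) → List (Fin n × Fin n)
  arcs ps cs = concatMap (pathPairs ∘ verts) ps ++ concatMap cyclePairs cs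

  -- The arcs (v , f v) for v in vs form disjoint paths ps, single vertices included, and disjoint cycles cs.
  record Traced (f : Fin n → Fin n) (vs : List (Fin n)) : Set where
    field
      ps         : List NEList
      cs         : List (List (Fin n))
      disjoint   : Unique (support ps cs)
      counts     : ∀ u v → count (arcs ps cs) u v ≡ count (map (λ v → v , f v) vs) u v
      ends-free  : ∀ {p} → p ∈ ps → end p ∉ vs
      is-end     : ∀ {v} → v ∉ vs → ∃[ p ] p ∈ ps × end p ≡ v
      is-start   : ∀ {v} → v ∉ map f vs → ∃[ p ] p ∈ ps × proj₁ p ≡ v

  -- Arcs are added one at a time. Before the arc from a to `f a` is added, a has no outgoing arc
  -- and, by injectivity, `f a` has no incoming one; so a ends a path and `f a` starts a path. If
  -- these are the same path the arc closes it to a cycle, otherwise it links the two.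
  trace : ∀ {f} → Injective _≡_ _≡_ f → ∀ vs → Unique vs → Traced f vs
  trace inj [] _ = record
    { ps = map (λ v → v , []) (allFin n)
    ; cs = []
    ; disjoint = subst Unique (sym (trans (cong (_++ []) (singles (allFin n))) (++-identityʳ (allFin n)))) (Unique.allFin⁺ n)
    ; counts = λ u v → cong (λ ps → count (ps ++ []) u v) (no-pairs (allFin n))
    ; ends-free = λ _ ()
    ; is-end = λ {v} _ → (v , []) , ∈-map⁺ _ (∈-allFin v) , refl
    ; is-start = λ {v} _ → (v , []) , ∈-map⁺ _ (∈-allFin v) , refl
    }
    where
    singles : ∀ vs → concatMap verts (map (λ v → v , []) vs) ≡ vs
    singles []       = refl
    singles (v ∷ vs) = cong (v ∷_) (singles vs)
    no-pairs : ∀ vs → concatMap (pathPairs ∘ verts) (map (λ v → v , []) vs) ≡ []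
    no-pairs []       = refl
    no-pairs (v ∷ vs) = no-pairs vs
  trace {f} inj (a ∷ vs) (a∉ ∷ uniq) = result
    where
    T = trace inj vs uniq
    open Traced T
    a∉vs : a ∉ vs
    a∉vs a∈ = All.lookup a∉ a∈ refl
    fa∉ : f a ∉ map f vs
    fa∉ fa∈ with ∈-map⁻ f fa∈
    ... | v , v∈ , eq = a∉vs (subst (_∈ vs) (sym (inj eq)) v∈)

    close : ∀ p qs → ps ↭ p ∷ qs → end p ≡ a → proj₁ p ≡ f a → Traced f (a ∷ vs)
    close p qs perm e s = record
      { ps = qs
      ; cs = verts p ∷ cs
      ; disjoint = Unique-resp-↭ moved disjoint
      ; counts = λ u v → trans (∑-↭ _ rearrange) (cong (⟦ edge (a , f a) u v ⟧ +_) (trans (sym (∑-↭ _ arcs-perm)) (counts u v)))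
      ; ends-free = λ { q∈ (here eq) → separate q∈ (trans e (sym eq)) ; q∈ (there v∈) → ends-free (∈-resp-↭ (↭-sym perm) (there q∈)) v∈ }
      ; is-end = λ v∉ → other (λ q → end q) (λ eq → v∉ (here (trans (sym eq) e))) (is-end (v∉ ∘ there))
      ; is-start = λ v∉ → other proj₁ (λ eq → v∉ (here (trans (sym eq) s))) (is-start (v∉ ∘ there))
      }
      where
      perm′ : support ps cs ↭ verts p ++ support qs cs
      perm′ = ↭-trans (++⁺ʳ (concat cs) (concatMap-↭ verts perm)) (↭-reflexive (++-assoc (verts p) (concatMap verts qs) (concat cs)))
      moved : support ps cs ↭ support qs (verts p ∷ cs)
      moved = ↭-trans perm′ (shifts (verts p) (concatMap verts qs))
      arcs-perm : arcs ps cs ↭ pathPairs (verts p) ++ arcs qs cs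
      arcs-perm = ↭-trans (++⁺ʳ _ (concatMap-↭ (pathPairs ∘ verts) perm))
        (↭-reflexive (++-assoc (pathPairs (verts p)) (concatMap (pathPairs ∘ verts) qs) _))
      rearrange : arcs qs (verts p ∷ cs) ↭ (a , f a) ∷ pathPairs (verts p) ++ arcs qs cs
      rearrange = ↭-trans (shifts (concatMap (pathPairs ∘ verts) qs) (cyclePairs (verts p)))
        (↭-reflexive (cong₂ (λ x y → (x , y) ∷ pathPairs (verts p) ++ arcs qs cs) e s))
      separate : ∀ {q} → q ∈ qs → end p ≢ end q
      separate {q} q∈ eq = Unique-++-disjoint (verts p) (Unique-resp-↭ perm′ disjoint) (subst (_∈ verts p) eq (end∈ p))
        (∈-++⁺ˡ (∈-concatMap⁺ verts (Any.map (λ { refl → end∈ q }) q∈)))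
      other : ∀ {v} (g : NEList → Fin n) → g p ≢ v → (∃[ q ] q ∈ ps × g q ≡ v) → ∃[ q ] q ∈ qs × g q ≡ v
      other g p≢ (q , q∈ , eq) with ∈-resp-↭ perm q∈
      ... | here refl = contradiction eq p≢
      ... | there q∈′ = q , q∈′ , eq

    link : ∀ p q qs → ps ↭ p ∷ q ∷ qs → end p ≡ a → proj₁ q ≡ f a → Traced f (a ∷ vs)
    link p q qs perm e s = record
      { ps = pq ∷ qs
      ; cs = cs
      ; disjoint = subst Unique (cong (_++ concat cs) (sym (++-assoc (verts p) (verts q) (concatMap verts qs)))) (Unique-resp-↭ perm′ disjoint)
      ; counts = λ u v → trans (∑-↭ _ rearrange) (cong (⟦ edge (a , f a) u v ⟧ +_) (trans (sym (∑-↭ _ arcs-perm)) (counts u v)))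
      ; ends-free = free
      ; is-end = λ v∉ → other-end (λ eq → v∉ (here (trans (sym eq) e))) (is-end (v∉ ∘ there))
      ; is-start = λ v∉ → other-start (λ eq → v∉ (here (trans (sym eq) s))) (is-start (v∉ ∘ there))
      }
      where
      pq : NEList
      pq = proj₁ p , proj₂ p ++ verts q
      end-pq : end pq ≡ end q
      end-pq = lastOr-++ (proj₁ p) (proj₂ p) (verts q)
      perm′ : support ps cs ↭ (verts p ++ verts q ++ concatMap verts qs) ++ concat cs
      perm′ = ++⁺ʳ (concat cs) (concatMap-↭ verts perm)
      P = pathPairs (verts p)
      Q = pathPairs (verts q)
      R = concatMap (pathPairs ∘ verts) qs
      C = concatMap cyclePairs cs
      arcs-perm : arcs ps cs ↭ P ++ Q ++ R ++ C
      arcs-perm = ↭-trans (++⁺ʳ C (concatMap-↭ (pathPairs ∘ verts) perm))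
        (↭-reflexive (trans (++-assoc P (Q ++ R) C) (cong (P ++_) (++-assoc Q R C))))
      pq-pairs : pathPairs (verts pq) ≡ P ++ (a , f a) ∷ Q
      pq-pairs = trans (pathPairs-++ (proj₁ p) (proj₂ p) (verts q)) (cong₂ (λ x y → P ++ (x , y) ∷ Q) e s)
      rearrange : arcs (pq ∷ qs) cs ↭ (a , f a) ∷ P ++ Q ++ R ++ C
      rearrange = ↭-trans (↭-reflexive (trans (cong (λ z → (z ++ R) ++ C) pq-pairs)
          (trans (++-assoc (P ++ (a , f a) ∷ Q) R C) (++-assoc P ((a , f a) ∷ Q) (R ++ C)))))
        (Perm.shift (a , f a) P (Q ++ R ++ C))
      separate : ∀ {r} → r ∈ q ∷ qs → end p ≢ end r
      separate {r} r∈ eq = Unique-++-disjoint (verts p)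
        (subst Unique (++-assoc (verts p) _ (concat cs)) (Unique-resp-↭ perm′ disjoint)) (subst (_∈ verts p) eq (end∈ p))
        (∈-++⁺ˡ (∈-concatMap⁺ verts (Any.map (λ { refl → end∈ r }) r∈)))
      old-free : ∀ {r} → r ∈ q ∷ qs → end r ∉ a ∷ vs
      old-free r∈ (here eq)  = separate r∈ (trans e (sym eq))
      old-free r∈ (there v∈) = ends-free (∈-resp-↭ (↭-sym perm) (there r∈)) v∈
      free : ∀ {r} → r ∈ pq ∷ qs → end r ∉ a ∷ vs
      free (here refl) v∈ = old-free (here refl) (subst (_∈ a ∷ vs) end-pq v∈)
      free (there r∈)  v∈ = old-free (there r∈) v∈
      other-end : ∀ {v} → end p ≢ v → (∃[ r ] r ∈ ps × end r ≡ v) → ∃[ r ] r ∈ pq ∷ qs × end r ≡ v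
      other-end p≢ (r , r∈ , eq) with ∈-resp-↭ perm r∈
      ... | here refl         = contradiction eq p≢
      ... | there (here refl) = pq , here refl , trans end-pq eq
      ... | there (there r∈′) = r , there r∈′ , eq
      other-start : ∀ {v} → proj₁ q ≢ v → (∃[ r ] r ∈ ps × proj₁ r ≡ v) → ∃[ r ] r ∈ pq ∷ qs × proj₁ r ≡ v
      other-start q≢ (r , r∈ , eq) with ∈-resp-↭ perm r∈
      ... | here refl         = pq , here refl , eq
      ... | there (here refl) = contradiction eq q≢
      ... | there (there r∈′) = r , there r∈′ , eq

    result : Traced f (a ∷ vs)
    result with is-end a∉vs | is-start fa∉
    ... | p , p∈ , e | q , q∈ , s with ∈⇒↭ p∈
    ...   | qs , perm with ∈-resp-↭ perm q∈
    ...     | here refl = close p qs perm e s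
    ...     | there q∈′ with ∈⇒↭ q∈′
    ...       | qs′ , perm′ = link p q qs′ (↭-trans perm (↭-prep p perm′)) e s

  -- When every vertex has received its outgoing arc, a remaining path would have an end without
  -- one. So tracing all vertices leaves cycles only.
  cycleDecomposition : ∀ {f : Fin n → Fin n} → Injective _≡_ _≡_ f → ∃[ cs ] Unique (concat cs) ×
    (∀ u v → count (concatMap cyclePairs cs) u v ≡ count (map (λ v → v , f v) (allFin n)) u v)
  cycleDecomposition {f} inj = finish (trace inj (allFin n) (Unique.allFin⁺ n))
    where
    finish : Traced f (allFin n) → _
    finish record { ps = [] ; cs = cs ; disjoint = d ; counts = c } = cs , d , c
    finish record { ps = p ∷ _ ; ends-free = free } = contradiction (∈-allFin (end p)) (free (here refl))

-- Petersen's theorem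

⟦∧⟧ : ∀ a b → ⟦ a ∧ b ⟧ ≡ ⟦ a ⟧ * ⟦ b ⟧
⟦∧⟧ true  b = sym (+-identityʳ ⟦ b ⟧)
⟦∧⟧ false b = refl

∑-* : ∀ c (f : A → ℕ) xs → ∑ (λ x → c * f x) xs ≡ c * ∑ f xs
∑-* c f []       = sym (*-zeroʳ c)
∑-* c f (x ∷ xs) = trans (cong (c * f x +_) (∑-* c f xs)) (sym (*-distribˡ-+ c (f x) (∑ f xs)))

∑-sift : ∀ (g : Fin n → ℕ) w → ∑ (λ s → g s * δ w s) (allFin n) ≡ g w
∑-sift {n} g w = trans (∑-cong pointwise (allFin n)) (trans (∑-* (g w) (λ s → δ s w) (allFin n))
  (trans (cong (g w *_) (∑-δ w)) (*-identityʳ (g w))))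
  where
  pointwise : ∀ s → g s * δ w s ≡ g w * δ s w
  pointwise s with s ≟ w | w ≟ s
  ... | yes refl | yes _    = refl
  ... | yes refl | no  w≢w  = contradiction refl w≢w
  ... | no  s≢w  | yes refl = contradiction refl s≢w
  ... | no  _    | no  _    = trans (*-zeroʳ (g s)) (sym (*-zeroʳ (g w)))

sum-map : ∀ (f : A → ℕ) xs → sum (map f xs) ≡ ∑ f xs
sum-map f []       = refl
sum-map f (x ∷ xs) = cong (f x +_) (sum-map f xs)

mapPair : (A → B) → A × A → B × B
mapPair f (a , b) = f a , f b

lift : Fin n × Fin n → Fin (suc n) × Fin (suc n)
lift = mapPair suc

edge-lift-zero : ∀ (p : Fin n × Fin n) v → edge (lift p) zero v ≡ false
edge-lift-zero (a , b) v = ∧-zeroʳ (does (v ≟ suc a))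

count-lift : ∀ (ps : List (Fin n × Fin n)) u v → count (map lift ps) (suc u) (suc v) ≡ count ps u v
count-lift ps u v = ∑-map (λ p → ⟦ edge p (suc u) (suc v) ⟧) lift ps

count-lift-zero : ∀ (ps : List (Fin n × Fin n)) v → count (map lift ps) zero v ≡ 0
count-lift-zero ps v = trans (∑-map (λ p → ⟦ edge p zero v ⟧) lift ps)
  (∑-0 (λ p → cong ⟦_⟧ (edge-lift-zero p v)) ps)

count-++ : ∀ (ps qs : List (Fin n × Fin n)) u v → count (ps ++ qs) u v ≡ count ps u v + count qs u v
count-++ ps qs u v = ∑-++ (λ p → ⟦ edge p u v ⟧) ps qs

count-concatMap : ∀ (g : A → List (Fin n × Fin n)) xs u v → count (concatMap g xs) u v ≡ ∑ (λ x → count (g x) u v) xs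
count-concatMap g xs u v = ∑-concatMap (λ p → ⟦ edge p u v ⟧) g xs

count-sym : ∀ (ps : List (Fin n × Fin n)) u v → count ps u v ≡ count ps v u
count-sym ps u v = ∑-cong (λ p → cong ⟦_⟧ (edge-sym p u v)) ps

edgeList : (G : Graph n) → ∃[ ps ] ∀ u v → count ps u v ≡ ⟦ adj G u v ⟧
edgeList {zero} G = [] , λ ()
edgeList {suc n} G = star ++ map lift ps , counts
  where
  G₁ : Graph n
  G₁ = record { adj = λ u v → adj G (suc u) (suc v) ; sym = λ u v → adj-sym G (suc u) (suc v) ; irrefl = λ v → adj-irrefl G (suc v) }
  ps = proj₁ (edgeList G₁)
  spoke : Fin n → List (Fin (suc n) × Fin (suc n))
  spoke v = if adj G zero (suc v) then (zero , suc v) ∷ [] else []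
  star = concatMap spoke (allFin n)
  spoke-00 : ∀ v → count (spoke v) zero zero ≡ 0
  spoke-00 v with adj G zero (suc v)
  ... | true  = refl
  ... | false = refl
  spoke-0 : ∀ w v → count (spoke v) zero (suc w) ≡ ⟦ adj G zero (suc v) ⟧ * δ w v
  spoke-0 w v with adj G zero (suc v)
  ... | false = refl
  ... | true with w ≟ v
  ...   | yes _ = refl
  ...   | no _  = refl
  spoke-s : ∀ u w v → count (spoke v) (suc u) (suc w) ≡ 0
  spoke-s u w v with adj G zero (suc v)
  ... | true  = refl
  ... | false = refl
  split : ∀ u v → count (star ++ map lift ps) u v ≡ ∑ (λ w → count (spoke w) u v) (allFin n) + count (map lift ps) u v
  split u v = trans (count-++ star (map lift ps) u v) (cong (_+ count (map lift ps) u v) (count-concatMap spoke (allFin n) u v))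
  row₀ : ∀ v → count (star ++ map lift ps) zero v ≡ ⟦ adj G zero v ⟧
  row₀ zero    = trans (split zero zero) (trans (cong₂ _+_ (∑-0 spoke-00 (allFin n)) (count-lift-zero ps zero))
                   (sym (cong ⟦_⟧ (adj-irrefl G zero))))
  row₀ (suc v) = trans (split zero (suc v)) (trans (cong₂ _+_ (trans (∑-cong (spoke-0 v) (allFin n)) (∑-sift (λ w → ⟦ adj G zero (suc w) ⟧) v)) (count-lift-zero ps (suc v)))
                   (+-identityʳ _))
  counts : ∀ u v → count (star ++ map lift ps) u v ≡ ⟦ adj G u v ⟧
  counts zero    v       = row₀ v
  counts (suc u) zero    = trans (count-sym (star ++ map lift ps) (suc u) zero) (trans (row₀ (suc u)) (cong ⟦_⟧ (adj-sym G zero (suc u))))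
  counts (suc u) (suc v) = trans (split (suc u) (suc v)) (trans (cong₂ _+_ (∑-0 (spoke-s u v) (allFin n)) (count-lift ps u v))
                             (proj₂ (edgeList G₁) u v))

noLoops : ∀ (ps : List (Fin n × Fin n)) → (∀ v → count ps v v ≡ 0) → All (λ p → proj₁ p ≢ proj₂ p) ps
noLoops []             _  = []
noLoops ((a , b) ∷ ps) c0 = (λ { refl → contradiction (trans (sym (cong ⟦_⟧ (edge-self a a))) (m+n≡0⇒m≡0 _ (c0 a))) λ () })
  ∷ noLoops ps (λ v → m+n≡0⇒n≡0 _ (c0 v))

pathPairs-distinct : ∀ (xs : List (Fin n)) → Unique xs → All (λ p → proj₁ p ≢ proj₂ p) (pathPairs xs)
pathPairs-distinct []           _                    = []
pathPairs-distinct (x ∷ [])     _                    = []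
pathPairs-distinct (x ∷ y ∷ xs) ((x≢y ∷ _) ∷ uniq) = x≢y ∷ pathPairs-distinct (y ∷ xs) uniq

cyclePairs-distinct : ∀ (xs : List (Fin n)) → Unique xs → 2 ≤ length xs → All (λ p → proj₁ p ≢ proj₂ p) (cyclePairs xs)
cyclePairs-distinct (x ∷ [])     _ (s≤s ())
cyclePairs-distinct (x ∷ y ∷ xs) uniq@(x∉ ∷ _) _ = All.lookup x∉ (lastOr-∈ y xs) ∘ sym ∷ pathPairs-distinct (x ∷ y ∷ xs) uniq

count-diagonal : ∀ {ps : List (Fin n × Fin n)} → All (λ p → proj₁ p ≢ proj₂ p) ps → ∀ v → count ps v v ≡ 0
count-diagonal {ps = ps} ps≢ v = trans (∑-congᴬ (All.map (λ { {a , b} a≢b → cong ⟦_⟧ (loopless a≢b) }) ps≢)) (∑-0 (λ _ → refl) ps)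
  where
  loopless : ∀ {a b} → a ≢ b → edge (a , b) v v ≡ false
  loopless {a} {b} a≢b with edge (a , b) v v in eq
  ... | false = refl
  ... | true with edge-ends {p = a , b} {v} {v} eq
  ...   | inj₁ refl = contradiction refl a≢b
  ...   | inj₂ refl = contradiction refl a≢b

-- Off the diagonal the two alternatives in `edge` exclude each other. The indicator becomes a sum
-- of products, a form that can be summed over all vertices by `∑-sift`.
⟦edge⟧ : ∀ (a b : Fin n) {u v} → u ≢ v → ⟦ edge (a , b) u v ⟧ ≡ δ v b * δ u a + δ u b * δ v a
⟦edge⟧ a b {u} {v} u≢v with u ≟ a | v ≟ b | v ≟ a | u ≟ b
... | yes refl | _        | yes refl | _        = contradiction refl u≢v
... | _        | yes refl | _        | yes refl = contradiction refl u≢v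
... | yes _    | yes _    | no _     | no _     = refl
... | yes _    | no _     | no _     | yes _    = refl
... | yes _    | no _     | no _     | no _     = refl
... | no _     | yes _    | yes _    | no _     = refl
... | no _     | yes _    | no _     | no _     = refl
... | no _     | no _     | yes _    | yes _    = refl
... | no _     | no _     | yes _    | no _     = refl
... | no _     | no _     | no _     | yes _    = refl
... | no _     | no _     | no _     | no _     = refl

row : List (Fin n × Fin n) → Fin n → List (Fin n)
row os v = concatMap (λ p → if does (v ≟ proj₁ p) then proj₂ p ∷ [] else []) os

∑-row : ∀ (f : Fin n → ℕ) os v → ∑ f (row os v) ≡ ∑ (λ p → f (proj₂ p) * δ v (proj₁ p)) os
∑-row f os v = trans (∑-concatMap f _ os) (∑-cong pointwise os)
  where
  pointwise : ∀ p → ∑ f (if does (v ≟ proj₁ p) then proj₂ p ∷ [] else []) ≡ f (proj₂ p) * δ v (proj₁ p)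
  pointwise p with v ≟ proj₁ p
  ... | yes _ = trans (+-identityʳ _) (sym (*-identityʳ _))
  ... | no  _ = sym (*-zeroʳ (f (proj₂ p)))

length-∑ : ∀ (xs : List A) → length xs ≡ ∑ (λ _ → 1) xs
length-∑ []       = refl
length-∑ (x ∷ xs) = cong suc (length-∑ xs)

length-row : ∀ (os : List (Fin n × Fin n)) v → length (row os v) ≡ outdeg os v
length-row os v = trans (length-∑ (row os v)) (trans (∑-row (λ _ → 1) os v) (∑-cong (λ p → +-identityʳ _) os))

headOr : A → List A → A
headOr x []      = x
headOr x (y ∷ _) = y

-- The k columns of the table whose row v is padded by fixed points v.
columns : ℕ → (Fin n → List (Fin n)) → Columns n
columns zero    rows = []
columns (suc k) rows = (λ v → headOr v (rows v)) ∷ columns k (drop 1 ∘ rows)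

length-columns : ∀ k (rows : Fin n → List (Fin n)) → length (columns k rows) ≡ k
length-columns zero    rows = refl
length-columns (suc k) rows = cong suc (length-columns k (drop 1 ∘ rows))

-- Here e is the number of fixed points that pad row v to k entries.
entries-columns : ∀ k (rows : Fin n → List (Fin n)) v e w → length (rows v) + e ≡ k →
                  entries (columns k rows) v w ≡ ∑ (δ w) (rows v) + e * δ w v
entries-columns zero rows v e w eq with rows v | m+n≡0⇒m≡0 (length (rows v)) eq | m+n≡0⇒n≡0 (length (rows v)) eq
... | [] | _ | refl = refl
entries-columns (suc k) rows v e w eq with rows v in rv
... | y ∷ ys = trans (cong (δ w y +_) (trans (entries-columns k (drop 1 ∘ rows) v e w
                 (trans (cong (λ z → length (drop 1 z) + e) rv) (suc-injective eq)))
                   (cong (λ z → ∑ (δ w) (drop 1 z) + e * δ w v) rv)))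
               (sym (+-assoc (δ w y) (∑ (δ w) ys) (e * δ w v)))
entries-columns (suc k) rows v (suc e) w refl | [] = cong (δ w v +_)
  (trans (entries-columns k (drop 1 ∘ rows) v k w (cong (λ z → length (drop 1 z) + k) rv))
    (cong (λ z → ∑ (δ w) (drop 1 z) + k * δ w v) rv))

-- Lists with fewer than two vertices arise as fixed points of permutations and as trivial paths of
-- linear forests; they contribute no edge between distinct vertices.
proper : List (List A) → List (List A)
proper []                  = []
proper ([] ∷ Ds)           = proper Ds
proper ((_ ∷ []) ∷ Ds)     = proper Ds
proper ((x ∷ y ∷ D) ∷ Ds)  = (x ∷ y ∷ D) ∷ proper Ds

proper-long : (Ds : List (List A)) → All (λ D → 2 ≤ length D) (proper Ds)
proper-long []                 = []
proper-long ([] ∷ Ds)          = proper-long Ds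
proper-long ((_ ∷ []) ∷ Ds)    = proper-long Ds
proper-long ((x ∷ y ∷ D) ∷ Ds) = s≤s (s≤s z≤n) ∷ proper-long Ds

∈-proper : ∀ {z : A} Ds → z ∈ concat (proper Ds) → z ∈ concat Ds
∈-proper ([] ∷ Ds)          z∈ = ∈-proper Ds z∈
∈-proper ((_ ∷ []) ∷ Ds)    z∈ = there (∈-proper Ds z∈)
∈-proper ((x ∷ y ∷ D) ∷ Ds) z∈ with ∈-++⁻ (x ∷ y ∷ D) z∈
... | inj₁ z∈D = ∈-++⁺ˡ z∈D
... | inj₂ z∈  = ∈-++⁺ʳ (x ∷ y ∷ D) (∈-proper Ds z∈)

proper-unique : (Ds : List (List A)) → Unique (concat Ds) → Unique (concat (proper Ds))
proper-unique []                 uniq = uniq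
proper-unique ([] ∷ Ds)          uniq = proper-unique Ds uniq
proper-unique ((_ ∷ []) ∷ Ds)    (_ ∷ uniq) = proper-unique Ds uniq
proper-unique ((x ∷ y ∷ D) ∷ Ds) uniq =
  Unique.++⁺ (Unique-++ˡ (x ∷ y ∷ D) uniq) (proper-unique Ds (Unique-++ʳ (x ∷ y ∷ D) uniq))
    λ (z∈D , z∈) → Unique-++-disjoint (x ∷ y ∷ D) uniq z∈D (∈-proper Ds z∈)

count-proper : ∀ (Ds : List (List (Fin n))) {u v} → u ≢ v →
               count (concatMap cyclePairs (proper Ds)) u v ≡ count (concatMap cyclePairs Ds) u v
count-proper []                 u≢v = refl
count-proper ([] ∷ Ds)          u≢v = count-proper Ds u≢v
count-proper ((x ∷ []) ∷ Ds) {u} {v} u≢v = trans (count-proper Ds u≢v) (cong (_+ count (concatMap cyclePairs Ds) u v) (sym (loop x)))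
  where
  loop : ∀ x → ⟦ edge (x , x) u v ⟧ ≡ 0
  loop x with u ≟ x | v ≟ x
  ... | yes refl | yes refl = contradiction refl u≢v
  ... | yes _ | no _ = refl
  ... | no _ | yes _ = refl
  ... | no _ | no _ = refl
count-proper ((x ∷ y ∷ D) ∷ Ds) {u} {v} u≢v =
  trans (count-++ C (concatMap cyclePairs (proper Ds)) u v) (trans (cong (count C u v +_) (count-proper Ds u≢v))
    (sym (count-++ C (concatMap cyclePairs Ds) u v)))
  where C = cyclePairs (x ∷ y ∷ D)

DisjointCycles : List (List (Fin n)) → Set
DisjointCycles Ds = Unique (concat Ds) × All (λ D → 3 ≤ length D) Ds

cyclesPairs : List (List (Fin n)) → List (Fin n × Fin n)
cyclesPairs = concatMap cyclePairs

cyclesPairs-distinct : ∀ (Ds : List (List (Fin n))) → Unique (concat Ds) → All (λ D → 2 ≤ length D) Ds →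
                       All (λ p → proj₁ p ≢ proj₂ p) (cyclesPairs Ds)
cyclesPairs-distinct []       _    _           = []
cyclesPairs-distinct (D ∷ Ds) uniq (long ∷ ls) =
  All.++⁺ (cyclePairs-distinct D (Unique-++ˡ D uniq) long) (cyclesPairs-distinct Ds (Unique-++ʳ D uniq) ls)

-- Cycles of length two remain possible here: a permutation may swap two vertices, and only
-- simplicity of the graph excludes this.
columnsCycles : (gs : Columns n) → All (Injective _≡_ _≡_) gs →
  ∃[ Cs ] length Cs ≡ length gs × All (λ Ds → Unique (concat Ds) × All (λ D → 2 ≤ length D) Ds) Cs ×
          (∀ {u v} → u ≢ v → count (concatMap cyclesPairs Cs) u v ≡ entries gs u v + entries gs v u)
columnsCycles [] [] = [] , refl , [] , λ _ → refl
columnsCycles {n} (g ∷ gs) (inj ∷ injs) =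
  let Cs , len , good , counts = columnsCycles gs injs
      Ds , uniq , cnt = cycleDecomposition inj
  in proper Ds ∷ Cs , cong suc len , (proper-unique Ds uniq , proper-long Ds) ∷ good , λ {u} {v} u≢v →
     trans (count-++ (cyclesPairs (proper Ds)) (concatMap cyclesPairs Cs) u v) (trans (cong₂ _+_
       (trans (count-proper Ds u≢v) (trans (cnt u v) (graph u≢v))) (counts u≢v))
       (solve 4 (λ a b c d → (a :+ b) :+ (c :+ d) := (a :+ c) :+ (b :+ d)) refl
         (δ v (g u)) (δ u (g v)) (entries gs u v) (entries gs v u)))
  where
  open +-*-Solver using (solve; _:+_; _:=_)
  graph : ∀ {u v} → u ≢ v → count (map (λ s → s , g s) (allFin n)) u v ≡ δ v (g u) + δ u (g v)
  graph {u} {v} u≢v = trans (∑-map (λ p → ⟦ edge p u v ⟧) (λ s → s , g s) (allFin n))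
    (trans (∑-cong (λ s → ⟦edge⟧ s (g s) u≢v) (allFin n))
      (trans (∑-+ (λ s → δ v (g s) * δ u s) (λ s → δ u (g s) * δ v s) (allFin n)) (cong₂ _+_ (∑-sift (λ s → δ v (g s)) u) (∑-sift (λ s → δ u (g s)) v))))

degree≤Δ : ∀ (G : Graph n) v → deg G v ≤ Δ G
degree≤Δ {n} G v = bound (∈-allFin v)
  where
  bound : ∀ {vs} → v ∈ vs → deg G v ≤ foldr _⊔_ 0 (map (deg G) vs)
  bound (here refl) = m≤m⊔n _ _
  bound {w ∷ _} (there v∈) = ≤-trans (bound v∈) (m≤n⊔m (deg G w) _)

byDiagonal : ∀ (f g : Fin n → Fin n → ℕ) → (∀ v → f v v ≡ g v v) → (∀ {u v} → u ≢ v → f u v ≡ g u v) → ∀ u v → f u v ≡ g u v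
byDiagonal f g on off u v with u ≟ v
... | yes refl = on u
... | no  u≢v  = off u≢v

-- In a balanced orientation the outdegree is half the degree, so the out-neighbours of v fit into a
-- row of length `⌊ Δ G /2⌋`, filled up with copies of v. Since v has as many incoming as outgoing
-- arcs, it also occurs `⌊ Δ G /2⌋` times in the whole table. This is the regularity that `könig`
-- asks for, and every resulting column is a permutation.
petersen : (G : Graph n) → Eulerian G →
  ∃[ Cs ] length Cs ≡ ⌊ Δ G /2⌋ × All DisjointCycles Cs × (∀ u v → ⟦ adj G u v ⟧ ≡ count (concatMap cyclesPairs Cs) u v)
petersen {n} G even = Cs , trans len (trans len-gs (length-columns h (row os))) , All.tabulate (λ Ds∈ → long Ds∈) , counts
  where
  es = proj₁ (edgeList G)
  es-count = proj₂ (edgeList G)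

  degree-of : ∀ ps → (∀ u v → count ps u v ≡ ⟦ adj G u v ⟧) → ∀ v → degree ps v ≡ deg G v
  degree-of ps cnt v = trans (sym (∑-count (noLoops ps (λ v → trans (cnt v v) (cong ⟦_⟧ (adj-irrefl G v)))) v))
    (trans (∑-cong (cnt v) (allFin n)) (sym (sum-map (λ u → ⟦ adj G v u ⟧) (allFin n))))

  orientation = balancedOrientation es (λ v → trans (cong odd (degree-of es es-count v)) (even⇒¬odd (even v)))
  os = proj₁ orientation
  os-count : ∀ u v → count os u v ≡ ⟦ adj G u v ⟧
  os-count u v = trans (proj₁ (proj₂ orientation) u v) (es-count u v)
  balanced = proj₂ (proj₂ orientation)

  h = ⌊ Δ G /2⌋

  out≤k : ∀ v → outdeg os v ≤ h
  out≤k v = ≤-trans (≤-reflexive (trans (n≡⌊n+n/2⌋ (outdeg os v)) (cong ⌊_/2⌋ twice))) (⌊n/2⌋-mono (degree≤Δ G v))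
    where
    twice : outdeg os v + outdeg os v ≡ deg G v
    twice = trans (cong (outdeg os v +_) (balanced v))
      (trans (sym (∑-+ (λ p → δ v (proj₁ p)) (λ p → δ v (proj₂ p)) os)) (degree-of os os-count v))

  fs = columns h (row os)
  slack = λ v → h ∸ outdeg os v

  entries-fs : ∀ v w → entries fs v w ≡ ∑ (λ p → δ w (proj₂ p) * δ v (proj₁ p)) os + slack v * δ w v
  entries-fs v w = trans (entries-columns h (row os) v (slack v) w
      (trans (cong (_+ slack v) (length-row os v)) (m+[n∸m]≡n (out≤k v))))
    (cong (_+ slack v * δ w v) (∑-row (δ w) os v))

  regular : Regular fs
  regular w = begin
    ∑ (λ f → occurrences f w) fs ≡⟨ ∑-comm (λ f s → δ w (f s)) fs (allFin n) ⟩
    ∑ (λ s → entries fs s w) (allFin n) ≡⟨ ∑-cong (λ s → entries-fs s w) (allFin n) ⟩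
    ∑ (λ s → ∑ (λ p → δ w (proj₂ p) * δ s (proj₁ p)) os + slack s * δ w s) (allFin n)
      ≡⟨ ∑-+ (λ s → ∑ (λ p → δ w (proj₂ p) * δ s (proj₁ p)) os) (λ s → slack s * δ w s) (allFin n) ⟩
    ∑ (λ s → ∑ (λ p → δ w (proj₂ p) * δ s (proj₁ p)) os) (allFin n) + ∑ (λ s → slack s * δ w s) (allFin n)
      ≡⟨ cong₂ _+_ incoming (∑-sift slack w) ⟩
    indeg os w + slack w ≡⟨ cong (_+ slack w) (sym (balanced w)) ⟩
    outdeg os w + slack w ≡⟨ m+[n∸m]≡n (out≤k w) ⟩
    h ≡⟨ sym (length-columns h (row os)) ⟩
    length fs ∎
    where
    open ≡-Reasoning
    incoming : ∑ (λ s → ∑ (λ p → δ w (proj₂ p) * δ s (proj₁ p)) os) (allFin n) ≡ indeg os w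
    incoming = trans (∑-comm (λ s p → δ w (proj₂ p) * δ s (proj₁ p)) (allFin n) os)
      (∑-cong (λ p → trans (∑-* (δ w (proj₂ p)) (λ s → δ s (proj₁ p)) (allFin n))
        (trans (cong (δ w (proj₂ p) *_) (∑-δ (proj₁ p))) (*-identityʳ _))) os)

  colouring = könig (defect fs) fs ≤-refl regular
  gs = proj₁ colouring
  len-gs = proj₁ (proj₂ (proj₂ colouring))
  entries-gs = proj₂ (proj₂ (proj₂ colouring))

  classes = columnsCycles gs (proj₁ (proj₂ colouring))
  Cs = proj₁ classes
  len = proj₁ (proj₂ classes)
  good = proj₁ (proj₂ (proj₂ classes))

  off-diagonal : ∀ {u v} → u ≢ v → ⟦ adj G u v ⟧ ≡ count (concatMap cyclesPairs Cs) u v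
  off-diagonal {u} {v} u≢v = sym (begin
    count (concatMap cyclesPairs Cs) u v ≡⟨ proj₂ (proj₂ (proj₂ classes)) u≢v ⟩
    entries gs u v + entries gs v u ≡⟨ cong₂ _+_ (trans (entries-gs u v) (plain u≢v)) (trans (entries-gs v u) (plain (u≢v ∘ sym))) ⟩
    ∑ (λ p → δ v (proj₂ p) * δ u (proj₁ p)) os + ∑ (λ p → δ u (proj₂ p) * δ v (proj₁ p)) os
      ≡⟨ sym (∑-+ (λ p → δ v (proj₂ p) * δ u (proj₁ p)) (λ p → δ u (proj₂ p) * δ v (proj₁ p)) os) ⟩
    ∑ (λ p → δ v (proj₂ p) * δ u (proj₁ p) + δ u (proj₂ p) * δ v (proj₁ p)) os
      ≡⟨ ∑-cong (λ p → sym (⟦edge⟧ (proj₁ p) (proj₂ p) u≢v)) os ⟩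
    count os u v ≡⟨ os-count u v ⟩
    ⟦ adj G u v ⟧ ∎)
    where
    open ≡-Reasoning
    plain : ∀ {a b} → a ≢ b → entries fs a b ≡ ∑ (λ p → δ b (proj₂ p) * δ a (proj₁ p)) os
    plain {a} {b} a≢b = trans (entries-fs a b) (trans (cong (∑ (λ p → δ b (proj₂ p) * δ a (proj₁ p)) os +_)
      (trans (cong (slack a *_) (δ-≢ (a≢b ∘ sym))) (*-zeroʳ (slack a)))) (+-identityʳ _))

  diagonal : ∀ v → ⟦ adj G v v ⟧ ≡ count (concatMap cyclesPairs Cs) v v
  diagonal v = trans (cong ⟦_⟧ (adj-irrefl G v)) (sym (trans (count-concatMap cyclesPairs Cs v v)
    (trans (∑-congᴬ (All.map (λ (uniq , long) → count-diagonal (cyclesPairs-distinct _ uniq long) v) good)) (∑-0 (λ _ → refl) Cs))))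

  counts : ∀ u v → ⟦ adj G u v ⟧ ≡ count (concatMap cyclesPairs Cs) u v
  counts = byDiagonal (λ u v → ⟦ adj G u v ⟧) (count (concatMap cyclesPairs Cs)) diagonal off-diagonal

  -- A class cycle of length 2 would use its edge twice.
  long : ∀ {Ds} → Ds ∈ Cs → DisjointCycles Ds
  long {Ds} Ds∈ = proj₁ (All.lookup good Ds∈) , All.tabulate (λ {D} D∈ → three D D∈ (All.lookup (proj₂ (All.lookup good Ds∈)) D∈))
    where
    three : ∀ D → D ∈ Ds → 2 ≤ length D → 3 ≤ length D
    three (x ∷ []) _ (s≤s ())
    three (x ∷ y ∷ []) D∈ _ = contradiction (begin
      2 ≡⟨ sym (cong₂ (λ a b → ⟦ a ⟧ + (⟦ b ⟧ + 0)) (trans (edge-swap y x x y) (edge-self x y)) (edge-self x y)) ⟩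
      count (cyclePairs (x ∷ y ∷ [])) x y ≤⟨ ∑-∈ (λ D → count (cyclePairs D) x y) D∈ ⟩
      ∑ (λ D → count (cyclePairs D) x y) Ds ≡⟨ sym (count-concatMap cyclePairs Ds x y) ⟩
      count (cyclesPairs Ds) x y ≤⟨ ∑-∈ (λ Ds → count (cyclesPairs Ds) x y) Ds∈ ⟩
      ∑ (λ Ds → count (cyclesPairs Ds) x y) Cs ≡⟨ sym (count-concatMap cyclesPairs Cs x y) ⟩
      count (concatMap cyclesPairs Cs) x y ≡⟨ sym (counts x y) ⟩
      ⟦ adj G x y ⟧ ≤⟨ ⟦⟧≤1 _ ⟩
      1 ∎) 1+n≰n
      where open ≤-Reasoning
    three (x ∷ y ∷ z ∷ D) _ _ = s≤s (s≤s (s≤s z≤n))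

-- Covering disjoint cycles by two cycles

parity-++ : ∀ (ps qs : List (Fin n × Fin n)) u v → parity (ps ++ qs) u v ≡ parity ps u v xor parity qs u v
parity-++ ps qs u v = ⨁-++ (λ p → edge p u v) ps qs

parity-concatMap : ∀ (g : A → List (Fin n × Fin n)) xs u v → parity (concatMap g xs) u v ≡ ⨁ (λ x → parity (g x) u v) xs
parity-concatMap g xs u v = ⨁-concatMap (λ p → edge p u v) g xs

count⇒parity : ∀ {b} (ps : List (Fin n × Fin n)) {u v} → ⟦ b ⟧ ≡ count ps u v → b ≡ parity ps u v
count⇒parity {b = b} ps {u} {v} eq = trans (sym (odd-⟦⟧ b)) (trans (cong odd eq) (odd-count ps u v))

∨≡xor : ∀ {a b} → (a ≡ true → b ≢ true) → a ∨ b ≡ a xor b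
∨≡xor {true}  {true}  excl = contradiction refl (excl refl)
∨≡xor {true}  {false} excl = refl
∨≡xor {false}         excl = refl

hasEdge⁻ : ∀ (ps : List (Fin n × Fin n)) {u v} → hasEdge ps u v ≡ true → (u , v) ∈ ps ⊎ (v , u) ∈ ps
hasEdge⁻ (p ∷ ps) {u} {v} eq with edge p u v in eq′
... | false with hasEdge⁻ ps eq
...   | inj₁ i = inj₁ (there i)
...   | inj₂ i = inj₂ (there i)
hasEdge⁻ (p ∷ ps) {u} {v} eq | true with edge-ends {p = p} {u} {v} eq′
...   | inj₁ refl = inj₁ (here refl)
...   | inj₂ refl = inj₂ (here refl)

pathPairs-∈ : ∀ (xs : List (Fin n)) {a b} → (a , b) ∈ pathPairs xs → a ∈ xs × b ∈ xs
pathPairs-∈ (x ∷ y ∷ xs) (here refl) = here refl , there (here refl)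
pathPairs-∈ (x ∷ y ∷ xs) (there i)   = let a∈ , b∈ = pathPairs-∈ (y ∷ xs) i in there a∈ , there b∈

hasEdge-path-∈ : ∀ (xs : List (Fin n)) {u v} → hasEdge (pathPairs xs) u v ≡ true → u ∈ xs × v ∈ xs
hasEdge-path-∈ xs eq with hasEdge⁻ (pathPairs xs) eq
... | inj₁ i = pathPairs-∈ xs i
... | inj₂ i = let a∈ , b∈ = pathPairs-∈ xs i in b∈ , a∈

hasEdge-path : ∀ (xs : List (Fin n)) → Unique xs → ∀ u v → hasEdge (pathPairs xs) u v ≡ parity (pathPairs xs) u v
hasEdge-path []           _           u v = refl
hasEdge-path (x ∷ [])     _           u v = refl
hasEdge-path (x ∷ y ∷ xs) (x∉ ∷ uniq) u v =
  trans (∨≡xor (λ e h → All.lookup x∉ (x∈ e (hasEdge-path-∈ (y ∷ xs) h)) refl)) (cong (edge (x , y) u v xor_) (hasEdge-path (y ∷ xs) uniq u v))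
  where
  x∈ : edge (x , y) u v ≡ true → u ∈ y ∷ xs × v ∈ y ∷ xs → x ∈ y ∷ xs
  x∈ e (u∈ , v∈) with edge-ends {p = x , y} {u} {v} e
  ... | inj₁ refl = u∈
  ... | inj₂ refl = v∈

Cyclic : List (Fin n) → Set
Cyclic D = Unique D × 3 ≤ length D

-- Union and symmetric difference of the edges agree because no edge is repeated. Length three is
-- what separates the closing edge from the first edge of the path: the last vertex is then not the
-- second.
hasEdge-cycle : ∀ {D : List (Fin n)} → Cyclic D → ∀ u v → hasEdge (cyclePairs D) u v ≡ parity (cyclePairs D) u v
hasEdge-cycle {D = x ∷ []} (_ , s≤s ())
hasEdge-cycle {D = x ∷ y ∷ []} (_ , s≤s (s≤s ()))
hasEdge-cycle {n} {D = x ∷ y ∷ z ∷ zs} (uniq@(x∉ ∷ y∉ ∷ _) , _) u v =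
  trans (∨≡xor clash) (cong (edge (l , x) u v xor_) (hasEdge-path (x ∷ y ∷ z ∷ zs) uniq u v))
  where
  l = lastOr z zs
  l∈ : l ∈ z ∷ zs
  l∈ = lastOr-∈ z zs
  member : ∀ {a b} → (a , b) ∈ pathPairs (x ∷ y ∷ z ∷ zs) → (l , x) ≢ (a , b) × (x , l) ≢ (a , b)
  member (here refl) = (λ { refl → All.lookup x∉ (there l∈) refl }) , λ eq → All.lookup y∉ l∈ (sym (cong proj₂ eq))
  member (there i) = let a∈ , b∈ = pathPairs-∈ (y ∷ z ∷ zs) i in
    (λ { refl → All.lookup x∉ b∈ refl }) , (λ { refl → All.lookup x∉ a∈ refl })
  clash : edge (l , x) u v ≡ true → hasEdge (pathPairs (x ∷ y ∷ z ∷ zs)) u v ≢ true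
  clash e h with edge-ends {p = l , x} {u} {v} e | hasEdge⁻ (pathPairs (x ∷ y ∷ z ∷ zs)) h
  ... | inj₁ refl | inj₁ i = proj₁ (member i) refl
  ... | inj₁ refl | inj₂ i = proj₂ (member i) refl
  ... | inj₂ refl | inj₁ i = proj₂ (member i) refl
  ... | inj₂ refl | inj₂ i = proj₁ (member i) refl

-- The upper bounds are proved for bare vertex lists and equations between parities; this translates
-- them back to `Cycle` and `symDiff`.
oddCover : ∀ {A : Adj n} (Ds : List (List (Fin n))) → All Cyclic Ds → (∀ u v → A u v ≡ parity (cyclesPairs Ds) u v) →
           ∀ {k} → length Ds ≤ k → C2≤ A k
oddCover {n} {A} Ds cyc eq {k} len = cycles cyc , (λ u v → trans (symDiff-cycles cyc u v) (sym (eq u v))) , subst (_≤ k) (sym (length-cycles cyc)) len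
  where
  cycles : ∀ {Ds} → All Cyclic Ds → List (Cycle {n})
  cycles []                        = []
  cycles {D ∷ _} ((uniq , long) ∷ cs) = record { verts = D ; distinct = uniq ; long = long } ∷ cycles cs
  length-cycles : ∀ {Ds} (cs : All Cyclic Ds) → length (cycles cs) ≡ length Ds
  length-cycles []       = refl
  length-cycles (_ ∷ cs) = cong suc (length-cycles cs)
  symDiff-cycles : ∀ {Ds} (cs : All Cyclic Ds) u v → symDiff (cycles cs) u v ≡ parity (cyclesPairs Ds) u v
  symDiff-cycles []       u v = refl
  symDiff-cycles {D ∷ Ds} (c ∷ cs) u v = trans (cong₂ _xor_ (hasEdge-cycle c u v) (symDiff-cycles cs u v))
    (sym (parity-++ (cyclePairs D) (cyclesPairs Ds) u v))

data Twin {n : ℕ} : (xs ys : List (Fin n)) → Set where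
  twin : ∀ x {xs ys} → lastOr x xs ≡ lastOr x ys → Twin (x ∷ xs) (x ∷ ys)

lastOr-twins : ∀ {Ls Ms : List (List (Fin n))} → Pointwise Twin Ls Ms → ∀ z → lastOr z (concat Ls) ≡ lastOr z (concat Ms)
lastOr-twins [] z = refl
lastOr-twins {Ls = _ ∷ Ls} {Ms = _ ∷ Ms} (twin x {xs} {ys} eq ∷ tw) z = trans (lastOr-++ x xs (concat Ls))
  (trans (trans (lastOr-twins tw (lastOr x xs)) (cong (λ l → lastOr l (concat Ms)) eq)) (sym (lastOr-++ x ys (concat Ms))))

-- Twin paths are joined up by the same linking edges, which cancel.
path-twins : ∀ {Ls Ms : List (List (Fin n))} → Pointwise Twin Ls Ms → ∀ z u v →
  parity (pathPairs (z ∷ concat Ls)) u v xor parity (pathPairs (z ∷ concat Ms)) u v ≡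
  ⨁ (λ L → parity (pathPairs L) u v) Ls xor ⨁ (λ L → parity (pathPairs L) u v) Ms
path-twins [] z u v = refl
path-twins {Ls = _ ∷ Ls} {Ms = _ ∷ Ms} (twin x {xs} {ys} eq ∷ tw) z u v
  rewrite pathPairs-++ x xs (concat Ls) | pathPairs-++ x ys (concat Ms)
        | parity-++ (pathPairs (x ∷ xs)) (pathPairs (lastOr x xs ∷ concat Ls)) u v
        | parity-++ (pathPairs (x ∷ ys)) (pathPairs (lastOr x ys ∷ concat Ms)) u v | sym eq =
  trans (solve 5 (λ e p r q s → (e :+ (p :+ r)) :+ (e :+ (q :+ s)) := (p :+ q) :+ (r :+ s)) refl
          (edge (z , x) u v) P R Q S)
    (trans (cong ((P xor Q) xor_) (path-twins tw (lastOr x xs) u v))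
      (solve 4 (λ p q r s → (p :+ q) :+ (r :+ s) := (p :+ r) :+ (q :+ s)) refl P Q R′ S′))
  where
  open xor-∧-Solver using (solve; _:+_; _:=_)
  P = parity (pathPairs (x ∷ xs)) u v
  Q = parity (pathPairs (x ∷ ys)) u v
  R = parity (pathPairs (lastOr x xs ∷ concat Ls)) u v
  S = parity (pathPairs (lastOr x xs ∷ concat Ms)) u v
  R′ = ⨁ (λ L → parity (pathPairs L) u v) Ls
  S′ = ⨁ (λ L → parity (pathPairs L) u v) Ms

cycle-twins : ∀ {Ls Ms : List (List (Fin n))} → Pointwise Twin Ls Ms → ∀ u v →
  parity (cyclePairs (concat Ls)) u v xor parity (cyclePairs (concat Ms)) u v ≡
  ⨁ (λ L → parity (pathPairs L) u v) Ls xor ⨁ (λ L → parity (pathPairs L) u v) Ms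
cycle-twins [] u v = refl
cycle-twins {Ms = _ ∷ Ms} tws@(twin x {xs} {ys} eq ∷ tw) u v =
  -- Both cycles have the same last vertex l and the same first vertex x, so their closing edge can
  -- be treated as one more linking edge, leading from l into the first pair of twins.
  trans (cong (parity (pathPairs (l ∷ x ∷ xs ++ _)) u v xor_)
          (cong (λ l → parity ((l , x) ∷ pathPairs (x ∷ ys ++ concat Ms)) u v) (sym (lastOr-twins tws x))))
    (path-twins tws l u v)
  where l = lastOr x (xs ++ _)

-- Read as a path, this is the closing edge of the cycle on the given list; read as a list of
-- vertices, the two ends of a path. A one-element list gives its vertex twice.
ends : List (Fin n) → List (Fin n)
ends []       = []
ends (x ∷ xs) = x ∷ lastOr x xs ∷ []

twin-ends : ∀ {D : List (Fin n)} → 2 ≤ length D → Twin D (ends D)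
twin-ends {D = x ∷ y ∷ D} _ = twin x refl
twin-ends {D = x ∷ []} (s≤s ())

ends-twin : ∀ {D : List (Fin n)} → 2 ≤ length D → Twin (ends D) D
ends-twin {D = x ∷ y ∷ D} _ = twin x refl
ends-twin {D = x ∷ []} (s≤s ())

cycle-ends : ∀ (D : List (Fin n)) u v →
  parity (pathPairs D) u v xor parity (pathPairs (ends D)) u v ≡ parity (cyclePairs D) u v
cycle-ends []       u v = refl
cycle-ends (x ∷ xs) u v =
  trans (cong (λ e → parity (pathPairs (x ∷ xs)) u v xor (e xor false)) (edge-swap x (lastOr x xs) u v))
    (solve 2 (λ p e → p :+ (e :+ con false) := e :+ p) refl (parity (pathPairs (x ∷ xs)) u v) (edge (lastOr x xs , x) u v))
  where open xor-∧-Solver using (solve; _:+_; _:=_; con)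

-- The two cycles visiting Ds and Es, where the first shortcuts each member of Es and the second each member of Ds,
-- share their linking edges and exchange the edges closing the cycles in Ds and Es.
weave₁ weave₂ : (Ds Es : List (List (Fin n))) → List (Fin n)
weave₁ Ds Es = concat (Ds ++ map ends Es)
weave₂ Ds Es = concat (map ends Ds ++ Es)

weave : ∀ (Ds Es : List (List (Fin n))) → All (λ D → 2 ≤ length D) Ds → All (λ D → 2 ≤ length D) Es → ∀ u v →
  parity (cyclePairs (weave₁ Ds Es)) u v xor parity (cyclePairs (weave₂ Ds Es)) u v ≡
  parity (cyclesPairs Ds) u v xor parity (cyclesPairs Es) u v
weave {n} Ds Es longD longE u v = trans (cycle-twins (twins longD) u v)
  (trans (cong₂ _xor_ (⨁-++ P Ds (map ends Es)) (⨁-++ P (map ends Ds) Es))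
    (trans (solve 4 (λ a b c d → (a :+ b) :+ (c :+ d) := (a :+ c) :+ (d :+ b)) refl
             (⨁ P Ds) (⨁ P (map ends Es)) (⨁ P (map ends Ds)) (⨁ P Es))
      (cong₂ _xor_ (closed Ds) (closed Es))))
  where
  open xor-∧-Solver using (solve; _:+_; _:=_)
  P = λ L → parity (pathPairs L) u v
  shortcuts : ∀ {Es : List (List (Fin n))} → All (λ D → 2 ≤ length D) Es → Pointwise Twin (map ends Es) Es
  shortcuts []       = []
  shortcuts (l ∷ ls) = ends-twin l ∷ shortcuts ls
  twins : ∀ {Ds : List (List (Fin n))} → All (λ D → 2 ≤ length D) Ds → Pointwise Twin (Ds ++ map ends Es) (map ends Ds ++ Es)
  twins []       = shortcuts longE
  twins (l ∷ ls) = twin-ends l ∷ twins ls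
  closed : ∀ Ds → ⨁ P Ds xor ⨁ P (map ends Ds) ≡ parity (cyclesPairs Ds) u v
  closed Ds = trans (cong (⨁ P Ds xor_) (⨁-map P ends Ds)) (trans (sym (⨁-xor P (P ∘ ends) Ds))
    (trans (⨁-cong (λ D → cycle-ends D u v) Ds) (sym (parity-concatMap cyclePairs Ds u v))))

ends-⊆ : ∀ (D : List (Fin n)) {z} → z ∈ ends D → z ∈ D
ends-⊆ (x ∷ xs) (here refl)         = here refl
ends-⊆ (x ∷ xs) (there (here refl)) = lastOr-∈ x xs

ends-unique : ∀ (D : List (Fin n)) → Unique D → 2 ≤ length D → Unique (ends D)
ends-unique (x ∷ [])     _ (s≤s ())
ends-unique (x ∷ y ∷ xs) (x∉ ∷ _) _ = (All.lookup x∉ (lastOr-∈ y xs) ∷ []) ∷ [] ∷ []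

shortcut : List (List (Fin n)) → List (Fin n)
shortcut Ds = concat (map ends Ds)

shortcut-⊆ : ∀ (Ds : List (List (Fin n))) {z} → z ∈ shortcut Ds → z ∈ concat Ds
shortcut-⊆ (D ∷ Ds) z∈ with ∈-++⁻ (ends D) z∈
... | inj₁ z∈D = ∈-++⁺ˡ (ends-⊆ D z∈D)
... | inj₂ z∈′ = ∈-++⁺ʳ D (shortcut-⊆ Ds z∈′)

shortcut-unique : ∀ (Ds : List (List (Fin n))) → Unique (concat Ds) → All (λ D → 2 ≤ length D) Ds → Unique (shortcut Ds)
shortcut-unique []       _    _        = []
shortcut-unique (D ∷ Ds) uniq (l ∷ ls) =
  Unique.++⁺ (ends-unique D (Unique-++ˡ D uniq) l) (shortcut-unique Ds (Unique-++ʳ D uniq) ls)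
    λ (z∈ , z∈′) → Unique-++-disjoint D uniq (ends-⊆ D z∈) (shortcut-⊆ Ds z∈′)

-- This is `weave` with an empty second class. The cycle formed by the closing edges has two
-- vertices per member and hence needs two members; a single member is already a cycle.
twoCycles : ∀ {Ds : List (List (Fin n))} → DisjointCycles Ds →
            ∃[ Xs ] All Cyclic Xs × length Xs ≤ 2 × (∀ u v → parity (cyclesPairs Ds) u v ≡ parity (cyclesPairs Xs) u v)
twoCycles {Ds = []} _ = [] , [] , z≤n , λ _ _ → refl
twoCycles {Ds = D ∷ []} (uniq , l ∷ []) = D ∷ [] , (subst Unique (++-identityʳ D) uniq , l) ∷ [] , s≤s z≤n , λ _ _ → refl
twoCycles {Ds = _ ∷ [] ∷ _} (_ , _ ∷ () ∷ _)
twoCycles {Ds = Ds@(D@(_ ∷ _) ∷ E@(_ ∷ _) ∷ Fs)} (uniq , long@(l ∷ _)) =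
  weave₁ Ds [] ∷ weave₂ Ds [] ∷ [] ,
  (subst Unique (sym (cong concat (++-identityʳ Ds))) uniq ,
   ≤-trans l (≤-trans (m≤m+n _ _) (≤-reflexive (sym (length-++ D))))) ∷
  (subst Unique (sym (cong concat (++-identityʳ (map ends Ds)))) (shortcut-unique Ds uniq long₂) , s≤s (s≤s (s≤s z≤n))) ∷ [] ,
  s≤s (s≤s z≤n) ,
  λ u v → trans (sym (xor-identityʳ _)) (trans (sym (weave Ds [] long₂ [] u v))
    (trans (cong (parity (cyclePairs (weave₁ Ds [])) u v xor_) (trans (sym (xor-identityʳ _)) (sym (parity-++ (cyclePairs (weave₂ Ds [])) [] u v))))
      (sym (parity-++ (cyclePairs (weave₁ Ds [])) (cyclesPairs (weave₂ Ds [] ∷ [])) u v))))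
  where
  long₂ : All (λ D → 2 ≤ length D) Ds
  long₂ = All.map (≤-trans (s≤s (s≤s z≤n))) long

twoCyclesEach : ∀ {Cs : List (List (List (Fin n)))} → All DisjointCycles Cs →
  ∃[ Xs ] All Cyclic Xs × length Xs ≤ 2 * length Cs × (∀ u v → parity (concatMap cyclesPairs Cs) u v ≡ parity (cyclesPairs Xs) u v)
twoCyclesEach [] = [] , [] , z≤n , λ _ _ → refl
twoCyclesEach {Cs = Ds ∷ Cs} (d ∷ ds) =
  let Xs , cx , lx , ex = twoCycles d
      Ys , cy , ly , ey = twoCyclesEach ds
  in Xs ++ Ys , All.++⁺ cx cy ,
     ≤-trans (≤-reflexive (length-++ Xs)) (≤-trans (+-mono-≤ lx ly) (≤-reflexive (sym (*-suc 2 (length Cs))))) ,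
     λ u v → trans (parity-++ (cyclesPairs Ds) (concatMap cyclesPairs Cs) u v) (trans (cong₂ _xor_ (ex u v) (ey u v))
       (sym (trans (parity-concatMap cyclePairs (Xs ++ Ys) u v) (trans (⨁-++ (λ D → parity (cyclePairs D) u v) Xs Ys)
         (cong₂ _xor_ (sym (parity-concatMap cyclePairs Xs u v)) (sym (parity-concatMap cyclePairs Ys u v)))))))

c₂≤Δ : (G : Graph n) → Eulerian G → C2≤ (adj G) (Δ G)
c₂≤Δ G even =
  let Cs , len , good , counts = petersen G even
      Xs , cyc , lenX , eq = twoCyclesEach good
  in oddCover Xs cyc (λ u v → trans (count⇒parity (concatMap cyclesPairs Cs) {u} {v} (counts u v)) (eq u v))
       (≤-trans lenX (≤-trans (≤-reflexive (cong (2 *_) len)) (2⌊n/2⌋≤n (Δ G))))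
  where
  2⌊n/2⌋≤n : ∀ n → 2 * ⌊ n /2⌋ ≤ n
  2⌊n/2⌋≤n n = ≤-trans (+-monoʳ-≤ ⌊ n /2⌋ (≤-trans (≤-reflexive (+-identityʳ ⌊ n /2⌋)) (⌊n/2⌋≤⌈n/2⌉ n))) (≤-reflexive (⌊n/2⌋+⌈n/2⌉≡n n))

-- The lower bound for subdivisions

∑-sources : ∀ (f : Fin n → ℕ) x xs → ∑ (f ∘ proj₁) (pathPairs (x ∷ xs)) + f (lastOr x xs) ≡ ∑ f (x ∷ xs)
∑-sources f x []       = +-comm 0 (f x)
∑-sources f x (y ∷ xs) = trans (+-assoc (f x) _ _) (cong (f x +_) (∑-sources f y xs))

∑-targets : ∀ (f : Fin n → ℕ) x xs → f x + ∑ (f ∘ proj₂) (pathPairs (x ∷ xs)) ≡ ∑ f (x ∷ xs)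
∑-targets f x []       = refl
∑-targets f x (y ∷ xs) = cong (f x +_) (∑-targets f y xs)

unique-∑-δ : ∀ (xs : List (Fin n)) → Unique xs → ∀ v → ∑ (δ v) xs ≤ 1
unique-∑-δ []       _           v = z≤n
unique-∑-δ (x ∷ xs) (x∉ ∷ uniq) v with v ≟ x
... | no  _    = unique-∑-δ xs uniq v
... | yes refl = s≤s (≤-reflexive (trans (∑-congᴬ (All.map δ-≢ x∉)) (∑-0 (λ _ → refl) xs)))

degree-split : ∀ (ps : List (Fin n × Fin n)) v → degree ps v ≡ outdeg ps v + indeg ps v
degree-split ps v = ∑-+ (λ p → δ v (proj₁ p)) (λ p → δ v (proj₂ p)) ps

degree-cycle : ∀ (D : List (Fin n)) → Unique D → ∀ v → degree (cyclePairs D) v ≤ 2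
degree-cycle []       _    v = z≤n
degree-cycle (x ∷ xs) uniq v = ≤-trans (≤-reflexive (degree-split (cyclePairs (x ∷ xs)) v)) (+-mono-≤
  (≤-trans (≤-reflexive (trans (+-comm (δ v (lastOr x xs)) _) (∑-sources (δ v) x xs))) (unique-∑-δ (x ∷ xs) uniq v))
  (≤-trans (≤-reflexive (∑-targets (δ v) x xs)) (unique-∑-δ (x ∷ xs) uniq v)))

rowSum : Adj n → Fin n → ℕ
rowSum {n} A v = ∑ (λ u → ⟦ A v u ⟧) (allFin n)

⟦∨⟧≤ : ∀ a b → ⟦ a ∨ b ⟧ ≤ ⟦ a ⟧ + ⟦ b ⟧
⟦∨⟧≤ true  b = s≤s z≤n
⟦∨⟧≤ false b = ≤-refl

⟦xor⟧≤ : ∀ a b → ⟦ a xor b ⟧ ≤ ⟦ a ⟧ + ⟦ b ⟧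
⟦xor⟧≤ true  true  = z≤n
⟦xor⟧≤ true  false = s≤s z≤n
⟦xor⟧≤ false b     = ≤-refl

hasEdge≤count : ∀ (ps : List (Fin n × Fin n)) u v → ⟦ hasEdge ps u v ⟧ ≤ count ps u v
hasEdge≤count []       u v = z≤n
hasEdge≤count (p ∷ ps) u v = ≤-trans (⟦∨⟧≤ (edge p u v) _) (+-monoʳ-≤ ⟦ edge p u v ⟧ (hasEdge≤count ps u v))

rowSum-cycle : ∀ (c : Cycle {n}) v → rowSum (cycleAdj c) v ≤ 2
rowSum-cycle {n} c v = ≤-trans (∑-mono (hasEdge≤count (cyclePairs D) v) (allFin n))
  (≤-trans (≤-reflexive (∑-count (cyclePairs-distinct D distinct (≤-trans (s≤s (s≤s z≤n)) long)) v)) (degree-cycle D distinct v))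
  where open Cycle c renaming (verts to D)

symDiff≤ : ∀ (cs : List (Cycle {n})) u v → ⟦ symDiff cs u v ⟧ ≤ ∑ (λ c → ⟦ cycleAdj c u v ⟧) cs
symDiff≤ []       u v = z≤n
symDiff≤ (c ∷ cs) u v = ≤-trans (⟦xor⟧≤ (cycleAdj c u v) _) (+-monoʳ-≤ ⟦ cycleAdj c u v ⟧ (symDiff≤ cs u v))

rowSum≤2length : ∀ {A : Adj n} {cs} → OddCover A cs → ∀ v → rowSum A v ≤ length cs + length cs
rowSum≤2length {n} {A} {cs} cover v = begin
  rowSum A v                                        ≡⟨ ∑-cong (λ u → cong ⟦_⟧ (sym (cover v u))) (allFin n) ⟩
  rowSum (symDiff cs) v                             ≤⟨ ∑-mono (symDiff≤ cs v) (allFin n) ⟩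
  ∑ (λ u → ∑ (λ c → ⟦ cycleAdj c v u ⟧) cs) (allFin n) ≡⟨ ∑-comm (λ u c → ⟦ cycleAdj c v u ⟧) (allFin n) cs ⟩
  ∑ (λ c → rowSum (cycleAdj c) v) cs                ≤⟨ ∑-mono (λ c → rowSum-cycle c v) cs ⟩
  ∑ (λ _ → 1 + 1) cs                                ≡⟨ ∑-+ (λ _ → 1) (λ _ → 1) cs ⟩
  ∑ (λ _ → 1) cs + ∑ (λ _ → 1) cs                   ≡⟨ sym (cong₂ _+_ (length-∑ cs) (length-∑ cs)) ⟩
  length cs + length cs                             ∎
  where open ≤-Reasoning

-- Subdivisions are bare adjacency functions, so the graph axioms travel with them as a property.
record Simple (A : Adj n) : Set where
  field
    symmetric   : ∀ u v → A u v ≡ A v u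
    irreflexive : ∀ v → A v v ≡ false
open Simple

-- The left-hand side is the condition under which subdivide deletes the edge xy.
removed : ∀ (u v x y : Fin n) →
  (does (x ≟ u) ∧ does (y ≟ v)) ∨ (does (x ≟ v) ∧ does (y ≟ u)) ≡ edge (u , v) x y
removed u v x y = cong ((does (x ≟ u) ∧ does (y ≟ v)) ∨_) (∧-comm (does (x ≟ v)) _)

subdivide-old : ∀ {A : Adj n} → Simple A → ∀ {u v} → A u v ≡ true → ∀ x y →
  ⟦ A x y ⟧ ≡ ⟦ edge (u , v) x y ⟧ + ⟦ subdivide A u v (suc x) (suc y) ⟧
subdivide-old {A = A} simple {u} {v} Auv x y rewrite removed u v x y with edge (u , v) x y in eq
... | false = cong ⟦_⟧ (sym (∧-identityʳ (A x y)))
... | true  = trans (cong ⟦_⟧ Axy) (cong suc (sym (cong ⟦_⟧ (∧-zeroʳ (A x y)))))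
  where
  Axy : A x y ≡ true
  Axy with edge-ends {p = u , v} {x} {y} eq
  ... | inj₁ refl = Auv
  ... | inj₂ refl = trans (symmetric simple x y) Auv

edge⇒≢ : ∀ {A : Adj n} → Simple A → ∀ {u v} → A u v ≡ true → u ≢ v
edge⇒≢ simple {u} Auv refl = contradiction (trans (sym Auv) (irreflexive simple u)) λ ()

either : ∀ {u v : Fin n} → u ≢ v → ∀ x → ⟦ does (x ≟ u) ∨ does (x ≟ v) ⟧ ≡ δ x u + δ x v
either {u = u} {v} u≢v x with x ≟ u | x ≟ v
... | yes refl | yes refl = contradiction refl u≢v
... | yes _    | no _     = refl
... | no _     | yes _    = refl
... | no _     | no _     = refl

subdivide-simple : ∀ {A : Adj n} → Simple A → ∀ u v → Simple (subdivide A u v)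
subdivide-simple {A = A} simple u v = record { symmetric = s ; irreflexive = i }
  where
  s : ∀ x y → subdivide A u v x y ≡ subdivide A u v y x
  s zero    zero    = refl
  s zero    (suc y) = refl
  s (suc x) zero    = refl
  s (suc x) (suc y) = cong₂ (λ a e → a ∧ not e) (symmetric simple x y)
    (trans (removed u v x y) (trans (edge-sym (u , v) x y) (sym (removed u v y x))))
  i : ∀ x → subdivide A u v x x ≡ false
  i zero    = refl
  i (suc x) rewrite irreflexive simple x = refl

-- An end of the subdivided edge loses one neighbour and gains the new vertex; every other old
-- vertex keeps its neighbours.
rowSum-subdivide : ∀ {A : Adj n} → Simple A → ∀ {u v} → A u v ≡ true → ∀ x →
                   rowSum (subdivide A u v) (suc x) ≡ rowSum A x
rowSum-subdivide {n} {A} simple {u} {v} Auv x = trans (∑-allFin-suc {n} (λ y → ⟦ subdivide A u v (suc x) y ⟧))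
  (trans (cong (_+ ∑ (λ y → ⟦ subdivide A u v (suc x) (suc y) ⟧) (allFin n))
           (trans (either u≢v x) (sym (∑-edge u≢v x))))
    (trans (sym (∑-+ (λ y → ⟦ edge (u , v) x y ⟧) (λ y → ⟦ subdivide A u v (suc x) (suc y) ⟧) (allFin n)))
      (sym (∑-cong (subdivide-old simple Auv x) (allFin n)))))
  where u≢v = edge⇒≢ simple Auv

subdivision-simple : ∀ {A : Adj n} → Simple A → ∀ {m H} → Subdivision A m H → Simple H
subdivision-simple simple here           = simple
subdivision-simple simple (step sub u v _) = subdivide-simple (subdivision-simple simple sub) u v

subdivision-rowSum : ∀ {A : Adj n} → Simple A → ∀ {m H} → Subdivision A m H → ∀ v → ∃[ w ] rowSum H w ≡ rowSum A v
subdivision-rowSum simple here v = v , refl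
subdivision-rowSum simple (step sub a b Bab) v =
  let w , eq = subdivision-rowSum simple sub v
  in suc w , trans (rowSum-subdivide (subdivision-simple simple sub) Bab w) eq

graph-simple : (G : Graph n) → Simple (adj G)
graph-simple G = record { symmetric = adj-sym G ; irreflexive = adj-irrefl G }

-- The first alternative accounts for the empty list, where the fold returns its default value 0.
maximum-attained : ∀ (f : A → ℕ) xs → foldr _⊔_ 0 (map f xs) ≡ 0 ⊎ ∃[ x ] f x ≡ foldr _⊔_ 0 (map f xs)
maximum-attained f []       = inj₁ refl
maximum-attained f (x ∷ xs) with ⊔-sel (f x) (foldr _⊔_ 0 (map f xs)) | maximum-attained f xs
... | inj₁ eq | _              = inj₂ (x , sym eq)
... | inj₂ eq | inj₁ eq₀       = inj₁ (trans eq eq₀)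
... | inj₂ eq | inj₂ (y , eqy) = inj₂ (y , trans eqy (sym eq))

-- A vertex of maximum degree keeps its degree in every subdivision, and each cycle of a cover
-- contributes at most two edges at it.
c₂top≥ : (G : Graph n) → ∀ m (H : Adj m) → Subdivision (adj G) m H → C2≥ H ⌊ Δ G /2⌋
c₂top≥ {n} G m H sub cs cover = ≤-trans (⌊n/2⌋-mono Δ≤) (≤-reflexive (sym (n≡⌊n+n/2⌋ (length cs))))
  where
  Δ≤ : Δ G ≤ length cs + length cs
  Δ≤ with maximum-attained (deg G) (allFin n)
  ... | inj₁ eq = ≤-trans (≤-reflexive eq) z≤n
  ... | inj₂ (v , eq) =
    let w , same = subdivision-rowSum (graph-simple G) sub v
    in ≤-trans (≤-reflexive (trans (sym eq) (trans (sum-map (λ u → ⟦ adj G v u ⟧) (allFin n)) (sym same)))) (rowSum≤2length {A = H} {cs} cover w)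

-- Opening the cycles by subdivision

subdivide-count : ∀ {A : Adj n} → Simple A → ∀ {a b} ps → (∀ u v → ⟦ A u v ⟧ ≡ count ((a , b) ∷ ps) u v) →
  A a b ≡ true × (∀ u v → ⟦ subdivide A a b u v ⟧ ≡ count ((suc a , zero) ∷ (zero , suc b) ∷ map lift ps) u v)
subdivide-count {A = A} simple {a} {b} ps eq = Aab , counts
  where
  Aab : A a b ≡ true
  Aab with A a b | trans (eq a b) (cong (λ e → ⟦ e ⟧ + count ps a b) (edge-self a b))
  ... | true  | _ = refl
  ... | false | ()
  Q = (suc a , zero) ∷ (zero , suc b) ∷ map lift ps
  row₀ : ∀ v → ⟦ subdivide A a b zero v ⟧ ≡ count Q zero v
  row₀ zero    = sym (count-lift-zero ps zero)
  row₀ (suc y) = trans (either (edge⇒≢ simple Aab) y)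
    (trans (cong₂ _+_ (cong ⟦_⟧ (sym (∧-identityʳ (does (y ≟ a))))) (cong ⟦_⟧ (sym (∨-identityʳ (does (y ≟ b))))))
      (cong (⟦ does (y ≟ a) ∧ true ⟧ +_) (trans (sym (+-identityʳ _)) (cong (⟦ does (y ≟ b) ∨ false ⟧ +_) (sym (count-lift-zero ps (suc y)))))))
  counts : ∀ u v → ⟦ subdivide A a b u v ⟧ ≡ count Q u v
  counts zero    v       = row₀ v
  counts (suc x) zero    = trans (cong ⟦_⟧ (Simple.symmetric (subdivide-simple simple a b) (suc x) zero))
    (trans (row₀ (suc x)) (count-sym Q zero (suc x)))
  counts (suc x) (suc y) = +-cancelˡ-≡ ⟦ edge (a , b) x y ⟧ _ _
    (trans (sym (subdivide-old simple Aab x y)) (trans (eq x y)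
      (cong (⟦ edge (a , b) x y ⟧ +_) (sym (trans (cong₂ (λ p q → ⟦ p ⟧ + (⟦ q ⟧ + count (map lift ps) (suc x) (suc y)))
        (cong₂ _∨_ (∧-zeroʳ (does (x ≟ a))) (∧-zeroʳ (does (y ≟ a)))) refl) (count-lift ps x y))))))

pathPairs-map : ∀ (f : Fin n → Fin m) xs → pathPairs (map f xs) ≡ map (mapPair f) (pathPairs xs)
pathPairs-map f []           = refl
pathPairs-map f (x ∷ [])     = refl
pathPairs-map f (x ∷ y ∷ xs) = cong ((f x , f y) ∷_) (pathPairs-map f (y ∷ xs))

lastOr-map : ∀ (f : Fin n → Fin m) x xs → lastOr (f x) (map f xs) ≡ f (lastOr x xs)
lastOr-map f x []       = refl
lastOr-map f x (y ∷ xs) = lastOr-map f y xs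

cyclePairs-map : ∀ (f : Fin n → Fin m) xs → cyclePairs (map f xs) ≡ map (mapPair f) (cyclePairs xs)
cyclePairs-map f []       = refl
cyclePairs-map f (x ∷ xs) = cong₂ (λ l ps → (l , f x) ∷ ps) (lastOr-map f x xs) (pathPairs-map f (x ∷ xs))

cyclesPairs-map : ∀ (f : Fin n → Fin m) Ds → cyclesPairs (map (map f) Ds) ≡ map (mapPair f) (cyclesPairs Ds)
cyclesPairs-map f []       = refl
cyclesPairs-map f (D ∷ Ds) = trans (cong₂ _++_ (cyclePairs-map f D) (cyclesPairs-map f Ds))
  (sym (map-++ (mapPair f) (cyclePairs D) (cyclesPairs Ds)))

suc² : Fin n → Fin (suc (suc n))
suc² x = suc (suc x)

-- D with its closing edge replaced by a path through the two fresh vertices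
opened : List (Fin n) → List (Fin (suc (suc n)))
opened D = suc zero ∷ map suc² D ++ zero ∷ []

-- The first three pairs are the pieces into which two subdivisions cut the closing edge, in their
-- order from the last vertex to x. On the right the middle piece has become the closing edge of the
-- opened cycle.
count-opened : ∀ (x : Fin n) xs Q u v →
  count ((suc² (lastOr x xs) , zero) ∷ (zero , suc zero) ∷ (suc zero , suc² x) ∷ map (mapPair suc²) (pathPairs (x ∷ xs) ++ Q)) u v ≡
  count (cyclePairs (opened (x ∷ xs)) ++ map (mapPair suc²) Q) u v
count-opened x xs Q u v = begin
  c₁ + (c₂ + (c₃ + count (map (mapPair suc²) (P ++ Q)) u v))
    ≡⟨ cong (λ z → c₁ + (c₂ + (c₃ + z))) (trans (cong (λ z → count z u v) (map-++ (mapPair suc²) P Q)) (count-++ P′ Q′ u v)) ⟩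
  c₁ + (c₂ + (c₃ + (count P′ u v + count Q′ u v)))
    ≡⟨ solve 5 (λ a b c p q → a :+ (b :+ (c :+ (p :+ q))) := b :+ (c :+ (p :+ (a :+ con 0))) :+ q) refl c₁ c₂ c₃ (count P′ u v) (count Q′ u v) ⟩
  c₂ + (c₃ + (count P′ u v + (c₁ + 0))) + count Q′ u v
    ≡⟨ cong (λ z → c₂ + (c₃ + z) + count Q′ u v) (sym (count-++ P′ ((suc² (lastOr x xs) , zero) ∷ []) u v)) ⟩
  c₂ + (c₃ + count (P′ ++ (suc² (lastOr x xs) , zero) ∷ []) u v) + count Q′ u v
    ≡⟨ cong₂ (λ l z → ⟦ edge (l , suc zero) u v ⟧ + (c₃ + count z u v) + count Q′ u v) (sym last-opened) (sym path-opened) ⟩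
  count (cyclePairs (opened (x ∷ xs))) u v + count Q′ u v
    ≡⟨ sym (count-++ (cyclePairs (opened (x ∷ xs))) Q′ u v) ⟩
  count (cyclePairs (opened (x ∷ xs)) ++ Q′) u v ∎
  where
  open ≡-Reasoning
  open +-*-Solver using (solve; _:+_; _:=_; con)
  P = pathPairs (x ∷ xs)
  P′ = map (mapPair suc²) P
  Q′ = map (mapPair suc²) Q
  c₁ = ⟦ edge (suc² (lastOr x xs) , zero) u v ⟧
  c₂ = ⟦ edge (zero , suc zero) u v ⟧
  c₃ = ⟦ edge (suc zero , suc² x) u v ⟧
  last-opened : lastOr (suc zero) (map suc² (x ∷ xs) ++ zero ∷ []) ≡ zero
  last-opened = lastOr-++ (suc zero) (map suc² (x ∷ xs)) (zero ∷ [])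
  path-opened : pathPairs (map suc² (x ∷ xs) ++ zero ∷ []) ≡ P′ ++ (suc² (lastOr x xs) , zero) ∷ []
  path-opened = trans (pathPairs-++ (suc² x) (map suc² xs) (zero ∷ []))
    (cong₂ (λ p l → p ++ (l , zero) ∷ []) (pathPairs-map suc² (x ∷ xs)) (lastOr-map suc² x xs))

OpenedBy : (Fin n → Fin m) → List (Fin n) → List (Fin m) → Set
OpenedBy f D D′ = ∃[ a ] ∃[ b ] D′ ≡ a ∷ map f D ++ b ∷ []

ends-opened : ∀ (a b : Fin n) xs → ends (a ∷ xs ++ b ∷ []) ≡ a ∷ b ∷ []
ends-opened a b xs = cong (λ l → a ∷ l ∷ []) (lastOr-++ a xs (b ∷ []))

-- `Ds` are cycles still to be opened and `Q` the other edges of the current graph, whose vertices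
-- are followed by `f` through all later renumberings. Since each list in `Es` begins and ends with
-- a fresh vertex, `fresh` and `new` say that the closing edges of `Es` are vertex-disjoint and
-- avoid the vertices present so far.
record Opening {n} (A : Adj n) {k} (Ds : List (List (Fin k))) (Q : List (Fin k × Fin k)) : Set where
  field
    {size}      : ℕ
    H           : Adj size
    subdivision : Subdivision A size H
    f           : Fin k → Fin size
    injective   : Injective _≡_ _≡_ f
    Es          : List (List (Fin size))
    open-by     : Pointwise (OpenedBy f) Ds Es
    fresh       : Unique (shortcut Es)
    new         : ∀ x → f x ∉ shortcut Es
    counts      : ∀ u v → ⟦ H u v ⟧ ≡ count (cyclesPairs Es ++ map (mapPair f) Q) u v

-- While `Ds` is being opened, the opened D waits among the other edges. Its two fresh vertices
-- count as old for the later openings, which therefore avoid them; afterwards D moves from the edge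
-- list to the opened cycles.
open-∷ : ∀ {A : Adj n} {k} (D : List (Fin k)) Ds Q →
  Opening A (map (map suc²) Ds) (cyclePairs (opened D) ++ map (mapPair suc²) Q) → Opening A (D ∷ Ds) Q
open-∷ D Ds Q O = record
  { H = O.H
  ; subdivision = O.subdivision
  ; f = f
  ; injective = λ {u} {v} e → Fin.suc-injective (Fin.suc-injective (O.injective e))
  ; Es = map O.f (opened D) ∷ O.Es
  ; open-by = (O.f (suc zero) , O.f zero , cong (O.f (suc zero) ∷_) (opened-map D)) ∷ unmap Ds O.open-by
  ; fresh = subst (λ E → Unique (E ++ shortcut O.Es)) (sym ends-D)
      (((λ e → 1≢0 (O.injective e)) ∷ All.tabulate (λ i e → O.new (suc zero) (subst (_∈ shortcut O.Es) (sym e) i)))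
        ∷ All.tabulate (λ i e → O.new zero (subst (_∈ shortcut O.Es) (sym e) i)) ∷ O.fresh)
  ; new = λ y y∈ → new y (subst (λ E → f y ∈ E ++ shortcut O.Es) ends-D y∈)
  ; counts = counts
  }
  where
  module O = Opening O
  f = O.f ∘ suc²
  1≢0 : suc zero ≢ zero
  1≢0 ()
  opened-map : ∀ D → map O.f (map suc² D ++ zero ∷ []) ≡ map f D ++ O.f zero ∷ []
  opened-map D = trans (map-++ O.f (map suc² D) (zero ∷ [])) (cong (_++ O.f zero ∷ []) (sym (map-∘ D)))
  ends-D : ends (map O.f (opened D)) ≡ O.f (suc zero) ∷ O.f zero ∷ []
  ends-D = trans (cong (λ E → ends (O.f (suc zero) ∷ E)) (opened-map D)) (ends-opened (O.f (suc zero)) (O.f zero) (map f D))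
  unmap : ∀ Ds {Es} → Pointwise (OpenedBy O.f) (map (map suc²) Ds) Es → Pointwise (OpenedBy f) Ds Es
  unmap []       []                    = []
  unmap (D ∷ Ds) ((a , b , refl) ∷ pw) = (a , b , cong (λ E → a ∷ E ++ b ∷ []) (sym (map-∘ D))) ∷ unmap Ds pw
  new : ∀ y → f y ∉ O.f (suc zero) ∷ O.f zero ∷ shortcut O.Es
  new y (here e)         = contradiction (O.injective e) λ ()
  new y (there (here e)) = contradiction (O.injective e) λ ()
  new y (there (there i)) = O.new (suc² y) i
  counts : ∀ u v → ⟦ O.H u v ⟧ ≡ count (cyclesPairs (map O.f (opened D) ∷ O.Es) ++ map (mapPair f) Q) u v
  counts u v = trans (O.counts u v) (∑-↭ (λ p → ⟦ edge p u v ⟧) (↭-trans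
    (↭-reflexive (cong (cyclesPairs O.Es ++_) (trans (map-++ (mapPair O.f) (cyclePairs (opened D)) (map (mapPair suc²) Q))
      (cong₂ _++_ (sym (cyclePairs-map O.f (opened D))) (sym (map-∘ Q))))))
    (↭-trans (shifts (cyclesPairs O.Es) (cyclePairs (map O.f (opened D))))
      (↭-reflexive (sym (++-assoc (cyclePairs (map O.f (opened D))) (cyclesPairs O.Es) (map (mapPair f) Q)))))))

-- The recursion is on ℓ because each step renumbers the vertices in the tail of `Ds`.
openCycles : ∀ ℓ {A : Adj n} {k} {B : Adj k} → Subdivision A k B → Simple B → ∀ Ds Q → length Ds ≡ ℓ → All (λ D → 3 ≤ length D) Ds →
             (∀ u v → ⟦ B u v ⟧ ≡ count (cyclesPairs Ds ++ Q) u v) → Opening A Ds Q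
openCycles zero {B = B} sub simple [] Q _ _ eq = record
  { H = B ; subdivision = sub ; f = id ; injective = id ; Es = [] ; open-by = [] ; fresh = [] ; new = λ _ ()
  ; counts = λ u v → trans (eq u v) (cong (λ q → count q u v) (sym (map-id Q))) }
openCycles (suc ℓ) {B = B} sub simple (D@(x ∷ xs) ∷ Ds) Q len (_ ∷ long) eq =
  -- The second subdivision cuts the half between l and the first new vertex, so the two new
  -- vertices become adjacent.
  open-∷ D Ds Q (openCycles ℓ (step (step sub l x (proj₁ sub₁)) (suc l) zero (proj₁ sub₂))
    (subdivide-simple simple₁ (suc l) zero) Ds₂ Q₂ (trans (length-map (map suc²) Ds) (suc-injective len))
    (All.map⁺ (All.map (λ {D} le → ≤-trans le (≤-reflexive (sym (length-map suc² D)))) long)) reorder)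
  where
  l = lastOr x xs
  ps₁ = pathPairs D ++ (cyclesPairs Ds ++ Q)
  eq₁ : ∀ u v → ⟦ B u v ⟧ ≡ count ((l , x) ∷ ps₁) u v
  eq₁ u v = trans (eq u v) (cong (λ q → count q u v) (++-assoc (cyclePairs D) (cyclesPairs Ds) Q))
  sub₁ = subdivide-count simple ps₁ eq₁
  simple₁ = subdivide-simple simple l x
  ps₂ = (zero , suc x) ∷ map lift ps₁
  sub₂ = subdivide-count simple₁ ps₂ (proj₂ sub₁)
  B₂ = subdivide (subdivide B l x) (suc l) zero
  Ds₂ = map (map suc²) Ds
  Q₂ = cyclePairs (opened D) ++ map (mapPair suc²) Q
  reorder : ∀ u v → ⟦ B₂ u v ⟧ ≡ count (cyclesPairs Ds₂ ++ Q₂) u v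
  reorder u v = trans (proj₂ sub₂ u v)
    (trans (cong (λ z → count ((suc² l , zero) ∷ (zero , suc zero) ∷ (suc zero , suc² x) ∷ z) u v) (sym (map-∘ ps₁)))
      (trans (count-opened x xs (cyclesPairs Ds ++ Q) u v)
        (∑-↭ (λ p → ⟦ edge p u v ⟧) (↭-trans (↭-reflexive (cong (cyclePairs (opened D) ++_) (trans (map-++ (mapPair suc²) (cyclesPairs Ds) Q)
            (cong (_++ map (mapPair suc²) Q) (sym (cyclesPairs-map suc² Ds))))))
          (shifts (cyclePairs (opened D)) (cyclesPairs Ds₂))))))

-- Absorbing all classes

shortcut-++ : ∀ (Ds Es : List (List (Fin n))) → shortcut (Ds ++ Es) ≡ shortcut Ds ++ shortcut Es
shortcut-++ []       Es = refl
shortcut-++ (D ∷ Ds) Es = trans (cong (ends D ++_) (shortcut-++ Ds Es)) (sym (++-assoc (ends D) (shortcut Ds) (shortcut Es)))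

shortcut-concat : ∀ (Cs : List (List (List (Fin n)))) → shortcut (concat Cs) ≡ concatMap shortcut Cs
shortcut-concat []        = refl
shortcut-concat (Ds ∷ Cs) = trans (shortcut-++ Ds (concat Cs)) (cong (shortcut Ds ++_) (shortcut-concat Cs))

shortcut-ends : ∀ (Ds : List (List (Fin n))) → shortcut (map ends Ds) ≡ shortcut Ds
shortcut-ends []             = refl
shortcut-ends ([] ∷ Ds)      = shortcut-ends Ds
shortcut-ends ((x ∷ D) ∷ Ds) = cong (λ E → x ∷ lastOr x D ∷ E) (shortcut-ends Ds)

cyclesPairs-concat : ∀ (Cs : List (List (List (Fin n)))) → cyclesPairs (concat Cs) ≡ concatMap cyclesPairs Cs
cyclesPairs-concat []        = refl
cyclesPairs-concat (Ds ∷ Cs) = trans (concatMap-++ cyclePairs Ds (concat Cs)) (cong (cyclesPairs Ds ++_) (cyclesPairs-concat Cs))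

module _ {R : A → B → Set} where

  Pointwise-split : ∀ xs {ys zs} → Pointwise R (xs ++ ys) zs →
                    ∃[ us ] ∃[ vs ] zs ≡ us ++ vs × Pointwise R xs us × Pointwise R ys vs
  Pointwise-split []       pw       = [] , _ , refl , [] , pw
  Pointwise-split (x ∷ xs) (r ∷ pw) =
    let us , vs , eq , pw₁ , pw₂ = Pointwise-split xs pw in _ ∷ us , vs , cong (_ ∷_) eq , r ∷ pw₁ , pw₂

  Pointwise-concat⁻ : ∀ xss {zs} → Pointwise R (concat xss) zs → ∃[ zss ] zs ≡ concat zss × Pointwise (Pointwise R) xss zss
  Pointwise-concat⁻ []         []  = [] , refl , []
  Pointwise-concat⁻ (xs ∷ xss) pw =
    let us , vs , eq , pw₁ , pw₂ = Pointwise-split xs pw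
        zss , eq′ , pw′ = Pointwise-concat⁻ xss pw₂
    in us ∷ zss , trans eq (cong (us ++_) eq′) , pw₁ ∷ pw′

concat-opened : ∀ {f : Fin n → Fin m} {Ds Es} → Pointwise (OpenedBy f) Ds Es → concat Es ↭ shortcut Es ++ map f (concat Ds)
concat-opened [] = ↭-refl
concat-opened {f = f} {D ∷ Ds} {_ ∷ Es} ((a , b , refl) ∷ pw) =
  ↭-trans (↭-prep a (↭-trans (↭-reflexive (++-assoc (map f D) (b ∷ []) (concat Es)))
    (↭-trans (Perm.shift b (map f D) (concat Es)) (↭-prep b (↭-trans (++⁺ˡ (map f D) (concat-opened pw))
      (↭-trans (shifts (map f D) (shortcut Es)) (↭-reflexive (cong (shortcut Es ++_) (sym (map-++ f D (concat Ds)))))))))))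
    (↭-reflexive (cong (_++ (shortcut Es ++ map f (concat (D ∷ Ds)))) (sym (ends-opened a b (map f D)))))

lastOr-concat : ∀ (Ls : List (List (Fin n))) l → lastOr l (concat Ls) ≡ l ⊎ lastOr l (concat Ls) ∈ shortcut Ls
lastOr-concat []             l = inj₁ refl
lastOr-concat ([] ∷ Ls)      l = lastOr-concat Ls l
lastOr-concat ((x ∷ xs) ∷ Ls) l with lastOr-concat Ls (lastOr x xs)
... | inj₁ eq = inj₂ (there (here (trans (lastOr-++ x xs (concat Ls)) eq)))
... | inj₂ i  = inj₂ (there (there (subst (_∈ shortcut Ls) (sym (lastOr-++ x xs (concat Ls))) i)))

-- A woven cycle inherits its end vertices from ends of its members. As these are fresh, it can be
-- shortcut in its turn at the next step.
ends-concat : ∀ (Ls : List (List (Fin n))) {z} → z ∈ ends (concat Ls) → z ∈ shortcut Ls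
ends-concat ([] ∷ Ls) z∈ = ends-concat Ls z∈
ends-concat ((x ∷ xs) ∷ Ls) (here refl) = here refl
ends-concat ((x ∷ xs) ∷ Ls) (there (here refl)) with lastOr-concat ((x ∷ xs) ∷ Ls) x
... | inj₁ eq = here eq
... | inj₂ i  = i

NonEmpty : List A → Set
NonEmpty xs = 1 ≤ length xs

concat-long : ∀ {Ds : List (List (Fin n))} → NonEmpty Ds → All (λ D → 3 ≤ length D) Ds → 3 ≤ length (concat Ds)
concat-long {Ds = D ∷ Ds} _ (l ∷ _) = ≤-trans l (≤-trans (m≤m+n _ _) (≤-reflexive (sym (length-++ D))))

module Weaving {m : ℕ} (Old : Fin m → Set) where

  -- Different classes may share old vertices but not fresh ones; `interior` separates the two
  -- kinds.
  record Class (Es : List (List (Fin m))) : Set where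
    field
      unique   : Unique (concat Es)
      long     : All (λ E → 3 ≤ length E) Es
      nonempty : NonEmpty Es
      interior : ∀ {z} → z ∈ concat Es → Old z ⊎ z ∈ shortcut Es
  open Class

  -- `Ds` accumulates what has been woven. Weaving it with `Es` gives c, which visits all of `Ds`
  -- and shortcuts `Es`, and d, which visits all of `Es` and shortcuts `Ds`. If more classes follow,
  -- d is put into the cover and c alone is the new accumulator. The vertices of `Ds` avoid the
  -- fresh vertices of all classes to come, so c is simple; the ends of `Ds` are not old, so d is
  -- simple. Each step produces one final cycle and the last one two, hence as many cycles as
  -- classes, counting `Ds` at the start as one.
  weaveAll : ∀ Ds Es Fs → Unique (concat Ds) → All (λ D → 3 ≤ length D) Ds → NonEmpty Ds →
    (∀ {z} → z ∈ concat Ds → z ∉ concatMap shortcut (Es ∷ Fs)) → (∀ {z} → z ∈ shortcut Ds → ¬ Old z) →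
    All Class (Es ∷ Fs) → Unique (concatMap shortcut (Es ∷ Fs)) → (∀ {z} → z ∈ concatMap shortcut (Es ∷ Fs) → ¬ Old z) →
    ∃[ Xs ] All Cyclic Xs × length Xs ≡ 2 + length Fs ×
      (∀ u v → parity (cyclesPairs Xs) u v ≡ parity (cyclesPairs Ds) u v xor parity (concatMap cyclesPairs (Es ∷ Fs)) u v)
  weaveAll Ds Es Fs uniqD longD nonD apart new (cl ∷ cls) uniqS newS = finish Fs cls uniqS newS apart
    where
    c = weave₁ Ds Es
    d = weave₂ Ds Es
    2≤ : ∀ {Ds : List (List (Fin m))} → All (λ D → 3 ≤ length D) Ds → All (λ D → 2 ≤ length D) Ds
    2≤ = All.map (≤-trans (n≤1+n 2))
    c≡ : c ≡ concat Ds ++ shortcut Es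
    c≡ = sym (concat-++ Ds (map ends Es))
    d≡ : d ≡ shortcut Ds ++ concat Es
    d≡ = sym (concat-++ (map ends Ds) Es)
    cyclic-c : Cyclic c
    cyclic-c = subst Cyclic (sym c≡)
      ( Unique.++⁺ uniqD (Unique-++ˡ (shortcut Es) uniqS) (λ (z∈ , z∈′) → apart z∈ (∈-++⁺ˡ z∈′))
      , ≤-trans (concat-long nonD longD) (≤-trans (m≤m+n _ _) (≤-reflexive (sym (length-++ (concat Ds))))))
    cyclic-d : Cyclic d
    cyclic-d = subst Cyclic (sym d≡)
      ( Unique.++⁺ (shortcut-unique Ds uniqD (2≤ longD)) (unique cl) disjoint
      , ≤-trans (concat-long (nonempty cl) (long cl)) (≤-trans (m≤n+m _ _) (≤-reflexive (sym (length-++ (shortcut Ds))))))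
      where
      disjoint : ∀ {z} → ¬ (z ∈ shortcut Ds × z ∈ concat Es)
      disjoint (z∈ , z∈′) with interior cl z∈′
      ... | inj₁ old = new z∈ old
      ... | inj₂ i   = apart (shortcut-⊆ Ds z∈) (∈-++⁺ˡ i)
    woven : ∀ u v → parity (cyclePairs c) u v xor parity (cyclePairs d) u v ≡ parity (cyclesPairs Ds) u v xor parity (cyclesPairs Es) u v
    woven = weave Ds Es (2≤ longD) (2≤ (long cl))
    finish : ∀ Fs → All Class Fs → Unique (concatMap shortcut (Es ∷ Fs)) → (∀ {z} → z ∈ concatMap shortcut (Es ∷ Fs) → ¬ Old z) →
      (∀ {z} → z ∈ concat Ds → z ∉ concatMap shortcut (Es ∷ Fs)) →
      ∃[ Xs ] All Cyclic Xs × length Xs ≡ 2 + length Fs ×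
      (∀ u v → parity (cyclesPairs Xs) u v ≡ parity (cyclesPairs Ds) u v xor parity (concatMap cyclesPairs (Es ∷ Fs)) u v)
    finish [] _ _ _ _ = c ∷ d ∷ [] , cyclic-c ∷ cyclic-d ∷ [] , refl , λ u v →
      trans (parity-++ (cyclePairs c) (cyclePairs d ++ []) u v)
        (trans (cong (λ z → parity (cyclePairs c) u v xor parity z u v) (++-identityʳ (cyclePairs d)))
          (trans (woven u v) (cong (λ z → parity (cyclesPairs Ds) u v xor parity z u v) (sym (++-identityʳ (cyclesPairs Es))))))
    finish (F ∷ Fs) cls uniqS newS apart =
      let Xs , cyc , len , eq = weaveAll (c ∷ []) F Fs (subst Unique (sym (++-identityʳ c)) (proj₁ cyclic-c)) (proj₂ cyclic-c ∷ []) (s≤s z≤n)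
            apart′ new′ cls (Unique-++ʳ (shortcut Es) uniqS) (λ z∈ → newS (∈-++⁺ʳ (shortcut Es) z∈))
      in d ∷ Xs , cyclic-d ∷ cyc , cong suc len , λ u v → begin
        parity (cyclesPairs (d ∷ Xs)) u v ≡⟨ parity-++ (cyclePairs d) (cyclesPairs Xs) u v ⟩
        parity (cyclePairs d) u v xor parity (cyclesPairs Xs) u v ≡⟨ cong (parity (cyclePairs d) u v xor_) (eq u v) ⟩
        parity (cyclePairs d) u v xor (parity (cyclePairs c ++ []) u v xor rest u v)
          ≡⟨ cong (λ z → parity (cyclePairs d) u v xor (parity z u v xor rest u v)) (++-identityʳ (cyclePairs c)) ⟩
        parity (cyclePairs d) u v xor (parity (cyclePairs c) u v xor rest u v)
          ≡⟨ solve 3 (λ d c r → d :+ (c :+ r) := (c :+ d) :+ r) refl (parity (cyclePairs d) u v) (parity (cyclePairs c) u v) (rest u v) ⟩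
        (parity (cyclePairs c) u v xor parity (cyclePairs d) u v) xor rest u v ≡⟨ cong (_xor rest u v) (woven u v) ⟩
        (parity (cyclesPairs Ds) u v xor parity (cyclesPairs Es) u v) xor rest u v
          ≡⟨ xor-assoc (parity (cyclesPairs Ds) u v) (parity (cyclesPairs Es) u v) (rest u v) ⟩
        parity (cyclesPairs Ds) u v xor (parity (cyclesPairs Es) u v xor rest u v)
          ≡⟨ cong (parity (cyclesPairs Ds) u v xor_) (sym (parity-++ (cyclesPairs Es) (concatMap cyclesPairs (F ∷ Fs)) u v)) ⟩
        parity (cyclesPairs Ds) u v xor parity (concatMap cyclesPairs (Es ∷ F ∷ Fs)) u v ∎
      where
      open ≡-Reasoning
      open xor-∧-Solver using (solve; _:+_; _:=_)
      rest = parity (concatMap cyclesPairs (F ∷ Fs))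
      apart′ : ∀ {z} → z ∈ c ++ [] → z ∉ concatMap shortcut (F ∷ Fs)
      apart′ {z} z∈ z∈′ with ∈-++⁻ (concat Ds) (subst (z ∈_) (trans (++-identityʳ c) c≡) z∈)
      ... | inj₁ z∈D = apart z∈D (∈-++⁺ʳ (shortcut Es) z∈′)
      ... | inj₂ z∈E = Unique-++-disjoint (shortcut Es) uniqS z∈E z∈′
      new′ : ∀ {z} → z ∈ shortcut (c ∷ []) → ¬ Old z
      new′ {z} z∈ with ∈-++⁻ (shortcut Ds) (subst (z ∈_) (trans (shortcut-++ Ds (map ends Es)) (cong (shortcut Ds ++_) (shortcut-ends Es)))
                         (ends-concat (Ds ++ map ends Es) (subst (z ∈_) (++-identityʳ (ends c)) z∈)))
      ... | inj₁ z∈D = new z∈D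
      ... | inj₂ z∈E = newS (∈-++⁺ˡ z∈E)

-- `petersen` makes no claim that each of its classes has a member, whereas a woven cycle needs one
-- to be long enough.
dropEmpty : List (List A) → List (List A)
dropEmpty []               = []
dropEmpty ([] ∷ xss)       = dropEmpty xss
dropEmpty ((x ∷ xs) ∷ xss) = (x ∷ xs) ∷ dropEmpty xss

dropEmpty-length : ∀ (xss : List (List A)) → length (dropEmpty xss) ≤ length xss
dropEmpty-length []               = z≤n
dropEmpty-length ([] ∷ xss)       = ≤-trans (dropEmpty-length xss) (n≤1+n _)
dropEmpty-length ((x ∷ xs) ∷ xss) = s≤s (dropEmpty-length xss)

dropEmpty-All : ∀ {P : List A → Set} {xss} → All P xss → All (λ xs → P xs × NonEmpty xs) (dropEmpty xss)
dropEmpty-All []                         = []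
dropEmpty-All {xss = [] ∷ _} (p ∷ ps)      = dropEmpty-All ps
dropEmpty-All {xss = (_ ∷ _) ∷ _} (p ∷ ps) = (p , s≤s z≤n) ∷ dropEmpty-All ps

dropEmpty-pairs : ∀ (Cs : List (List (List (Fin n)))) → concatMap cyclesPairs (dropEmpty Cs) ≡ concatMap cyclesPairs Cs
dropEmpty-pairs []             = refl
dropEmpty-pairs ([] ∷ Cs)      = dropEmpty-pairs Cs
dropEmpty-pairs ((D ∷ Ds) ∷ Cs) = cong (cyclesPairs (D ∷ Ds) ++_) (dropEmpty-pairs Cs)

hasEdge-++ : ∀ (ps qs : List (Fin n × Fin n)) u v → hasEdge (ps ++ qs) u v ≡ hasEdge ps u v ∨ hasEdge qs u v
hasEdge-++ []       qs u v = refl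
hasEdge-++ (p ∷ ps) qs u v = trans (cong (edge p u v ∨_) (hasEdge-++ ps qs u v)) (sym (∨-assoc (edge p u v) _ _))

count⇒hasEdge : ∀ {b} (ps : List (Fin n × Fin n)) {u v} → ⟦ b ⟧ ≡ count ps u v → b ≡ hasEdge ps u v
count⇒hasEdge {b = false} [] eq = refl
count⇒hasEdge {b = true}  [] ()
count⇒hasEdge {b = b} (p ∷ ps) {u} {v} eq with edge p u v
count⇒hasEdge {b = b}     (p ∷ ps) {u} {v} eq | false = count⇒hasEdge ps {u} {v} eq
count⇒hasEdge {b = true}  (p ∷ ps) {u} {v} eq | true = refl
count⇒hasEdge {b = false} (p ∷ ps) {u} {v} () | true

disjointCycleUnion : (G : Graph n) → ∀ {Ds} → DisjointCycles Ds → 2 ≤ length Ds →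
  (∀ u v → ⟦ adj G u v ⟧ ≡ count (cyclesPairs Ds) u v) → DisjointCycleUnion G
disjointCycleUnion {n} G {Ds} (uniq , long) two eq =
  cycles Ds uniq long , subst (2 ≤_) (sym (length-cycles Ds uniq long)) two , disjoint Ds uniq long ,
  λ u v → trans (count⇒hasEdge (cyclesPairs Ds) {u} {v} (eq u v)) (edges Ds uniq long u v)
  where
  cycles : ∀ Ds → Unique (concat Ds) → All (λ D → 3 ≤ length D) Ds → List (Cycle {n})
  cycles []       _    _        = []
  cycles (D ∷ Ds) uniq (l ∷ ls) = record { verts = D ; distinct = Unique-++ˡ D uniq ; long = l } ∷ cycles Ds (Unique-++ʳ D uniq) ls
  length-cycles : ∀ Ds uniq long → length (cycles Ds uniq long) ≡ length Ds
  length-cycles []       _    _        = refl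
  length-cycles (D ∷ Ds) uniq (l ∷ ls) = cong suc (length-cycles Ds (Unique-++ʳ D uniq) ls)
  edges : ∀ Ds uniq long u v → hasEdge (cyclesPairs Ds) u v ≡ anyB {n} (λ c → cycleAdj {n} c u v) (cycles Ds uniq long)
  edges []       _    _        u v = refl
  edges (D ∷ Ds) uniq (l ∷ ls) u v = trans (hasEdge-++ (cyclePairs D) (cyclesPairs Ds) u v)
    (cong (hasEdge (cyclePairs D) u v ∨_) (edges Ds (Unique-++ʳ D uniq) ls u v))
  inside : ∀ Ds uniq long → All (λ c → ∀ x → x ∈ Cycle.verts c → x ∈ concat Ds) (cycles Ds uniq long)
  inside []       _    _        = []
  inside (D ∷ Ds) uniq (l ∷ ls) = (λ _ → ∈-++⁺ˡ) ∷ All.map (λ f x x∈ → ∈-++⁺ʳ D (f x x∈)) (inside Ds (Unique-++ʳ D uniq) ls)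
  disjoint : ∀ Ds uniq long → AllPairs (λ c d → VertexDisjoint (Cycle.verts c) (Cycle.verts d)) (cycles Ds uniq long)
  disjoint []       _    _        = []
  disjoint (D ∷ Ds) uniq (l ∷ ls) = All.map (λ f x x∈D x∈ → Unique-++-disjoint D uniq x∈D (f x x∈)) (inside Ds (Unique-++ʳ D uniq) ls)
    ∷ disjoint Ds (Unique-++ʳ D uniq) ls

weaveOpened : ∀ {A : Adj n} (Cs : List (List (List (Fin n)))) → 2 ≤ length Cs → All (λ Ds → DisjointCycles Ds × NonEmpty Ds) Cs → Opening A (concat Cs) [] →
  Σ ℕ λ m → Σ (Adj m) λ H → Subdivision A m H × C2≤ H (length Cs)
weaveOpened {A = A} Cs two good O = assemble two good (Pointwise-concat⁻ Cs O.open-by)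
  where
  module O = Opening O
  Old : Fin O.size → Set
  Old z = ∃[ y ] O.f y ≡ z
  open Weaving Old
  open-long : ∀ {Ds Es} → All (λ D → 3 ≤ length D) Ds → Pointwise (OpenedBy O.f) Ds Es → All (λ E → 3 ≤ length E) Es
  open-long []       []                    = []
  open-long (l ∷ ls) (_∷_ {x = D} (a , b , refl) pw) = ≤-trans l (≤-trans (≤-trans (≤-reflexive (sym (length-map O.f D)))
    (≤-trans (m≤m+n _ 1) (≤-reflexive (sym (length-++ (map O.f D)))))) (n≤1+n _)) ∷ open-long ls pw
  fresh-class : ∀ {Ds Es} → DisjointCycles Ds × NonEmpty Ds → Pointwise (OpenedBy O.f) Ds Es →
    Unique (shortcut Es) → (∀ {z} → z ∈ shortcut Es → ¬ Old z) → Class Es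
  fresh-class {Ds} {Es} ((uniq , long) , non) pw uniqS new = record
    { unique = Unique-resp-↭ (↭-sym (concat-opened pw))
        (Unique.++⁺ uniqS (Unique.map⁺ O.injective uniq) (λ (z∈ , z∈′) → let y , _ , e = ∈-map⁻ O.f z∈′ in new z∈ (y , sym e)))
    ; long = open-long long pw
    ; nonempty = subst (1 ≤_) (Pointwise.Pointwise-length pw) non
    ; interior = interior′ }
    where
    interior′ : ∀ {z} → z ∈ concat Es → Old z ⊎ z ∈ shortcut Es
    interior′ z∈ with ∈-++⁻ (shortcut Es) (∈-resp-↭ (concat-opened pw) z∈)
    ... | inj₁ i = inj₂ i
    ... | inj₂ i = let y , _ , e = ∈-map⁻ O.f i in inj₁ (y , sym e)
  classes : ∀ {Cs Bs} → All (λ Ds → DisjointCycles Ds × NonEmpty Ds) Cs → Pointwise (Pointwise (OpenedBy O.f)) Cs Bs →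
    Unique (concatMap shortcut Bs) → (∀ {z} → z ∈ concatMap shortcut Bs → ¬ Old z) → All Class Bs
  classes []       []         _    _   = []
  classes {Bs = B ∷ Bs} (g ∷ gs) (pw ∷ pws) uniq new = fresh-class g pw (Unique-++ˡ (shortcut B) uniq) (λ i → new (∈-++⁺ˡ i))
    ∷ classes gs pws (Unique-++ʳ (shortcut B) uniq) (λ i → new (∈-++⁺ʳ (shortcut B) i))
  assemble : ∀ {Cs} → 2 ≤ length Cs → All (λ Ds → DisjointCycles Ds × NonEmpty Ds) Cs →
    (∃[ Bs ] O.Es ≡ concat Bs × Pointwise (Pointwise (OpenedBy O.f)) Cs Bs) →
    Σ ℕ λ m → Σ (Adj m) λ H → Subdivision A m H × C2≤ H (length Cs)
  assemble {_ ∷ []} (s≤s ()) _ _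
  assemble {_ ∷ _ ∷ _} _ _ (_ ∷ [] , _ , _ ∷ ())
  assemble {_ ∷ _ ∷ Cs} _ good (Bs@(Ds ∷ Es ∷ Fs) , eqE , pws) = O.size , O.H , O.subdivision , covered
    where
    shorts : shortcut O.Es ≡ concatMap shortcut Bs
    shorts = trans (cong shortcut eqE) (shortcut-concat Bs)
    uniqS = subst Unique shorts O.fresh
    newS : ∀ {z} → z ∈ concatMap shortcut Bs → ¬ Old z
    newS z∈ (y , refl) = O.new y (subst (O.f y ∈_) (sym shorts) z∈)
    cls = classes good pws uniqS newS
    first = All.head cls
    apart : ∀ {z} → z ∈ concat Ds → z ∉ concatMap shortcut (Es ∷ Fs)
    apart z∈ z∈′ with Class.interior first z∈
    ... | inj₁ old = newS (∈-++⁺ʳ (shortcut Ds) z∈′) old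
    ... | inj₂ i   = Unique-++-disjoint (shortcut Ds) uniqS i z∈′
    covered : C2≤ O.H (2 + length Cs)
    covered = let Xs , cyc , len , par = weaveAll Ds Es Fs (Class.unique first) (Class.long first) (Class.nonempty first) apart
                    (λ z∈ → newS (∈-++⁺ˡ z∈)) (All.tail cls) (Unique-++ʳ (shortcut Ds) uniqS) (λ z∈ → newS (∈-++⁺ʳ (shortcut Ds) z∈))
      in oddCover Xs cyc (λ u v → trans (count⇒parity (concatMap cyclesPairs Bs) {u} {v} (trans (O.counts u v)
             (cong (λ q → count q u v) (trans (++-identityʳ (cyclesPairs O.Es)) (trans (cong cyclesPairs eqE) (cyclesPairs-concat Bs))))))
           (trans (parity-++ (cyclesPairs Ds) (concatMap cyclesPairs (Es ∷ Fs)) u v) (sym (par u v))))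
         (≤-reflexive (trans len (sym (Pointwise.Pointwise-length pws))))

weaveClasses : (G : Graph n) → ∀ Cs → 2 ≤ length Cs → All (λ Ds → DisjointCycles Ds × NonEmpty Ds) Cs →
  (∀ u v → ⟦ adj G u v ⟧ ≡ count (concatMap cyclesPairs Cs) u v) →
  Σ ℕ λ m → Σ (Adj m) λ H → Subdivision (adj G) m H × C2≤ H (length Cs)
weaveClasses {n} G Cs two good eq = weaveOpened Cs two good (openCycles _ here (graph-simple G) (concat Cs) [] refl (long good)
    (λ u v → trans (eq u v) (cong (λ q → count q u v) (trans (sym (cyclesPairs-concat Cs)) (sym (++-identityʳ (cyclesPairs (concat Cs))))))))
  where
  long : ∀ {Cs : List (List (List (Fin n)))} → All (λ Ds → DisjointCycles Ds × NonEmpty Ds) Cs → All (λ D → 3 ≤ length D) (concat Cs)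
  long []                    = []
  long (((_ , l) , _) ∷ ls) = All.++⁺ l (long ls)

c₂top≤ : (G : Graph n) → Eulerian G → ¬ DisjointCycleUnion G →
         Σ ℕ λ m → Σ (Adj m) λ H → Subdivision (adj G) m H × C2≤ H ⌊ Δ G /2⌋
c₂top≤ {n} G even ¬union =
  let Cs , len , good , counts = petersen G even
  in byClasses (dropEmpty Cs) (≤-trans (dropEmpty-length Cs) (≤-reflexive len)) (dropEmpty-All good)
       (λ u v → trans (counts u v) (cong (λ q → count q u v) (sym (dropEmpty-pairs Cs))))
  where
  byClasses : ∀ Cs → length Cs ≤ ⌊ Δ G /2⌋ → All (λ Ds → DisjointCycles Ds × NonEmpty Ds) Cs →
    (∀ u v → ⟦ adj G u v ⟧ ≡ count (concatMap cyclesPairs Cs) u v) →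
    Σ ℕ λ m → Σ (Adj m) λ H → Subdivision (adj G) m H × C2≤ H ⌊ Δ G /2⌋
  byClasses [] len _ eq = n , adj G , here , oddCover [] [] (λ u v → count⇒parity [] {u} {v} (eq u v)) len
  byClasses ([] ∷ []) _ ((_ , ()) ∷ _) _
  byClasses ((D ∷ []) ∷ []) len (((uniq , long) , _) ∷ []) eq = n , adj G , here ,
    oddCover (D ∷ []) ((subst Unique (++-identityʳ D) uniq , All.head long) ∷ [])
      (λ u v → count⇒parity (cyclesPairs (D ∷ [])) {u} {v} (trans (eq u v) (cong (λ q → count q u v) (++-identityʳ (cyclesPairs (D ∷ [])))))) len
  -- A single class with several members has no partner to be woven with; this is the excluded union
  -- of disjoint cycles.
  byClasses (Ds@(_ ∷ _ ∷ _) ∷ []) _ ((disj , _) ∷ []) eq =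
    contradiction (disjointCycleUnion G disj (s≤s (s≤s z≤n)) (λ u v → trans (eq u v) (cong (λ q → count q u v) (++-identityʳ (cyclesPairs Ds))))) ¬union
  byClasses Cs@(_ ∷ _ ∷ _) len good eq =
    let m , H , sub , Xs , cover , lenX = weaveClasses G Cs (s≤s (s≤s z≤n)) good eq
    in m , H , sub , Xs , cover , ≤-trans lenX len

-- Linear forests and isolated vertices

oddly : Fin n → List (Fin n) → Bool
oddly v xs = ⨁ (λ x → does (v ≟ x)) xs

oddly⇒∈ : ∀ {v : Fin n} xs → oddly v xs ≡ true → v ∈ xs
oddly⇒∈ {v = v} (x ∷ xs) eq with v ≟ x
... | yes refl = here refl
... | no  _    = there (oddly⇒∈ xs eq)

oddly-suc : ∀ (v : Fin n) xs → oddly (suc v) (map suc xs) ≡ oddly v xs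
oddly-suc v xs = ⨁-map (λ x → does (suc v ≟ x)) suc xs

oddly-zero : ∀ (xs : List (Fin n)) → oddly zero (map suc xs) ≡ false
oddly-zero xs = trans (⨁-map (λ x → does (zero ≟ x)) suc xs) (⨁-false (λ _ → refl) xs)

parity-lift-zero : ∀ (ps : List (Fin n × Fin n)) v → parity (map lift ps) zero v ≡ false
parity-lift-zero ps v = trans (⨁-map (λ p → edge p zero v) lift ps) (⨁-false (λ p → edge-lift-zero p v) ps)

parity-sym : ∀ (ps : List (Fin n × Fin n)) u v → parity ps u v ≡ parity ps v u
parity-sym ps u v = ⨁-cong (λ p → edge-sym p u v) ps

addIso-parity : ∀ {A : Adj n} ps → (∀ u v → A u v ≡ parity ps u v) → ∀ u v → addIso 1 A u v ≡ parity (map lift ps) u v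
addIso-parity ps eq zero    v       = sym (parity-lift-zero ps v)
addIso-parity ps eq (suc u) zero    = sym (trans (parity-sym (map lift ps) (suc u) zero) (parity-lift-zero ps (suc u)))
addIso-parity ps eq (suc u) (suc v) = trans (eq u v) (sym (⨁-map (λ p → edge p (suc u) (suc v)) lift ps))

addIso-suc : ∀ j (A : Adj n) u v → addIso (suc j) A u v ≡ addIso 1 (addIso j A) u v
addIso-suc j A zero    v       = refl
addIso-suc j A (suc u) zero    = refl
addIso-suc j A (suc u) (suc v) = refl

reverse-ends : ∀ (x : Fin n) xs → ∃[ ys ] reverse (x ∷ xs) ≡ lastOr x xs ∷ ys × lastOr (lastOr x xs) ys ≡ x
reverse-ends x []       = [] , refl , refl
reverse-ends x (y ∷ xs) =
  let ys , eq , _ = reverse-ends y xs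
  in ys ++ x ∷ [] , trans (unfold-reverse x (y ∷ xs)) (cong (_++ x ∷ []) eq) , lastOr-++ (lastOr y xs) ys (x ∷ [])

pathPairs-reverse-++ : ∀ (x : Fin n) xs zs → ∀ u v →
  parity (pathPairs (reverse (x ∷ xs) ++ zs)) u v ≡ parity (pathPairs (reverse (x ∷ xs))) u v xor parity (pathPairs (x ∷ zs)) u v
pathPairs-reverse-++ x xs zs u v =
  let ys , eq , last = reverse-ends x xs
  in trans (cong (λ r → parity (pathPairs (r ++ zs)) u v) eq)
    (trans (cong (λ q → parity q u v) (pathPairs-++ (lastOr x xs) ys zs))
    (trans (parity-++ (pathPairs (lastOr x xs ∷ ys)) (pathPairs (lastOr (lastOr x xs) ys ∷ zs)) u v)
      (cong₂ (λ r l → parity (pathPairs r) u v xor parity (pathPairs (l ∷ zs)) u v) (sym eq) last)))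

parity-reverse : ∀ (xs : List (Fin n)) u v → parity (pathPairs (reverse xs)) u v ≡ parity (pathPairs xs) u v
parity-reverse []           u v = refl
parity-reverse (x ∷ [])     u v = refl
parity-reverse (x ∷ y ∷ xs) u v =
  trans (cong (λ r → parity (pathPairs r) u v) (unfold-reverse x (y ∷ xs)))
    (trans (pathPairs-reverse-++ y xs (x ∷ []) u v)
      (trans (cong₂ _xor_ (parity-reverse (y ∷ xs) u v) (trans (xor-identityʳ _) (edge-swap y x u v)))
        (xor-comm (parity (pathPairs (y ∷ xs)) u v) (edge (x , y) u v))))

oddly-ends-reverse : ∀ (xs : List (Fin n)) v → oddly v (ends (reverse xs)) ≡ oddly v (ends xs)
oddly-ends-reverse []       v = refl
oddly-ends-reverse (x ∷ xs) v =
  let ys , eq , last = reverse-ends x xs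
  in trans (cong (λ r → oddly v (ends r)) eq) (trans (cong (λ l → oddly v (lastOr x xs ∷ l ∷ [])) last)
       (solve 2 (λ a b → a :+ (b :+ con false) := b :+ (a :+ con false)) refl (does (v ≟ lastOr x xs)) (does (v ≟ x))))
  where open xor-∧-Solver using (solve; _:+_; _:=_; con)

-- Coloured path systems and the joining of paths

ColouredPaths : ℕ → ℕ → Set
ColouredPaths k m = List (Fin k × List (Fin m))

colouredVerts : ColouredPaths k m → List (Fin k × Fin m)
colouredVerts = concatMap (λ (c , p) → map (c ,_) p)

tips : ColouredPaths k m → List (Fin m)
tips = concatMap (ends ∘ proj₂)

pairs : ColouredPaths k m → List (Fin m × Fin m)
pairs = concatMap (pathPairs ∘ proj₂)

-- Uniqueness of the coloured vertices says that the paths of each colour form a linear forest.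
record Valid (A : Adj m) (L : ColouredPaths k m) : Set where
  field
    unique : Unique (colouredVerts L)
    long   : All (λ cp → 2 ≤ length (proj₂ cp)) L
    even   : ∀ v → oddly v (tips L) ≡ false
    covers : ∀ u v → A u v ≡ parity (pairs L) u v

module _ {A : Adj m} where

  valid-↭ : ∀ {L M : ColouredPaths k m} → L ↭ M → Valid A L → Valid A M
  valid-↭ p V = record
    { unique = Unique-resp-↭ (concatMap-↭ _ p) unique
    ; long   = All-resp-↭ p long
    ; even   = λ v → trans (sym (⨁-↭ _ (concatMap-↭ (ends ∘ proj₂) p))) (even v)
    ; covers = λ u v → trans (covers u v) (⨁-↭ _ (concatMap-↭ (pathPairs ∘ proj₂) p)) }
    where open Valid V

  valid-reverse : ∀ {c : Fin k} {p L} → Valid A ((c , p) ∷ L) → Valid A ((c , reverse p) ∷ L)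
  valid-reverse {c = c} {p} {L} V = record
    { unique = Unique-resp-↭ (++⁺ʳ (colouredVerts L) (Perm.map⁺ (c ,_) (↭-sym (Perm.↭-reverse p)))) unique
    ; long   = subst (2 ≤_) (sym (length-reverse p)) (All.head long) ∷ All.tail long
    ; even   = λ v → trans (⨁-++ _ (ends (reverse p)) (tips L)) (trans (cong (_xor oddly v (tips L)) (oddly-ends-reverse p v))
                 (trans (sym (⨁-++ _ (ends p) (tips L))) (even v)))
    ; covers = λ u v → trans (covers u v) (trans (parity-++ (pathPairs p) (pairs L) u v)
                 (trans (cong (_xor parity (pairs L) u v) (sym (parity-reverse p u v))) (sym (parity-++ (pathPairs (reverse p)) (pairs L) u v)))) }
    where open Valid V

  tip-path : ∀ (L : ColouredPaths k m) {v} → v ∈ tips L → ∃[ c ] ∃[ p ] ∃[ R ] L ↭ (c , p) ∷ R × v ∈ ends p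
  tip-path ((c , p) ∷ L) v∈ with ∈-++⁻ (ends p) v∈
  ... | inj₁ i = c , p , L , ↭-refl , i
  ... | inj₂ i = let c′ , p′ , R , perm , j = tip-path L i in
    c′ , p′ , (c , p) ∷ R , ↭-trans (↭-prep _ perm) (↭-swap _ _ ↭-refl) , j

  -- `P` holds the paths chosen already. The search is confined to `L`, so the path found is a
  -- different one; it is reversed if v is its last vertex.
  front : ∀ (P L : ColouredPaths k m) {v} → v ∈ tips L → Valid A (P ++ L) →
          ∃[ c ] ∃[ p ] ∃[ R ] length L ≡ suc (length R) × Valid A ((c , v ∷ p) ∷ P ++ R)
  front P L v∈ V with tip-path L v∈
  ... | c , x ∷ xs , R , perm , here refl =
    c , xs , R , ↭-length perm , valid-↭ (↭-trans (++⁺ˡ P perm) (Perm.shift (c , x ∷ xs) P R)) V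
  ... | c , x ∷ xs , R , perm , there (here refl) =
    let ys , eq , _ = reverse-ends x xs
    in c , ys , R , ↭-length perm , subst (λ r → Valid A ((c , r) ∷ P ++ R)) eq
         (valid-reverse (valid-↭ (↭-trans (++⁺ˡ P perm) (Perm.shift (c , x ∷ xs) P R)) V))

liftPaths : ColouredPaths k m → ColouredPaths k (suc m)
liftPaths = map (λ (c , p) → c , map suc p)

lift-verts : ∀ (L : ColouredPaths k m) → colouredVerts (liftPaths L) ≡ map (λ (c , v) → c , suc v) (colouredVerts L)
lift-verts []            = refl
lift-verts ((c , p) ∷ L) = trans (cong₂ _++_ (trans (sym (map-∘ p)) (map-∘ p)) (lift-verts L))
  (sym (map-++ (λ (c , v) → c , suc v) (map (c ,_) p) (colouredVerts L)))

lift-tips : ∀ (L : ColouredPaths k m) → tips (liftPaths L) ≡ map suc (tips L)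
lift-tips []                  = refl
lift-tips ((c , []) ∷ L)      = lift-tips L
lift-tips ((c , x ∷ xs) ∷ L)  = cong₂ (λ l t → suc x ∷ l ∷ t) (lastOr-map suc x xs) (lift-tips L)

lift-pairs : ∀ (L : ColouredPaths k m) → pairs (liftPaths L) ≡ map lift (pairs L)
lift-pairs []            = refl
lift-pairs ((c , p) ∷ L) = trans (cong₂ _++_ (pathPairs-map suc p) (lift-pairs L)) (sym (map-++ lift (pathPairs p) (pairs L)))

lift-long : ∀ {L : ColouredPaths k m} → All (λ cp → 2 ≤ length (proj₂ cp)) L → All (λ cp → 2 ≤ length (proj₂ cp)) (liftPaths L)
lift-long ls = All.map⁺ (All.map (λ {cp} l → subst (2 ≤_) (sym (length-map suc (proj₂ cp))) l) ls)

extend : List (Fin m) → List (Fin (suc m))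
extend p = zero ∷ map suc p

join : List (Fin m) → List (Fin m) → List (Fin (suc m))
join p q = reverse (map suc p) ++ extend q

join-↭ : ∀ (p q : List (Fin m)) → join p q ↭ zero ∷ map suc p ++ map suc q
join-↭ p q = ↭-trans (Perm.shift zero (reverse (map suc p)) (map suc q))
  (↭-prep zero (++⁺ʳ (map suc q) (Perm.↭-reverse (map suc p))))

ends-extend : ∀ (x : Fin m) xs → ends (extend (x ∷ xs)) ≡ zero ∷ suc (lastOr x xs) ∷ []
ends-extend x xs = cong (λ l → zero ∷ l ∷ []) (lastOr-map suc x xs)

ends-join : ∀ (x y : Fin m) xs ys → ends (join (x ∷ xs) (y ∷ ys)) ≡ suc (lastOr x xs) ∷ suc (lastOr y ys) ∷ []
ends-join x y xs ys =
  let zs , eq , _ = reverse-ends (suc x) (map suc xs)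
  in trans (cong (λ r → ends (r ++ extend (y ∷ ys))) eq)
       (cong₂ (λ a b → a ∷ b ∷ []) (lastOr-map suc x xs)
         (trans (lastOr-++ (lastOr (suc x) (map suc xs)) zs (extend (y ∷ ys))) (lastOr-map suc y ys)))

parity-extend : ∀ (x : Fin m) xs u v →
  parity (pathPairs (extend (x ∷ xs))) u v ≡ edge (zero , suc x) u v xor parity (map lift (pathPairs (x ∷ xs))) u v
parity-extend x xs u v = cong (λ q → edge (zero , suc x) u v xor parity q u v) (pathPairs-map suc (x ∷ xs))

parity-join : ∀ (x y : Fin m) xs ys u v → parity (pathPairs (join (x ∷ xs) (y ∷ ys))) u v ≡
  parity (map lift (pathPairs (x ∷ xs))) u v xor (edge (zero , suc x) u v xor (edge (zero , suc y) u v xor parity (map lift (pathPairs (y ∷ ys))) u v))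
parity-join x y xs ys u v = trans (pathPairs-reverse-++ (suc x) (map suc xs) (extend (y ∷ ys)) u v)
  (cong₂ _xor_ (trans (parity-reverse (map suc (x ∷ xs)) u v) (cong (λ q → parity q u v) (pathPairs-map suc (x ∷ xs))))
    (cong₂ _xor_ (edge-swap (suc x) zero u v) (parity-extend y ys u v)))

fresh-unique : ∀ {L : List (Fin k × Fin m)} → Unique L → ∀ cs → Unique cs →
               Unique (map (_, zero) cs ++ map (λ (c , v) → c , suc v) L)
fresh-unique {L = L} uniq cs uniq-cs = Unique.++⁺ (Unique.map⁺ (cong proj₁) uniq-cs) (Unique.map⁺ (λ { {_ , _} {_ , _} refl → refl }) uniq)
  disjoint
  where
  disjoint : ∀ {z} → ¬ (z ∈ map (_, zero) cs × z ∈ map (λ (c , v) → c , suc v) L)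
  disjoint (i , j) with ∈-map⁻ (_, zero) i | ∈-map⁻ (λ (c , v) → c , suc v) j
  ... | _ , _ , refl | _ , _ , ()

-- The two paths of colour i are joined through a fresh vertex; the paths of colours j and l starting at x and y absorb the two new edges.
module Join {A : Adj m} {i j l : Fin k} {x y : Fin m} {X Y Z W : List (Fin m)} {R : ColouredPaths k m}
  (V : Valid A ((l , y ∷ W) ∷ (j , x ∷ Z) ∷ (i , x ∷ X) ∷ (i , y ∷ Y) ∷ R)) where

  open Valid V

  old : ColouredPaths k m
  old = (l , y ∷ W) ∷ (j , x ∷ Z) ∷ (i , x ∷ X) ∷ (i , y ∷ Y) ∷ R
  up : Fin k × Fin m → Fin k × Fin (suc m)
  up (c , v) = c , suc v

  U : Fin k → List (Fin m) → List (Fin k × Fin (suc m))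
  U c p = map (c ,_) (map suc p)

  up-old : map up (colouredVerts old) ≡ U l (y ∷ W) ++ U j (x ∷ Z) ++ U i (x ∷ X) ++ U i (y ∷ Y) ++ colouredVerts (liftPaths R)
  up-old = sym (lift-verts old)

  join-verts : ∀ c p q → map (c ,_) (join p q) ↭ (c , zero) ∷ U c p ++ U c q
  join-verts c p q = ↭-trans (Perm.map⁺ (c ,_) (join-↭ p q)) (↭-reflexive (cong ((c , zero) ∷_) (map-++ (c ,_) (map suc p) (map suc q))))

  i≢j : i ≢ j
  i≢j refl = Unique-++-disjoint (map (j ,_) (x ∷ Z)) (Unique-++ʳ (map (l ,_) (y ∷ W)) unique) (here refl) (here refl)

  i≢l : i ≢ l
  i≢l refl = Unique-++-disjoint (map (l ,_) (y ∷ W)) unique (here refl)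
    (∈-++⁺ʳ (map (j ,_) (x ∷ Z)) (∈-++⁺ʳ (map (i ,_) (x ∷ X)) (here refl)))

  e : Fin m → Adj (suc m)
  e z = edge (zero , suc z)

  P : List (Fin m) → Adj (suc m)
  P p = parity (map lift (pathPairs p))

  lifted : ∀ u v → parity (map lift (pairs old)) u v ≡
    P (y ∷ W) u v xor (P (x ∷ Z) u v xor (P (x ∷ X) u v xor (P (y ∷ Y) u v xor parity (map lift (pairs R)) u v)))
  lifted u v = trans (unfold (y ∷ W) (pairs ((j , x ∷ Z) ∷ (i , x ∷ X) ∷ (i , y ∷ Y) ∷ R)))
    (cong (P (y ∷ W) u v xor_) (trans (unfold (x ∷ Z) (pairs ((i , x ∷ X) ∷ (i , y ∷ Y) ∷ R)))
      (cong (P (x ∷ Z) u v xor_) (trans (unfold (x ∷ X) (pairs ((i , y ∷ Y) ∷ R)))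
        (cong (P (x ∷ X) u v xor_) (unfold (y ∷ Y) (pairs R)))))))
    where
    unfold : ∀ p qs → parity (map lift (pathPairs p ++ qs)) u v ≡ P p u v xor parity (map lift qs) u v
    unfold p qs = trans (cong (λ q → parity q u v) (map-++ lift (pathPairs p) qs)) (parity-++ (map lift (pathPairs p)) (map lift qs) u v)

  open xor-∧-Solver using (solve; _:+_; _:=_; con)

  -- Each of the two absorbing paths is extended to the fresh vertex, so that this vertex ends two
  -- paths and evenness persists. Four paths have become three.
  module Distinct (l≢j : l ≢ j) where

    new : ColouredPaths k (suc m)
    new = (l , extend (y ∷ W)) ∷ (j , extend (x ∷ Z)) ∷ (i , join (x ∷ X) (y ∷ Y)) ∷ liftPaths R

    verts-↭ : map (_, zero) (l ∷ j ∷ i ∷ []) ++ map up (colouredVerts old) ↭ colouredVerts new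
    verts-↭ = ↭-prep (l , zero) (↭-trans (↭-reflexive (cong (λ z → (j , zero) ∷ (i , zero) ∷ z) up-old))
      (↭-trans (↭-sym (Perm.shifts (U l (y ∷ W)) ((j , zero) ∷ (i , zero) ∷ [])))
        (++⁺ˡ (U l (y ∷ W)) (↭-prep (j , zero) (↭-trans (↭-sym (Perm.shift (i , zero) (U j (x ∷ Z)) _))
          (++⁺ˡ (U j (x ∷ Z)) (↭-trans (↭-reflexive (cong ((i , zero) ∷_) (sym (++-assoc (U i (x ∷ X)) (U i (y ∷ Y)) _))))
            (++⁺ʳ (colouredVerts (liftPaths R)) (↭-sym (join-verts i (x ∷ X) (y ∷ Y)))))))))))

    tips-new : tips new ≡ zero ∷ suc (lastOr y W) ∷ zero ∷ suc (lastOr x Z) ∷ suc (lastOr x X) ∷ suc (lastOr y Y) ∷ map suc (tips R)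
    tips-new = cong₂ _++_ (ends-extend y W) (cong₂ _++_ (ends-extend x Z) (cong₂ _++_ (ends-join x y X Y) (lift-tips R)))

    even-new : ∀ v → oddly v (tips new) ≡ false
    even-new zero    = trans (cong (oddly zero) tips-new) (cong (λ b → not (not b)) (oddly-zero (tips R)))
    -- Before the join x and y each begin two of the four paths; these occurrences cancel in pairs.
    even-new (suc v) = trans (cong (oddly (suc v)) tips-new) (trans
      (solve 7 (λ y x w z x′ y′ r → w :+ (z :+ (x′ :+ (y′ :+ r))) := y :+ (w :+ (x :+ (z :+ (x :+ (x′ :+ (y :+ (y′ :+ r)))))))) refl
        (does (v ≟ y)) (does (v ≟ x)) (does (v ≟ lastOr y W)) (does (v ≟ lastOr x Z)) (does (v ≟ lastOr x X)) (does (v ≟ lastOr y Y))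
        (oddly (suc v) (map suc (tips R))))
      (trans (cong (λ r → does (v ≟ y) xor (does (v ≟ lastOr y W) xor (does (v ≟ x) xor (does (v ≟ lastOr x Z) xor (does (v ≟ x) xor
        (does (v ≟ lastOr x X) xor (does (v ≟ y) xor (does (v ≟ lastOr y Y) xor r)))))))) (oddly-suc v (tips R))) (even v)))

    parity-new : ∀ u v → parity (map lift (pairs old)) u v ≡ parity (pairs new) u v
    parity-new u v = sym (trans (parity-++ (pathPairs (extend (y ∷ W))) _ u v)
      (trans (cong₂ _xor_ (parity-extend y W u v) (trans (parity-++ (pathPairs (extend (x ∷ Z))) _ u v)
        (cong₂ _xor_ (parity-extend x Z u v) (trans (parity-++ (pathPairs (join (x ∷ X) (y ∷ Y))) _ u v)
          (cong₂ _xor_ (parity-join x y X Y u v) (cong (λ q → parity q u v) (lift-pairs R)))))))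
      (trans (solve 7 (λ ex ey w z x y r → (ey :+ w) :+ ((ex :+ z) :+ ((x :+ (ex :+ (ey :+ y))) :+ r)) := w :+ (z :+ (x :+ (y :+ r)))) refl
          (e x u v) (e y u v) (P (y ∷ W) u v) (P (x ∷ Z) u v) (P (x ∷ X) u v) (P (y ∷ Y) u v) (parity (map lift (pairs R)) u v))
        (sym (lifted u v)))))

    valid : Valid (addIso 1 A) new
    valid = record
      { unique = Unique-resp-↭ verts-↭ (fresh-unique unique (l ∷ j ∷ i ∷ [])
          ((l≢j ∷ (i≢l ∘ sym) ∷ []) ∷ ((i≢j ∘ sym) ∷ []) ∷ [] ∷ []))
      ; long = s≤s (s≤s z≤n) ∷ s≤s (s≤s z≤n) ∷ join-long ∷ lift-long (All.tail (All.tail (All.tail (All.tail long))))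
      ; even = even-new
      ; covers = λ u v → trans (addIso-parity (pairs old) covers u v) (parity-new u v) }
      where
      join-long : 2 ≤ length (join (x ∷ X) (y ∷ Y))
      join-long = ≤-trans (s≤s (s≤s z≤n)) (≤-trans (m≤n+m _ (length (reverse (map suc (x ∷ X))))) (≤-reflexive (sym (length-++ (reverse (map suc (x ∷ X)))))))

  -- Extending both absorbing paths would put the fresh vertex on two paths of one colour; they are
  -- joined there instead, and four paths become two.
  module Equal (l≡j : l ≡ j) where

    new : ColouredPaths k (suc m)
    new = (l , join (y ∷ W) (x ∷ Z)) ∷ (i , join (x ∷ X) (y ∷ Y)) ∷ liftPaths R

    verts-↭ : map (_, zero) (l ∷ i ∷ []) ++ map up (colouredVerts old) ↭ colouredVerts new
    verts-↭ = ↭-trans (↭-reflexive (cong (λ z → (l , zero) ∷ (i , zero) ∷ z) (trans up-old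
        (trans (cong (λ c → U l (y ∷ W) ++ U c (x ∷ Z) ++ rest) (sym l≡j)) (sym (++-assoc (U l (y ∷ W)) (U l (x ∷ Z)) rest))))))
      (↭-trans (↭-prep (l , zero) (↭-sym (Perm.shift (i , zero) (U l (y ∷ W) ++ U l (x ∷ Z)) rest)))
        (Perm.++⁺ (↭-sym (join-verts l (y ∷ W) (x ∷ Z)))
          (↭-trans (↭-reflexive (cong ((i , zero) ∷_) (sym (++-assoc (U i (x ∷ X)) (U i (y ∷ Y)) _))))
            (++⁺ʳ (colouredVerts (liftPaths R)) (↭-sym (join-verts i (x ∷ X) (y ∷ Y)))))))
      where rest = U i (x ∷ X) ++ U i (y ∷ Y) ++ colouredVerts (liftPaths R)

    tips-new : tips new ≡ suc (lastOr y W) ∷ suc (lastOr x Z) ∷ suc (lastOr x X) ∷ suc (lastOr y Y) ∷ map suc (tips R)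
    tips-new = cong₂ _++_ (ends-join y x W Z) (cong₂ _++_ (ends-join x y X Y) (lift-tips R))

    even-new : ∀ v → oddly v (tips new) ≡ false
    even-new zero    = trans (cong (oddly zero) tips-new) (oddly-zero (tips R))
    even-new (suc v) = trans (cong (oddly (suc v)) tips-new) (trans
      (solve 7 (λ y x w z x′ y′ r → w :+ (z :+ (x′ :+ (y′ :+ r))) := y :+ (w :+ (x :+ (z :+ (x :+ (x′ :+ (y :+ (y′ :+ r)))))))) refl
        (does (v ≟ y)) (does (v ≟ x)) (does (v ≟ lastOr y W)) (does (v ≟ lastOr x Z)) (does (v ≟ lastOr x X)) (does (v ≟ lastOr y Y))
        (oddly (suc v) (map suc (tips R))))
      (trans (cong (λ r → does (v ≟ y) xor (does (v ≟ lastOr y W) xor (does (v ≟ x) xor (does (v ≟ lastOr x Z) xor (does (v ≟ x) xor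
        (does (v ≟ lastOr x X) xor (does (v ≟ y) xor (does (v ≟ lastOr y Y) xor r)))))))) (oddly-suc v (tips R))) (even v)))

    parity-new : ∀ u v → parity (map lift (pairs old)) u v ≡ parity (pairs new) u v
    parity-new u v = sym (trans (parity-++ (pathPairs (join (y ∷ W) (x ∷ Z))) _ u v)
      (trans (cong₂ _xor_ (parity-join y x W Z u v) (trans (parity-++ (pathPairs (join (x ∷ X) (y ∷ Y))) _ u v)
          (cong₂ _xor_ (parity-join x y X Y u v) (cong (λ q → parity q u v) (lift-pairs R)))))
      (trans (solve 7 (λ ex ey w z x y r → (w :+ (ey :+ (ex :+ z))) :+ ((x :+ (ex :+ (ey :+ y))) :+ r) := w :+ (z :+ (x :+ (y :+ r)))) refl
          (e x u v) (e y u v) (P (y ∷ W) u v) (P (x ∷ Z) u v) (P (x ∷ X) u v) (P (y ∷ Y) u v) (parity (map lift (pairs R)) u v))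
        (sym (lifted u v)))))

    valid : Valid (addIso 1 A) new
    valid = record
      { unique = Unique-resp-↭ verts-↭ (fresh-unique unique (l ∷ i ∷ []) (((i≢l ∘ sym) ∷ []) ∷ [] ∷ []))
      ; long = join-long (y ∷ W) x Z ∷ join-long (x ∷ X) y Y ∷ lift-long (All.tail (All.tail (All.tail (All.tail long))))
      ; even = even-new
      ; covers = λ u v → trans (addIso-parity (pairs old) covers u v) (parity-new u v) }
      where
      join-long : ∀ p q qs → 2 ≤ length (join p (q ∷ qs))
      join-long p q qs = ≤-trans (s≤s (s≤s z≤n)) (≤-trans (m≤n+m _ (length (reverse (map suc p)))) (≤-reflexive (sym (length-++ (reverse (map suc p))))))

path-ends-distinct : ∀ {x : Fin m} {p} → Unique (x ∷ p) → 2 ≤ length (x ∷ p) → lastOr x p ≢ x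
path-ends-distinct {p = []}    _          (s≤s ())
path-ends-distinct {p = y ∷ p} (x∉ ∷ _) _ eq = All.lookup x∉ (lastOr-∈ y p) (sym eq)

module _ {A : Adj m} {k : ℕ} where

  Shorter : ℕ → Set
  Shorter ℓ = Σ (ColouredPaths k (suc m)) λ M → Valid (addIso 1 A) M × length M < ℓ

  module SameColour {i : Fin k} {x y : Fin m} {X Y : List (Fin m)} {R : ColouredPaths k m}
                    (V : Valid A ((i , x ∷ X) ∷ (i , y ∷ Y) ∷ R)) where
    open Valid V

    apart : ∀ {v w} → v ∈ x ∷ X → w ∈ y ∷ Y → v ≢ w
    apart v∈ w∈ refl = Unique-++-disjoint (map (i ,_) (x ∷ X)) unique (∈-map⁺ (i ,_) v∈) (∈-++⁺ˡ (∈-map⁺ (i ,_) w∈))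

    X-ends : lastOr x X ≢ x
    X-ends = path-ends-distinct (Unique.map⁻ (Unique-++ˡ (map (i ,_) (x ∷ X)) unique)) (All.head long)

    Y-ends : lastOr y Y ≢ y
    Y-ends = path-ends-distinct (Unique.map⁻ (Unique-++ˡ (map (i ,_) (y ∷ Y)) (Unique-++ʳ (map (i ,_) (x ∷ X)) unique)))
      (All.head (All.tail long))

    -- The two paths of colour i have four different ends, of which x is one; by evenness x is an
    -- end of some path outside them.
    tip-x : x ∈ tips R
    tip-x = oddly⇒∈ (tips R) (force (does-refl x) (dec-false (x ≟ lastOr x X) (X-ends ∘ sym))
      (dec-false (x ≟ y) (apart (here refl) (here refl))) (dec-false (x ≟ lastOr y Y) (apart (here refl) (lastOr-∈ y Y))) (even x))
      where
      force : ∀ {a b c d r} → a ≡ true → b ≡ false → c ≡ false → d ≡ false → a xor (b xor (c xor (d xor r))) ≡ false → r ≡ true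
      force {r = true} refl refl refl refl _ = refl

  -- Because the path of colour j does not end at y, the three chosen paths have y as an end exactly
  -- once, and evenness yields a fourth path ending there. `V` and `V₀` concern the same paths in
  -- two orders.
  joinAt : ∀ {i j : Fin k} {x y X Y Z R} → Valid A ((j , x ∷ Z) ∷ (i , x ∷ X) ∷ (i , y ∷ Y) ∷ R) →
           Valid A ((i , x ∷ X) ∷ (i , y ∷ Y) ∷ (j , x ∷ Z) ∷ R) → lastOr x Z ≢ y → Shorter (3 + length R)
  joinAt {i} {j} {x} {y} {X} {Y} {Z} {R} V V₀ z≢y = finish (front ((j , x ∷ Z) ∷ (i , x ∷ X) ∷ (i , y ∷ Y) ∷ []) R tip-y V)
    where
    open SameColour V₀
    tip-y : y ∈ tips R
    tip-y = oddly⇒∈ (tips R) (force (dec-false (y ≟ x) (apart (here refl) (here refl) ∘ sym)) (dec-false (y ≟ lastOr x Z) (z≢y ∘ sym))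
      (dec-false (y ≟ lastOr x X) (apart (lastOr-∈ x X) (here refl) ∘ sym)) (does-refl y) (dec-false (y ≟ lastOr y Y) (Y-ends ∘ sym)) (Valid.even V y))
      where
      force : ∀ {a b d e f r} → a ≡ false → b ≡ false → d ≡ false → e ≡ true → f ≡ false →
              a xor (b xor (a xor (d xor (e xor (f xor r))))) ≡ false → r ≡ true
      force {r = true} refl refl refl refl refl _ = refl
    finish : ∃[ l ] ∃[ W ] ∃[ S ] length R ≡ suc (length S) × Valid A ((l , y ∷ W) ∷ (j , x ∷ Z) ∷ (i , x ∷ X) ∷ (i , y ∷ Y) ∷ S) →
             Shorter (3 + length R)
    finish (l , W , S , len , V′) with l ≟ j
    ... | no l≢j  = Join.Distinct.new V′ l≢j , Join.Distinct.valid V′ l≢j ,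
      s≤s (s≤s (s≤s (≤-reflexive (trans (cong suc (length-map _ S)) (sym len)))))
    ... | yes l≡j = Join.Equal.new V′ l≡j , Join.Equal.valid V′ l≡j ,
      s≤s (s≤s (≤-trans (s≤s (≤-reflexive (length-map _ S))) (≤-trans (≤-reflexive (sym len)) (n≤1+n _))))

  joinSameColour : ∀ {i : Fin k} {x y X Y R} → Valid A ((i , x ∷ X) ∷ (i , y ∷ Y) ∷ R) → Shorter (2 + length R)
  joinSameColour {i} {x} {y} {X} {Y} {R} V = orient (front ((i , x ∷ X) ∷ (i , y ∷ Y) ∷ []) R tip-x V)
    where
    open SameColour V
    orient : ∃[ j ] ∃[ Z ] ∃[ S ] length R ≡ suc (length S) × Valid A ((j , x ∷ Z) ∷ (i , x ∷ X) ∷ (i , y ∷ Y) ∷ S) → Shorter (2 + length R)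
    orient (j , Z , S , len , V₁) with lastOr x Z ≟ y
    ... | no z≢y = subst (λ ℓ → Shorter (2 + ℓ)) (sym len)
      (joinAt V₁ (valid-↭ (↭-trans (↭-swap _ _ ↭-refl) (↭-prep _ (↭-swap _ _ ↭-refl))) V₁) z≢y)
    -- If x and y are the two ends of one path of colour j, the other end of the second path serves instead of y.
    ... | yes z≡y = subst (λ ℓ → Shorter (2 + ℓ)) (sym len)
      (let ys , eq , _ = reverse-ends y Y
           V₂ = subst (λ r → Valid A ((i , r) ∷ (j , x ∷ Z) ∷ (i , x ∷ X) ∷ S)) eq
                  (valid-reverse (valid-↭ (↭-trans (↭-prep _ (↭-swap _ _ ↭-refl)) (↭-swap _ _ ↭-refl)) V₁))
       in joinAt (valid-↭ (↭-trans (↭-swap _ _ ↭-refl) (↭-prep _ (↭-swap _ _ ↭-refl))) V₂)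
                 (valid-↭ (↭-trans (↭-prep _ (↭-swap _ _ ↭-refl)) (↭-swap _ _ ↭-refl)) V₂)
                 (λ z≡ → Y-ends (trans (sym z≡) z≡y)))

repeatedColour : ∀ (L : ColouredPaths k m) → Unique (map proj₁ L) ⊎ ∃[ i ] ∃[ p ] ∃[ q ] ∃[ R ] L ↭ (i , p) ∷ (i , q) ∷ R
repeatedColour [] = inj₁ []
repeatedColour {k} ((i , p) ∷ L) with i ∈? map proj₁ L
  where open DecMembership (_≟_ {k}) using (_∈?_)
... | yes i∈ with ∈-map⁻ proj₁ i∈
...   | (_ , q) , q∈ , refl = let R , perm = ∈⇒↭ q∈ in inj₂ (i , p , q , R , ↭-prep _ perm)
repeatedColour ((i , p) ∷ L) | no i∉ with repeatedColour L
... | inj₁ uniq = inj₁ (All.tabulate (λ j∈ → λ { refl → i∉ j∈ }) ∷ uniq)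
... | inj₂ (j , q , r , R , perm) = inj₂ (j , q , r , (i , p) ∷ R ,
        ↭-trans (↭-prep _ perm) (↭-trans (↭-swap _ _ ↭-refl) (↭-prep _ (↭-swap _ _ ↭-refl))))

valid-resp : ∀ {A B : Adj m} {L : ColouredPaths k m} → (∀ u v → B u v ≡ A u v) → Valid A L → Valid B L
valid-resp eq V = record { Valid V ; covers = λ u v → trans (eq u v) (Valid.covers V u v) }

-- Two paths of equal colour can always be joined at the price of one isolated vertex; as the number
-- of paths then drops, the bound ℓ on it drives the recursion.
onePathPerColour : ∀ ℓ j (A : Adj n) (L : ColouredPaths k (j + n)) → length L ≤ ℓ → Valid (addIso j A) L →
  ∃[ j′ ] Σ (ColouredPaths k (j′ + n)) λ M → Valid (addIso j′ A) M × Unique (map proj₁ M)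
onePathPerColour ℓ j A L len V with repeatedColour L
... | inj₁ uniq = j , L , V , uniq
... | inj₂ (i , [] , q , R , perm) = contradiction (All.head (Valid.long (valid-↭ perm V))) λ ()
... | inj₂ (i , _ ∷ _ , [] , R , perm) = contradiction (All.head (All.tail (Valid.long (valid-↭ perm V)))) λ ()
onePathPerColour zero j A L len V | inj₂ (i , x ∷ X , y ∷ Y , R , perm) =
  contradiction (≤-trans (≤-reflexive (sym (↭-length perm))) len) λ ()
onePathPerColour (suc ℓ) j A L len V | inj₂ (i , x ∷ X , y ∷ Y , R , perm) =
  let M , V′ , shorter = joinSameColour (valid-↭ perm V)
  in onePathPerColour ℓ (suc j) A M (s≤s⁻¹ (≤-trans shorter (≤-trans (≤-reflexive (sym (↭-length perm))) len)))
       (valid-resp (addIso-suc j A) V′)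

unique-length : ∀ (xs : List (Fin k)) → Unique xs → length xs ≤ k
unique-length {k} xs uniq = begin
  length xs                                   ≡⟨ length-∑ xs ⟩
  ∑ (λ _ → 1) xs                              ≡⟨ ∑-cong (λ x → sym (∑-δ x)) xs ⟩
  ∑ (λ x → ∑ (λ v → δ v x) (allFin k)) xs     ≡⟨ ∑-comm (λ x v → δ v x) xs (allFin k) ⟩
  ∑ (λ v → ∑ (δ v) xs) (allFin k)             ≤⟨ ∑-mono (unique-∑-δ xs uniq) (allFin k) ⟩
  ∑ (λ _ → 1) (allFin k)                      ≡⟨ trans (sym (length-∑ (allFin k))) (length-tabulate id) ⟩
  k ∎
  where open ≤-Reasoning

-- Each tip is joined to the hub by an even number of the cycles.
closeAtHub : ∀ {A : Adj m} {L : ColouredPaths k m} → Valid A L → Unique (map proj₁ L) → C2≤ (addIso 1 A) k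
closeAtHub {m} {k} {A} {L} V colours = oddCover (map (extend ∘ proj₂) L) (cyclic L unique long)
  (λ u v → trans (addIso-parity (pairs L) covers u v) (sym (trans (closed L long u v) (cong (_xor parity (map lift (pairs L)) u v) (spokes u v)))))
  (≤-trans (≤-reflexive (trans (length-map _ L) (sym (length-map proj₁ L)))) (unique-length (map proj₁ L) colours))
  where
  open Valid V
  cyclic : ∀ L → Unique (colouredVerts L) → All (λ cp → 2 ≤ length (proj₂ cp)) L → All Cyclic (map (extend ∘ proj₂) L)
  cyclic []            _    []       = []
  cyclic ((c , p) ∷ L) uniq (l ∷ ls) =
    ( All.map⁺ (All.tabulate (λ _ ())) ∷ Unique.map⁺ Fin.suc-injective (Unique.map⁻ (Unique-++ˡ (map (c ,_) p) uniq))
    , s≤s (≤-trans l (≤-reflexive (sym (length-map suc p)))) )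
    ∷ cyclic L (Unique-++ʳ (map (c ,_) p) uniq) ls
  spoke : Fin (suc m) → Fin (suc m) → Fin m → Bool
  spoke u v t = edge (zero , suc t) u v
  closed : ∀ L → All (λ cp → 2 ≤ length (proj₂ cp)) L → ∀ u v →
    parity (cyclesPairs (map (extend ∘ proj₂) L)) u v ≡ ⨁ (spoke u v) (tips L) xor parity (map lift (pairs L)) u v
  closed []                   _        u v = refl
  closed ((c , []) ∷ L)       (() ∷ _) u v
  closed ((c , x ∷ xs) ∷ L)   (_ ∷ ls) u v = trans (parity-++ (cyclePairs (extend (x ∷ xs))) (cyclesPairs (map (extend ∘ proj₂) L)) u v)
    (trans (cong₂ _xor_ (cong₂ _xor_ (trans (cong (λ l → edge (l , zero) u v) (lastOr-map suc x xs)) (edge-swap (suc (lastOr x xs)) zero u v))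
        (parity-extend x xs u v)) (closed L ls u v))
      (trans (solve 5 (λ a b p t q → (a :+ (b :+ p)) :+ (t :+ q) := (b :+ (a :+ t)) :+ (p :+ q)) refl
          (spoke u v (lastOr x xs)) (spoke u v x) (parity (map lift (pathPairs (x ∷ xs))) u v) (⨁ (spoke u v) (tips L)) (parity (map lift (pairs L)) u v))
        (cong ((spoke u v x xor (spoke u v (lastOr x xs) xor ⨁ (spoke u v) (tips L))) xor_)
          (sym (trans (cong (λ q → parity q u v) (map-++ lift (pathPairs (x ∷ xs)) (pairs L))) (parity-++ (map lift (pathPairs (x ∷ xs))) (map lift (pairs L)) u v))))))
    where open xor-∧-Solver using (solve; _:+_; _:=_)
  spokes : ∀ u v → ⨁ (spoke u v) (tips L) ≡ false
  spokes zero    zero    = ⨁-false (λ _ → refl) (tips L)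
  spokes zero    (suc v) = trans (⨁-cong (λ t → ∨-identityʳ (does (v ≟ t))) (tips L)) (even v)
  spokes (suc u) zero    = even u
  spokes (suc u) (suc v) = ⨁-false (λ _ → refl) (tips L)

-- From linear decompositions to coloured paths

-- Disjoint paths repeat no edge, so their union is also their sum modulo 2. Trivial paths are
-- dropped, since a path must have two different ends to be closed at the hub.
forestPaths : ∀ {F : Adj n} → LinearForest F →
  ∃[ Ds ] Unique (concat Ds) × All (λ D → 2 ≤ length D) Ds × (∀ u v → F u v ≡ parity (concatMap pathPairs Ds) u v)
forestPaths {n} {F} (ps , disjoint , eq) = proper Ds , proper-unique Ds unique , proper-long Ds , λ u v →
  trans (eq u v) (trans (sym (anyB-edges ps u v)) (trans (hasEdge-forest Ds unique u v) (cong (λ q → parity q u v) (sym (proper-pairs Ds)))))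
  where
  Ds = map Path.verts ps
  proper-pairs : ∀ (Ds : List (List (Fin n))) → concatMap pathPairs (proper Ds) ≡ concatMap pathPairs Ds
  proper-pairs []                 = refl
  proper-pairs ([] ∷ Ds)          = proper-pairs Ds
  proper-pairs ((_ ∷ []) ∷ Ds)    = proper-pairs Ds
  proper-pairs ((x ∷ y ∷ D) ∷ Ds) = cong (pathPairs (x ∷ y ∷ D) ++_) (proper-pairs Ds)
  unique : Unique (concat Ds)
  unique = Unique.concat⁺ (All.map⁺ (All.tabulate (λ {p} _ → Path.distinct p)))
    (AllPairs.map⁺ (AllPairs.map (λ disj {x} (x∈ , x∈′) → disj x x∈ x∈′) disjoint))
  anyB-edges : ∀ ps u v → hasEdge (concatMap pathPairs (map Path.verts ps)) u v ≡ anyB {n} (λ p → pathAdj p u v) ps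
  anyB-edges []       u v = refl
  anyB-edges (p ∷ ps) u v = trans (hasEdge-++ (pathPairs (Path.verts p)) _ u v) (cong (pathAdj p u v ∨_) (anyB-edges ps u v))
  inside : ∀ (Ds : List (List (Fin n))) {u v} → hasEdge (concatMap pathPairs Ds) u v ≡ true → u ∈ concat Ds
  inside (D ∷ Ds) {u} {v} h with hasEdge (pathPairs D) u v in eq′
  ... | true  = ∈-++⁺ˡ (proj₁ (hasEdge-path-∈ D {u} {v} eq′))
  ... | false = ∈-++⁺ʳ D (inside Ds {u} {v} (trans (cong (_∨ hasEdge (concatMap pathPairs Ds) u v) (sym eq′))
                  (trans (sym (hasEdge-++ (pathPairs D) (concatMap pathPairs Ds) u v)) h)))
  hasEdge-forest : ∀ (Ds : List (List (Fin n))) → Unique (concat Ds) → ∀ u v →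
    hasEdge (concatMap pathPairs Ds) u v ≡ parity (concatMap pathPairs Ds) u v
  hasEdge-forest []       _    u v = refl
  hasEdge-forest (D ∷ Ds) uniq u v = trans (hasEdge-++ (pathPairs D) (concatMap pathPairs Ds) u v)
    (trans (∨≡xor {hasEdge (pathPairs D) u v} (λ h h′ → Unique-++-disjoint D uniq (proj₁ (hasEdge-path-∈ D {u} {v} h)) (inside Ds {u} {v} h′)))
      (trans (cong₂ _xor_ (hasEdge-path D (Unique-++ˡ D uniq) u v) (hasEdge-forest Ds (Unique-++ʳ D uniq) u v))
        (sym (parity-++ (pathPairs D) (concatMap pathPairs Ds) u v))))

paint : Fin k → List (List (Fin m)) → ColouredPaths k m
paint c = map (c ,_)

paint-verts : ∀ (c : Fin k) (Ds : List (List (Fin m))) → colouredVerts (paint c Ds) ≡ map (c ,_) (concat Ds)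
paint-verts c []       = refl
paint-verts c (D ∷ Ds) = trans (cong (map (c ,_) D ++_) (paint-verts c Ds)) (sym (map-++ (c ,_) D (concat Ds)))

paint-pairs : ∀ (c : Fin k) (Ds : List (List (Fin m))) → pairs (paint c Ds) ≡ concatMap pathPairs Ds
paint-pairs c []       = refl
paint-pairs c (D ∷ Ds) = cong (pathPairs D ++_) (paint-pairs c Ds)

paintAll : ∀ {F : Fin k → Adj n} → (∀ i → LinearForest (F i)) → ∀ cs → Unique cs →
  Σ (ColouredPaths k n) λ L → Unique (colouredVerts L) × (∀ {c v} → (c , v) ∈ colouredVerts L → c ∈ cs) ×
  All (λ cp → 2 ≤ length (proj₂ cp)) L × (∀ u v → parity (pairs L) u v ≡ ⨁ (λ i → F i u v) cs)
paintAll forests []       _           = [] , [] , (λ ()) , [] , λ _ _ → refl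
paintAll forests (c ∷ cs) (c∉ ∷ uniq) =
  let L , uniqL , colours , longL , eqL = paintAll forests cs uniq
      Ds , uniqD , longD , eqD = forestPaths (forests c)
      verts-eq = trans (concatMap-++ _ (paint c Ds) L) (cong (_++ colouredVerts L) (paint-verts c Ds))
  in paint c Ds ++ L ,
     subst Unique (sym verts-eq) (Unique.++⁺ (Unique.map⁺ (cong proj₂) uniqD) uniqL (disjoint {concat Ds} {L} colours)) ,
     (λ {d} {v} i → colour {concat Ds} {L} colours (∈-++⁻ (map (c ,_) (concat Ds)) (subst ((d , v) ∈_) verts-eq i))) ,
     All.++⁺ (All.map⁺ longD) longL ,
     λ u v → trans (cong (λ q → parity q u v) (trans (concatMap-++ (pathPairs ∘ proj₂) (paint c Ds) L) (cong (_++ pairs L) (paint-pairs c Ds))))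
       (trans (parity-++ (concatMap pathPairs Ds) (pairs L) u v) (cong₂ _xor_ (sym (eqD u v)) (eqL u v)))
  where
  disjoint : ∀ {xs} {L : ColouredPaths _ _} → (∀ {c v} → (c , v) ∈ colouredVerts L → c ∈ cs) → ∀ {cv} → ¬ (cv ∈ map (c ,_) xs × cv ∈ colouredVerts L)
  disjoint colours (i , j) with ∈-map⁻ (c ,_) i
  ... | _ , _ , refl = All.lookup c∉ (colours j) refl
  colour : ∀ {xs} {L : ColouredPaths _ _} → (∀ {c v} → (c , v) ∈ colouredVerts L → c ∈ cs) → ∀ {d v} →
           (d , v) ∈ map (c ,_) xs ⊎ (d , v) ∈ colouredVerts L → d ∈ c ∷ cs
  colour colours (inj₂ j) = there (colours j)
  colour colours (inj₁ i) with ∈-map⁻ (c ,_) i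
  ... | _ , _ , refl = here refl

-- Each path meets its inner vertices twice and its ends once.
odd-degree : ∀ (L : ColouredPaths k m) v → odd (degree (pairs L) v) ≡ oddly v (tips L)
odd-degree []                  v = refl
odd-degree ((c , []) ∷ L)      v = odd-degree L v
odd-degree ((c , x ∷ xs) ∷ L)  v = begin
  odd (degree (P ++ pairs L) v) ≡⟨ cong odd (∑-++ (λ p → δ v (proj₁ p) + δ v (proj₂ p)) P (pairs L)) ⟩
  odd (degree P v + degree (pairs L) v) ≡⟨ odd-+ (degree P v) (degree (pairs L) v) ⟩
  odd (degree P v) xor odd (degree (pairs L) v) ≡⟨ cong₂ _xor_ path (odd-degree L v) ⟩
  (does (v ≟ x) xor does (v ≟ lastOr x xs)) xor oddly v (tips L) ≡⟨ xor-assoc (does (v ≟ x)) _ _ ⟩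
  oddly v (tips ((c , x ∷ xs) ∷ L)) ∎
  where
  open ≡-Reasoning
  P = pathPairs (x ∷ xs)
  total = ∑ (δ v) (x ∷ xs)
  path : odd (degree P v) ≡ does (v ≟ x) xor does (v ≟ lastOr x xs)
  path = begin
    -- The two ends are added twice. One copy completes the sources and the targets to two full
    -- lists of the vertices, which cancel modulo 2; the other copy remains as the result.
    odd (degree P v) ≡⟨ sym (odd-cancel (δ v x + δ v (lastOr x xs)) (degree P v)) ⟩
    odd (δ v x + δ v (lastOr x xs) + (δ v x + δ v (lastOr x xs)) + degree P v)
      ≡⟨ cong (λ d → odd (δ v x + δ v (lastOr x xs) + (δ v x + δ v (lastOr x xs)) + d)) (degree-split P v) ⟩
    odd (δ v x + δ v (lastOr x xs) + (δ v x + δ v (lastOr x xs)) + (outdeg P v + indeg P v))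
      ≡⟨ cong odd (solve 4 (λ a b o i → a :+ b :+ (a :+ b) :+ (o :+ i) := (o :+ b) :+ (a :+ i) :+ (a :+ b)) refl
           (δ v x) (δ v (lastOr x xs)) (outdeg P v) (indeg P v)) ⟩
    odd ((outdeg P v + δ v (lastOr x xs)) + (δ v x + indeg P v) + (δ v x + δ v (lastOr x xs)))
      ≡⟨ cong₂ (λ s t → odd (s + t + (δ v x + δ v (lastOr x xs)))) (∑-sources (δ v) x xs) (∑-targets (δ v) x xs) ⟩
    odd (total + total + (δ v x + δ v (lastOr x xs))) ≡⟨ odd-cancel total _ ⟩
    odd (δ v x + δ v (lastOr x xs)) ≡⟨ odd-+ (δ v x) _ ⟩
    odd (δ v x) xor odd (δ v (lastOr x xs)) ≡⟨ cong₂ _xor_ (odd-⟦⟧ (does (v ≟ x))) (odd-⟦⟧ (does (v ≟ lastOr x xs))) ⟩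
    does (v ≟ x) xor does (v ≟ lastOr x xs) ∎
    where open +-*-Solver using (solve; _:+_; _:=_)

pairs-distinct : ∀ (L : ColouredPaths k m) → Unique (colouredVerts L) → All (λ p → proj₁ p ≢ proj₂ p) (pairs L)
pairs-distinct []            _    = []
pairs-distinct ((c , p) ∷ L) uniq = All.++⁺ (pathPairs-distinct p (Unique.map⁻ (Unique-++ˡ (map (c ,_) p) uniq)))
  (pairs-distinct L (Unique-++ʳ (map (c ,_) p) uniq))

-- Each edge lies in exactly one of the edge-disjoint forests, so exactly one summand is true there.
decomposition-xor : ∀ {G : Graph n} ((F , _) : LinearDecomp G k) → ∀ u v → adj G u v ≡ ⨁ (λ i → F i u v) (allFin k)
decomposition-xor {n} {k} {G} (F , _ , disjoint , cover , inside) u v with adj G u v in eq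
... | true = let i , Fi = cover u v eq in sym (begin
    ⨁ (λ j → F j u v) (allFin k)           ≡⟨ ⨁-cong (only i Fi) (allFin k) ⟩
    ⨁ (λ j → does (j ≟ i)) (allFin k)      ≡⟨ sym (⨁-cong (λ j → odd-⟦⟧ (does (j ≟ i))) (allFin k)) ⟩
    ⨁ (λ j → odd (δ j i)) (allFin k)       ≡⟨ sym (odd-∑ (λ j → δ j i) (allFin k)) ⟩
    odd (∑ (λ j → δ j i) (allFin k))       ≡⟨ cong odd (∑-δ i) ⟩
    true ∎)
  where
  open ≡-Reasoning
  only : ∀ i → F i u v ≡ true → ∀ j → F j u v ≡ does (j ≟ i)
  only i Fi j with j ≟ i
  ... | yes refl = Fi
  ... | no  j≢i  = disjoint i j (j≢i ∘ sym) u v Fi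
... | false = sym (⨁-false absent (allFin k))
  where
  absent : ∀ i → F i u v ≡ false
  absent i with F i u v in Fi
  ... | false = refl
  ... | true  = trans (sym (inside i u v Fi)) eq

decomposition-valid : ∀ {G : Graph n} → Eulerian G → LinearDecomp G k → Σ (ColouredPaths k n) (Valid (adj G))
decomposition-valid {n} {k} {G} even D = L , record
  { unique = proj₁ (proj₂ painted)
  ; long   = proj₁ (proj₂ (proj₂ (proj₂ painted)))
  ; even   = λ v → trans (sym (odd-degree L v)) (trans (cong odd (sym (∑-count (pairs-distinct L (proj₁ (proj₂ painted))) v)))
      (trans (odd-∑ (count (pairs L) v) (allFin n)) (trans (⨁-cong (λ u → trans (odd-count (pairs L) v u) (sym (covers v u))) (allFin n))
        (trans (sym (trans (odd-∑ (λ u → ⟦ adj G v u ⟧) (allFin n)) (⨁-cong (λ u → odd-⟦⟧ (adj G v u)) (allFin n))))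
          (trans (cong odd (sym (sum-map (λ u → ⟦ adj G v u ⟧) (allFin n)))) (even⇒¬odd (even v)))))))
  ; covers = covers }
  where
  painted = paintAll (proj₁ (proj₂ D)) (allFin k) (Unique.allFin⁺ k)
  L = proj₁ painted
  covers : ∀ u v → adj G u v ≡ parity (pairs L) u v
  covers u v = trans (decomposition-xor {G = G} D u v) (sym (proj₂ (proj₂ (proj₂ (proj₂ painted))) u v))

c₂iso≤la : ∀ (G : Graph n) → Eulerian G → ∀ k → LinearDecomp G k → C2iso≤ G k
c₂iso≤la G even k D =
  let L , V = decomposition-valid {G = G} even D
      j , M , V′ , colours = onePathPerColour (length L) 0 (adj G) L ≤-refl V
      Xs , cover , len = closeAtHub V′ colours
  in suc j , Xs , (λ u v → trans (cover u v) (sym (addIso-suc j (adj G) u v))) , len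

theorem1p4 : ∀ {n} (G : Graph n) → Eulerian G →
    (¬ DisjointCycleUnion G → C2top≡ G ⌊ Δ G /2⌋)
    × (∀ (k : ℕ) → LinearDecomp G k → C2iso≤ G k)
    × C2≤ (adj G) (Δ G)
theorem1p4 G even = (λ ¬union → c₂top≤ G even ¬union , c₂top≥ G) , c₂iso≤la G even , c₂≤Δ G even
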